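{- Let $L$ be a punctual linear order which is relatively $\Delta^0_2$-categorical but not relatively $\Delta^0_1$-categorical. Then $\mathrm{PrCat}(L)=\mathrm{Cone}(\Delta^0_2)$.
   Context: A structure is punctual if its domain is $\omega$ and its relations are uniformly primitive recursive. A computable structure $A$ is relatively $\Delta^0_\alpha$-categorical if for every copy $B\cong A$ with domain $\omega$ there is an isomorphism $f:B\to A$ with $f\in\Delta^0_\alpha$ relative to the atomic diagram of $B$. For total $f,g:\omega\to\omega$, write $f\le_{PR}g$ if $f$ is primitive recursive relative to $g$; the induced equivalence classes are PR-degrees, and $f\le_{PR}\mathbf d$ means $f\le_{PR}$ a member of $\mathbf d$. For a punctual structure $A$, $\mathrm{PrCat}(A)$ is the set of PR-degrees $\mathbf d$ such that for every punctual $B\cong A$ there is an isomorphism $f:A\to B$ with $f\le_{PR}\mathbf d$ and $f^{ -1}\le_{PR}\mathbf d$. $\mathrm{Cone}(\Delta^0_2)$ is the set of PR-degrees $\mathbf d$ such that $f\le_{PR}\mathbf d$ for every total $\Delta^0_2$ function $f:\omega\to\omega$. -}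

module Defs where

open import Data.Nat using (ℕ; zero; suc; _<_)
open import Data.Fin using (Fin)
open import Data.Vec using (Vec; []; _∷_; lookup; head)
open import Data.Bool using (Bool; true; false; if_then_else_)
open import Data.Maybe using (Maybe; just; nothing)
open import Data.Unit using (⊤; tt)
open import Data.Product using (Σ; ∃; _×_; _,_)
open import Data.Sum using (_⊎_)
open import Relation.Nullary using (¬_)
open import Relation.Binary.PropositionalEquality using (_≡_; _≢_)

Orc : Maybe ℕ → Set
Orc nothing  = ⊤
Orc (just k) = Vec ℕ k → ℕ

data PR (o : Maybe ℕ) : ℕ → Set where
  zro  : ∀ {n} → PR o n
  sc   : PR o 1
  proj : ∀ {n} → Fin n → PR o n
  comp : ∀ {m n} → PR o m → Vec (PR o n) m → PR o n
  prec : ∀ {n} → PR o n → PR o (suc (suc n)) → PR o (suc n)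
  orc  : ∀ {k} → o ≡ just k → PR o k

callOrc : ∀ {o k} → o ≡ just k → Orc o → Vec ℕ k → ℕ
callOrc _≡_.refl O = O

mutual
  evalPR : ∀ {o n} → Orc o → PR o n → Vec ℕ n → ℕ
  evalPR O zro xs = 0
  evalPR O sc (x ∷ []) = suc x
  evalPR O (proj i) xs = lookup xs i
  evalPR O (comp f gs) xs = evalPR O f (evalPRs O gs xs)
  evalPR O (prec f g) (zero ∷ xs) = evalPR O f xs
  evalPR O (prec f g) (suc y ∷ xs) =
    evalPR O g (y ∷ evalPR O (prec f g) (y ∷ xs) ∷ xs)
  evalPR O (orc e) xs = callOrc e O xs

  evalPRs : ∀ {o n m} → Orc o → Vec (PR o n) m → Vec ℕ n → Vec ℕ m
  evalPRs O [] xs = []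
  evalPRs O (g ∷ gs) xs = evalPR O g xs ∷ evalPRs O gs xs

data Rec (o : Maybe ℕ) : ℕ → Set where
  zro  : ∀ {n} → Rec o n
  sc   : Rec o 1
  proj : ∀ {n} → Fin n → Rec o n
  comp : ∀ {m n} → Rec o m → Vec (Rec o n) m → Rec o n
  prec : ∀ {n} → Rec o n → Rec o (suc (suc n)) → Rec o (suc n)
  mu   : ∀ {n} → Rec o (suc n) → Rec o n
  orc  : ∀ {k} → o ≡ just k → Rec o k

mutual
  data Ev {o : Maybe ℕ} (O : Orc o) : ∀ {n} → Rec o n → Vec ℕ n → ℕ → Set where
    ev-zro  : ∀ {n} {xs : Vec ℕ n} → Ev O zro xs 0
    ev-sc   : ∀ {x} → Ev O sc (x ∷ []) (suc x)
    ev-proj : ∀ {n} {i : Fin n} {xs} → Ev O (proj i) xs (lookup xs i)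
    ev-comp : ∀ {m n} {f : Rec o m} {gs : Vec (Rec o n) m} {xs ys v} →
              Evs O gs xs ys → Ev O f ys v → Ev O (comp f gs) xs v
    ev-prec0 : ∀ {n} {f : Rec o n} {g xs v} →
               Ev O f xs v → Ev O (prec f g) (zero ∷ xs) v
    ev-precS : ∀ {n} {f : Rec o n} {g y xs w v} →
               Ev O (prec f g) (y ∷ xs) w → Ev O g (y ∷ w ∷ xs) v →
               Ev O (prec f g) (suc y ∷ xs) v
    ev-mu   : ∀ {n} {f : Rec o (suc n)} {xs y} →
              Ev O f (y ∷ xs) 0 →
              (∀ z → z < y → ∃ λ v → Ev O f (z ∷ xs) (suc v)) →
              Ev O (mu f) xs y
    ev-orc  : ∀ {k} (e : o ≡ just k) {xs : Vec ℕ k} → Ev O (orc e) xs (callOrc e O xs)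

  data Evs {o : Maybe ℕ} (O : Orc o) : ∀ {n m} → Vec (Rec o n) m → Vec ℕ n → Vec ℕ m → Set where
    evs-[] : ∀ {n} {xs : Vec ℕ n} → Evs O [] xs []
    evs-∷  : ∀ {n m} {g : Rec o n} {gs : Vec (Rec o n) m} {xs v vs} →
             Ev O g xs v → Evs O gs xs vs → Evs O (g ∷ gs) xs (v ∷ vs)

Computable : ∀ {o m} → Orc o → (Vec ℕ m → Set) → Set
Computable {o} {m} O R =
  Σ (Rec o m) λ t → ∀ xs → (R xs → Ev O t xs 1) × (¬ R xs → Ev O t xs 0)

-- Σ⁰₂ and Π⁰₂ relative to O.  The matrix is an O-computable relation,
-- given by a total O-recursive term t with values in {0,1}; the matrix
-- holds at a tuple iff t outputs 1 there.
TotalBool : ∀ {o m} → Orc o → Rec o m → Set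
TotalBool O t = ∀ xs → Ev O t xs 0 ⊎ Ev O t xs 1

Sigma2 : ∀ {o m} → Orc o → (Vec ℕ m → Set) → Set
Sigma2 {o} {m} O R =
  Σ (Rec o (suc (suc m))) λ t → TotalBool O t ×
    (∀ xs → (R xs → ∃ λ a → ∀ b → Ev O t (b ∷ a ∷ xs) 1) ×
            ((∃ λ a → ∀ b → Ev O t (b ∷ a ∷ xs) 1) → R xs))

Pi2 : ∀ {o m} → Orc o → (Vec ℕ m → Set) → Set
Pi2 {o} {m} O R =
  Σ (Rec o (suc (suc m))) λ t → TotalBool O t ×
    (∀ xs → (R xs → ∀ a → ∃ λ b → Ev O t (b ∷ a ∷ xs) 1) ×
            ((∀ a → ∃ λ b → Ev O t (b ∷ a ∷ xs) 1) → R xs))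

Graph : (ℕ → ℕ) → Vec ℕ 2 → Set
Graph f (x ∷ y ∷ []) = f x ≡ y

Delta1Fun : ∀ {o} → Orc o → (ℕ → ℕ) → Set
Delta1Fun O f = Computable O (Graph f)

Delta2Fun : ∀ {o} → Orc o → (ℕ → ℕ) → Set
Delta2Fun O f = Sigma2 O (Graph f) × Pi2 O (Graph f)

Rel : Set
Rel = ℕ → ℕ → Bool

IsLinearOrder : Rel → Set
IsLinearOrder R =
  (∀ x → R x x ≡ false) ×
  (∀ x y z → R x y ≡ true → R y z ≡ true → R x z ≡ true) ×
  (∀ x y → x ≢ y → (R x y ≡ true) ⊎ (R y x ≡ true))

IsIso : Rel → Rel → (ℕ → ℕ) → Set
IsIso A B f =
  (∀ x y → A x y ≡ B (f x) (f y)) ×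
  (∀ x y → f x ≡ f y → x ≡ y) ×
  (∀ y → ∃ λ x → f x ≡ y)

Isomorphic : Rel → Rel → Set
Isomorphic A B = ∃ λ f → IsIso A B f

Punctual : Rel → Set
Punctual A = Σ (PR nothing 2) λ t →
  ∀ x y → evalPR tt t (x ∷ y ∷ []) ≡ (if A x y then 1 else 0)

diag : Rel → Orc (just 2)
diag B (x ∷ y ∷ []) = if B x y then 1 else 0

RelDelta1Cat : Rel → Set
RelDelta1Cat A = ∀ (B : Rel) → Isomorphic B A →
  ∃ λ f → IsIso B A f × Delta1Fun (diag B) f

RelDelta2Cat : Rel → Set
RelDelta2Cat A = ∀ (B : Rel) → Isomorphic B A →
  ∃ λ f → IsIso B A f × Delta2Fun (diag B) f

-- Primitive recursive reducibility and the sets PrCat, Cone(Δ⁰₂)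
-- (degree sets are represented by their members g : ℕ → ℕ; both
-- properties are invariant under ≡_PR)

_≤PR_ : (ℕ → ℕ) → (ℕ → ℕ) → Set
f ≤PR g = Σ (PR (just 1) 1) λ t →
  ∀ n → evalPR {just 1} (λ v → g (head v)) t (n ∷ []) ≡ f n

InPrCat : Rel → (ℕ → ℕ) → Set
InPrCat A g = ∀ (B : Rel) → Punctual B → Isomorphic A B →
  ∃ λ f → ∃ λ h → IsIso A B f × (∀ x → h (f x) ≡ x) × (∀ y → f (h y) ≡ y) ×
    f ≤PR g × h ≤PR g

InConeDelta2 : (ℕ → ℕ) → Set
InConeDelta2 g = ∀ (f : ℕ → ℕ) → Delta2Fun {nothing} tt f → f ≤PR g

-- From the cone: apply relative Δ⁰₂-categoricity to a punctual copy and replace the oracle for its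
-- diagram by the primitive recursive function computing it.
--
-- Into the cone: in a sufficiently generic copy of L the Δ⁰₂ isomorphism is forced.  Over finitely many
-- parameters this gives every tuple an extension that is determined up to automorphism by having gaps
-- at least as large as those of the tuples compared with it.  Collapsing such tuples into runs of
-- consecutive elements shows that L is a finite sum of points and copies of ω, ω* and N·η.  If only
-- points and copies of η occur, L has finitely many adjacencies and back-and-forth makes it relatively
-- Δ⁰₁-categorical.  Otherwise L has a punctual copy B with primitive recursive immediate successors and
-- predecessors and, for every Δ⁰₂ function f, a punctual copy C in which each change of a guess at f n
-- inserts a new neighbour of an element b n.  Isomorphisms from L to B and C lead to the neighbour of
-- b n in C, whose index bounds the stage at which the guess has settled.

module Submission where

open import Defs
open import Data.Nat
open import Data.Nat.Properties
open import Data.Nat.DivMod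
open import Data.Nat.Divisibility using (divides-refl)
open import Data.Bool using (Bool; true; false; if_then_else_; _∧_; _∨_; not)
open import Data.Bool.Properties using (not-injective)
open import Data.Empty using (⊥; ⊥-elim)
open import Data.Fin using (Fin; zero; suc; toℕ; fromℕ<)
open import Data.Fin.Properties using (toℕ<n; toℕ-fromℕ<)
open import Data.List using (List; []; _∷_; _++_; length; map; upTo)
open import Data.List.Membership.Propositional using (_∈_)
open import Data.List.Membership.Propositional.Properties using (∈-map⁺; ∈-map⁻; ∈-++⁺ˡ; ∈-++⁺ʳ; ∈-++⁻; ∈-upTo⁺; ∈-upTo⁻)
open import Data.List.Relation.Unary.Any using (here; there)
open import Data.List.Properties using (map-++)
open import Data.Maybe using (Maybe; just; nothing)
open import Data.Product using (Σ; ∃; _×_; _,_; proj₁; proj₂; swap)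
open import Data.Sum using (_⊎_; inj₁; inj₂; [_,_]′)
open import Data.Unit using (⊤; tt)
open import Data.Vec using (Vec; []; _∷_; lookup; head; tail; tabulate)
open import Data.Vec.Properties using (tabulate∘lookup)
open import Function using (_∘_; id; case_of_; flip)
open import Relation.Nullary using (¬_; Dec; yes; no)
open import Relation.Binary.Definitions using (tri<; tri≈; tri>)
open import Relation.Binary.PropositionalEquality using (_≡_; _≢_; refl; sym; trans; cong; cong₂; subst)

-- Primitive recursive functions

-- Immediate neighbourhood is what an isomorphism must respect and a punctual copy can hide: in B a
-- neighbour is computed, in C it can appear late. A search would leave the primitive recursive
-- functions, so the neighbour is fetched through two isomorphisms instead. The obstacle for the
-- structure of L is that the hypothesis gives a Δ⁰₂ isomorphism for each copy separately, with no
-- uniformity. Forcing supplies it: that the isomorphism takes i to y is a Σ⁰₂ statement, forcing it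
-- means that no extension refutes the matrix, and refutability is an existential property of a
-- tuple. Hence whatever a tuple forces is also forced by each tuple satisfying no more existential
-- formulas. In a linear order this is a comparison of gap sizes, which is why domination takes the
-- place of equality of gaps. Empty gaps are dominated by all and infinite gaps dominate all, so
-- tuples can be compared with tuples made of runs; the automorphisms obtained make arbitrary
-- elements look like members of these runs. In N·η with N ≥ 2 no part of type ω is at hand for the
-- coding, so a summand built along ω is absorbed into it.

bit : Bool → ℕ
bit b = if b then 1 else 0

-- The value k means that no i below k satisfies p, so `leastBelow p k <ᵇ k` is the bounded
-- existential quantifier.
leastBelow : (ℕ → Bool) → ℕ → ℕ
leastBelow p zero = 0
leastBelow p (suc k) = if leastBelow p k <ᵇ k then leastBelow p k else (if p k then k else suc k)

<⇒ᵇ : ∀ {m n} → m < n → (m <ᵇ n) ≡ true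
<⇒ᵇ {zero} {suc n} _ = refl
<⇒ᵇ {suc m} {suc n} (s≤s h) = <⇒ᵇ h

ᵇ⇒< : ∀ {m n} → (m <ᵇ n) ≡ true → m < n
ᵇ⇒< {zero} {suc n} _ = s≤s z≤n
ᵇ⇒< {suc m} {suc n} h = s≤s (ᵇ⇒< h)

≮⇒ᵇ : ∀ {m n} → ¬ m < n → (m <ᵇ n) ≡ false
≮⇒ᵇ {m} {n} h with m <ᵇ n in e
... | true = ⊥-elim (h (ᵇ⇒< e))
... | false = refl

ᵇ⇒≮ : ∀ {m n} → (m <ᵇ n) ≡ false → ¬ m < n
ᵇ⇒≮ e h with trans (sym e) (<⇒ᵇ h)
... | ()

≡ᵇ-refl : ∀ m → (m ≡ᵇ m) ≡ true
≡ᵇ-refl zero = refl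
≡ᵇ-refl (suc m) = ≡ᵇ-refl m

ᵇ⇒≡ : ∀ {m n} → (m ≡ᵇ n) ≡ true → m ≡ n
ᵇ⇒≡ {zero} {zero} _ = refl
ᵇ⇒≡ {suc m} {suc n} h = cong suc (ᵇ⇒≡ h)

true≢false : ∀ {b} → b ≡ true → b ≡ false → ⊥
true≢false refl ()

¬true⇒false : ∀ {b} → ¬ b ≡ true → b ≡ false
¬true⇒false {true} h = ⊥-elim (h refl)
¬true⇒false {false} h = refl

leastBelow-≤ : ∀ p k → leastBelow p k ≤ k
leastBelow-≤ p zero = z≤n
leastBelow-≤ p (suc k) with leastBelow p k <ᵇ k | p k
... | true | _ = m≤n⇒m≤1+n (leastBelow-≤ p k)
... | false | true = n≤1+n k
... | false | false = ≤-refl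

leastBelow-true : ∀ p k → leastBelow p k < k → p (leastBelow p k) ≡ true
leastBelow-true p (suc k) h with leastBelow p k <ᵇ k in e | p k in e′
... | true | _ = leastBelow-true p k (ᵇ⇒< e)
... | false | true = e′
... | false | false = ⊥-elim (<-irrefl refl h)

leastBelow-min : ∀ p k i → i < leastBelow p k → p i ≡ false
leastBelow-min p (suc k) i h with leastBelow p k <ᵇ k in e | p k in e′
... | true | _ = leastBelow-min p k i h
... | false | true = leastBelow-min p k i (<-≤-trans h (≮⇒≥ (ᵇ⇒≮ e)))
... | false | false with m≤n⇒m<n∨m≡n (≤-pred h)
... | inj₁ i<k = leastBelow-min p k i (<-≤-trans i<k (≮⇒≥ (ᵇ⇒≮ e)))
... | inj₂ refl = e′

leastBelow-unique : ∀ p k i → i < k → p i ≡ true → (∀ j → j < i → p j ≡ false) → leastBelow p k ≡ i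
leastBelow-unique p k i i<k pi mn with <-cmp (leastBelow p k) i
... | tri≈ _ e _ = e
... | tri< l _ _ = ⊥-elim (true≢false (leastBelow-true p k (<-trans l i<k)) (mn _ l))
... | tri> _ _ g = ⊥-elim (true≢false pi (leastBelow-min p k i g))

-- A function is carried together with a term and a proof that the term computes it. Programs are
-- then assembled from combinators that take the correctness proof along.
E : ∀ {o} → Orc o → ∀ n → (Vec ℕ n → ℕ) → Set
E {o} O n f = Σ (PR o n) λ t → ∀ xs → evalPR O t xs ≡ f xs

Es : ∀ {o} → Orc o → ∀ n m → (Vec ℕ n → Vec ℕ m) → Set
Es {o} O n m f = Σ (Vec (PR o n) m) λ t → ∀ xs → evalPRs O t xs ≡ f xs

EB : ∀ {o} → Orc o → ∀ n → (Vec ℕ n → Bool) → Set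
EB O n p = E O n (λ xs → bit (p xs))

a0 : ∀ {n} → Vec ℕ (1 + n) → ℕ
a0 = head
a1 : ∀ {n} → Vec ℕ (2 + n) → ℕ
a1 xs = head (tail xs)
a2 : ∀ {n} → Vec ℕ (3 + n) → ℕ
a2 xs = head (tail (tail xs))
a3 : ∀ {n} → Vec ℕ (4 + n) → ℕ
a3 xs = head (tail (tail (tail xs)))

F1 : ∀ {o} → Orc o → (ℕ → ℕ) → Set
F1 O f = E O 1 (λ xs → f (a0 xs))
F2 : ∀ {o} → Orc o → (ℕ → ℕ → ℕ) → Set
F2 O f = E O 2 (λ xs → f (a0 xs) (a1 xs))
B2 : ∀ {o} → Orc o → (ℕ → ℕ → Bool) → Set
B2 O p = EB O 2 (λ xs → p (a0 xs) (a1 xs))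

cond : ℕ → ℕ → ℕ → ℕ
cond zero x y = y
cond (suc _) x y = x

cond-bit : ∀ b {x y} → cond (bit b) x y ≡ (if b then x else y)
cond-bit true = refl
cond-bit false = refl

sign : ℕ → ℕ
sign k = cond k 1 0

sign-∸ : ∀ x y → sign (y ∸ x) ≡ bit (x <ᵇ y)
sign-∸ zero zero = refl
sign-∸ zero (suc y) = refl
sign-∸ (suc x) zero = refl
sign-∸ (suc x) (suc y) = sign-∸ x y

≡ᵇ-<ᵇ : ∀ x y → not (x <ᵇ y) ∧ not (y <ᵇ x) ≡ (x ≡ᵇ y)
≡ᵇ-<ᵇ zero zero = refl
≡ᵇ-<ᵇ zero (suc y) = refl
≡ᵇ-<ᵇ (suc x) zero = refl
≡ᵇ-<ᵇ (suc x) (suc y) = ≡ᵇ-<ᵇ x y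

ps-eval : ∀ {o} {O : Orc o} {n m} (h : Fin m → Fin n) xs →
  evalPRs O (tabulate (λ i → proj (h i))) xs ≡ tabulate (λ i → lookup xs (h i))
ps-eval {m = zero} h xs = refl
ps-eval {m = suc m} h xs = cong (lookup xs (h zero) ∷_) (ps-eval (h ∘ suc) xs)

module _ {o : Maybe ℕ} {O : Orc o} where

  infixr 5 _∷E_

  Ecast : ∀ {n f g} → (∀ xs → f xs ≡ g xs) → E O n f → E O n g
  Ecast h (t , p) = t , λ xs → trans (p xs) (h xs)

  []E : ∀ {n} → Es O n 0 (λ _ → [])
  []E = [] , λ _ → refl

  _∷E_ : ∀ {n m g gs} → E O n g → Es O n m gs → Es O n (suc m) (λ xs → g xs ∷ gs xs)
  (t , p) ∷E (ts , ps) = t ∷ ts , λ xs → cong₂ _∷_ (p xs) (ps xs)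

  app : ∀ {n m f gs} → E O m f → Es O n m gs → E O n (λ xs → f (gs xs))
  app {f = f} (t , p) (ts , ps) = comp t ts , λ xs → trans (p _) (cong f (ps xs))

  v0 : ∀ {n} → E O (1 + n) a0
  v0 = proj zero , λ { (x ∷ xs) → refl }
  v1 : ∀ {n} → E O (2 + n) a1
  v1 = proj (suc zero) , λ { (x ∷ y ∷ xs) → refl }
  v2 : ∀ {n} → E O (3 + n) a2
  v2 = proj (suc (suc zero)) , λ { (x ∷ y ∷ z ∷ xs) → refl }
  v3 : ∀ {n} → E O (4 + n) a3
  v3 = proj (suc (suc (suc zero))) , λ { (x ∷ y ∷ z ∷ w ∷ xs) → refl }

  tailEs : ∀ {n} → Es O (suc n) n tail
  tailEs = tabulate (λ i → proj (suc i)) , λ { (x ∷ xs) →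
    trans (ps-eval suc (x ∷ xs)) (tabulate∘lookup xs) }

  tail2Es : ∀ {n} → Es O (2 + n) n (λ xs → tail (tail xs))
  tail2Es = tabulate (λ i → proj (suc (suc i))) , λ { (x ∷ y ∷ xs) →
    trans (ps-eval (λ i → suc (suc i)) (x ∷ y ∷ xs)) (tabulate∘lookup xs) }

  tail3Es : ∀ {n} → Es O (3 + n) n (λ xs → tail (tail (tail xs)))
  tail3Es = tabulate (λ i → proj (suc (suc (suc i)))) , λ { (x ∷ y ∷ z ∷ xs) →
    trans (ps-eval (λ i → suc (suc (suc i))) (x ∷ y ∷ z ∷ xs)) (tabulate∘lookup xs) }

  idEs : ∀ {n} → Es O n n (λ xs → xs)
  idEs = tabulate (λ i → proj i) , λ xs → trans (ps-eval (λ i → i) xs) (tabulate∘lookup xs)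

  wk : ∀ {n f} → E O n f → E O (suc n) (λ ys → f (tail ys))
  wk e = app e tailEs

  app1 : ∀ {n e} (f : ℕ → ℕ) → F1 O f → E O n e → E O n (λ xs → f (e xs))
  app1 f tf e = app tf (e ∷E []E)

  app2 : ∀ {n e e′} (f : ℕ → ℕ → ℕ) → F2 O f → E O n e → E O n e′ → E O n (λ xs → f (e xs) (e′ xs))
  app2 f tf e e′ = app tf (e ∷E e′ ∷E []E)

  pr : ∀ {n b s} → E O n b → E O (2 + n) s → (f : ℕ → Vec ℕ n → ℕ) →
    (∀ ps → f 0 ps ≡ b ps) → (∀ k ps → f (suc k) ps ≡ s (k ∷ f k ps ∷ ps)) →
    E O (suc n) (λ xs → f (head xs) (tail xs))
  pr {n} {b} {s} (tb , pb) (ts , ps) f h0 hs = prec tb ts , λ { (k ∷ xs) → go k xs }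
    where
    go : ∀ k xs → evalPR O (prec tb ts) (k ∷ xs) ≡ f k xs
    go zero xs = trans (pb xs) (sym (h0 xs))
    go (suc k) xs = trans (ps _) (trans (cong (λ z → s (k ∷ z ∷ xs)) (go k xs)) (sym (hs k xs)))

  sucE : ∀ {n e} → E O n e → E O n (λ xs → suc (e xs))
  sucE = app1 suc (sc , λ { (x ∷ []) → refl })

  cst : ∀ {n} c → E O n (λ _ → c)
  cst zero = zro , λ _ → refl
  cst (suc c) = sucE (cst c)

  infixl 6 _+E_ _∸E_
  infixl 7 _*E_
  _+E_ : ∀ {n e e′} → E O n e → E O n e′ → E O n (λ xs → e xs + e′ xs)
  _+E_ = app2 _+_ (pr v0 (sucE v1) (λ k ps → k + head ps) (λ _ → refl) (λ _ _ → refl))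

  _*E_ : ∀ {n e e′} → E O n e → E O n e′ → E O n (λ xs → e xs * e′ xs)
  _*E_ = app2 _*_ (pr (cst 0) (v2 +E v1) (λ k ps → k * head ps) (λ _ → refl) (λ _ _ → refl))

  predE : ∀ {n e} → E O n e → E O n (λ xs → pred (e xs))
  predE = app1 pred (pr (cst 0) v0 (λ k ps → pred k) (λ _ → refl) (λ _ _ → refl))

  _∸E_ : ∀ {n e e′} → E O n e → E O n e′ → E O n (λ xs → e xs ∸ e′ xs)
  e ∸E e′ = app2 (λ x y → y ∸ x)
    (pr v0 (predE v1) (λ k ps → head ps ∸ k) (λ _ → refl) (λ k ps → sym (pred[m∸n]≡m∸[1+n] (head ps) k))) e′ e

  condE : ∀ {n c x y} → E O n c → E O n x → E O n y → E O n (λ xs → cond (c xs) (x xs) (y xs))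
  condE c x y = app (pr v1 v2 (λ k ps → cond k (a0 ps) (a1 ps)) (λ _ → refl) (λ _ _ → refl)) (c ∷E x ∷E y ∷E []E)

  ifE : ∀ {n p x y} → EB O n p → E O n x → E O n y → E O n (λ xs → if p xs then x xs else y xs)
  ifE {p = q} p x y = Ecast (λ xs → cond-bit (q xs)) (condE p x y)

  ltB : ∀ {n e e′} → E O n e → E O n e′ → EB O n (λ xs → e xs <ᵇ e′ xs)
  ltB {e = x} {y} e e′ = Ecast (λ xs → sign-∸ (x xs) (y xs)) (condE (e′ ∸E e) (cst 1) (cst 0))

  trueB : ∀ {n} → EB O n (λ _ → true)
  trueB = cst 1
  falseB : ∀ {n} → EB O n (λ _ → false)
  falseB = cst 0

  if-bit : ∀ p {q r} → (if p then bit q else bit r) ≡ bit (if p then q else r)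
  if-bit true = refl
  if-bit false = refl

  ifB : ∀ {n p q r} → EB O n p → EB O n q → EB O n r → EB O n (λ xs → if p xs then q xs else r xs)
  ifB {p = p} a b c = Ecast (λ xs → if-bit (p xs)) (ifE a b c)

  Bcast : ∀ {n f g} → (∀ xs → f xs ≡ g xs) → EB O n f → EB O n g
  Bcast h = Ecast (λ xs → cong bit (h xs))

  notB : ∀ {n p} → EB O n p → EB O n (λ xs → not (p xs))
  notB {p = p} a = Bcast (λ xs → lem₁ (p xs)) (ifB a falseB trueB)
    where
    lem₁ : ∀ b → (if b then false else true) ≡ not b
    lem₁ true = refl
    lem₁ false = refl

  andB : ∀ {n p q} → EB O n p → EB O n q → EB O n (λ xs → p xs ∧ q xs)
  andB {p = p} a b = Bcast (λ xs → lem₁ (p xs)) (ifB a b falseB)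
    where
    lem₁ : ∀ b {c} → (if b then c else false) ≡ b ∧ c
    lem₁ true = refl
    lem₁ false = refl

  orB : ∀ {n p q} → EB O n p → EB O n q → EB O n (λ xs → p xs ∨ q xs)
  orB {p = p} a b = Bcast (λ xs → lem₁ (p xs)) (ifB a trueB b)
    where
    lem₁ : ∀ b {c} → (if b then true else c) ≡ b ∨ c
    lem₁ true = refl
    lem₁ false = refl

  eqB : ∀ {n e e′} → E O n e → E O n e′ → EB O n (λ xs → e xs ≡ᵇ e′ xs)
  eqB {e = x} {y} e e′ = Bcast (λ xs → ≡ᵇ-<ᵇ (x xs) (y xs)) (andB (notB (ltB e e′)) (notB (ltB e′ e)))

  leastBelowE : ∀ {n k} {p : ℕ → Vec ℕ n → Bool} → EB O (suc n) (λ ys → p (head ys) (tail ys)) → E O n k →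
    E O n (λ xs → leastBelow (λ i → p i xs) (k xs))
  leastBelowE {n} {k} {p} tp tk = app
    (pr (cst 0) (ifE (ltB v1 v0) v1 (ifE (app tp (v0 ∷E tail2Es)) v0 (sucE v0)))
      (λ j ps → leastBelow (λ i → p i ps) j) (λ _ → refl) (λ _ _ → refl))
    (tk ∷E idEs)

  anyB : ∀ {n k} {p : ℕ → Vec ℕ n → Bool} → EB O (suc n) (λ ys → p (head ys) (tail ys)) → E O n k →
    EB O n (λ xs → leastBelow (λ i → p i xs) (k xs) <ᵇ k xs)
  anyB tp tk = ltB (leastBelowE tp tk) tk

mutual
  liftPR : ∀ {o n} → PR nothing n → PR o n
  liftPR zro = zro
  liftPR sc = sc
  liftPR (proj i) = proj i
  liftPR (comp t ts) = comp (liftPR t) (liftPRs ts)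
  liftPR (prec t u) = prec (liftPR t) (liftPR u)
  liftPR (orc ())

  liftPRs : ∀ {o n m} → Vec (PR nothing n) m → Vec (PR o n) m
  liftPRs [] = []
  liftPRs (t ∷ ts) = liftPR t ∷ liftPRs ts

module _ {o : Maybe ℕ} {O : Orc o} where
  mutual
    lift-eval : ∀ {n} (t : PR nothing n) xs → evalPR O (liftPR t) xs ≡ evalPR tt t xs
    lift-eval zro xs = refl
    lift-eval sc (x ∷ []) = refl
    lift-eval (proj i) xs = refl
    lift-eval (comp t ts) xs = trans (cong (evalPR O (liftPR t)) (lifts-eval ts xs)) (lift-eval t _)
    lift-eval (prec t u) (zero ∷ xs) = lift-eval t xs
    lift-eval (prec t u) (suc k ∷ xs) =
      trans (cong (λ z → evalPR O (liftPR u) (k ∷ z ∷ xs)) (lift-eval (prec t u) (k ∷ xs))) (lift-eval u _)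
    lift-eval (orc ()) xs

    lifts-eval : ∀ {n m} (ts : Vec (PR nothing n) m) xs → evalPRs O (liftPRs ts) xs ≡ evalPRs tt ts xs
    lifts-eval [] xs = refl
    lifts-eval (t ∷ ts) xs = cong₂ _∷_ (lift-eval t xs) (lifts-eval ts xs)

  liftE : ∀ {n f} → E {nothing} tt n f → E O n f
  liftE (t , p) = liftPR t , λ xs → trans (lift-eval t xs) (p xs)

-- Pairing and division

triangle : ℕ → ℕ
triangle zero = 0
triangle (suc k) = suc k + triangle k

-- The largest d with `triangle d` ≤ n, that is, the diagonal of Cantor's enumeration that contains
-- n; it grows by at most one when n does.
diagonal : ℕ → ℕ
diagonal zero = 0
diagonal (suc n) = if suc n <ᵇ triangle (suc (diagonal n)) then diagonal n else suc (diagonal n)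

diagonal-spec : ∀ n → triangle (diagonal n) ≤ n × n < triangle (suc (diagonal n))
diagonal-spec zero = z≤n , s≤s z≤n
diagonal-spec (suc n) with diagonal-spec n | suc n <ᵇ triangle (suc (diagonal n)) in e
... | l , u | true = m≤n⇒m≤1+n l , ᵇ⇒< e
... | l , u | false = ≮⇒≥ (ᵇ⇒≮ e) ,
  s≤s (≤-trans u (m≤n+m _ (suc (diagonal n))))

triangle-mono : ∀ {a b} → a ≤ b → triangle a ≤ triangle b
triangle-mono z≤n = z≤n
triangle-mono (s≤s h) = +-mono-≤ (s≤s h) (triangle-mono h)

diagonal-unique : ∀ n d → triangle d ≤ n → n < triangle (suc d) → diagonal n ≡ d
diagonal-unique n d l u with <-cmp (diagonal n) d
... | tri≈ _ e _ = e
... | tri< h _ _ = ⊥-elim (<-irrefl refl (<-≤-trans (proj₂ (diagonal-spec n)) (≤-trans (triangle-mono h) l)))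
... | tri> _ _ h = ⊥-elim (<-irrefl refl (<-≤-trans u (≤-trans (triangle-mono h) (proj₁ (diagonal-spec n)))))

n≤triangle : ∀ n → n ≤ triangle n
n≤triangle zero = z≤n
n≤triangle (suc n) = m≤m+n (suc n) (triangle n)

abstract
  π₁ π₂ : ℕ → ℕ
  π₁ n = n ∸ triangle (diagonal n)
  π₂ n = diagonal n ∸ π₁ n

  pair : ℕ → ℕ → ℕ
  pair a b = triangle (a + b) + a

  diagonal-pair : ∀ a b → diagonal (pair a b) ≡ a + b
  diagonal-pair a b = diagonal-unique _ _ (m≤m+n _ a)
    (subst (_< triangle (suc (a + b))) (+-comm a _) (+-monoˡ-≤ (triangle (a + b)) (s≤s (m≤m+n a b))))

  π₁-pair : ∀ a b → π₁ (pair a b) ≡ a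
  π₁-pair a b rewrite diagonal-pair a b = m+n∸m≡n (triangle (a + b)) a

  π₂-pair : ∀ a b → π₂ (pair a b) ≡ b
  π₂-pair a b = trans (cong₂ _∸_ (diagonal-pair a b) (π₁-pair a b)) (m+n∸m≡n a b)

  pair-π : ∀ n → pair (π₁ n) (π₂ n) ≡ n
  pair-π n with diagonal-spec n
  ... | l , u = trans (cong (λ d → triangle d + π₁ n) (m+[n∸m]≡n h)) (m+[n∸m]≡n l)
    where
    h : π₁ n ≤ diagonal n
    h = ≤-pred (subst (suc (π₁ n) ≤_) (m+n∸n≡m (suc (diagonal n)) (triangle (diagonal n)))
          (∸-monoˡ-< u l))

  n≤pair : ∀ a b → b ≤ pair a b
  n≤pair a b = ≤-trans (m≤n+m b a) (≤-trans (n≤triangle (a + b)) (m≤m+n _ a))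

module _ {o : Maybe ℕ} {O : Orc o} where
  triangleE : ∀ {n e} → E O n e → E O n (λ xs → triangle (e xs))
  triangleE = app1 triangle (pr (cst 0) (sucE v0 +E v1) (λ k ps → triangle k) (λ _ → refl) (λ _ _ → refl))

  diagonalE : ∀ {n e} → E O n e → E O n (λ xs → diagonal (e xs))
  diagonalE = app1 diagonal (pr (cst 0) (ifE (ltB (sucE v0) (triangleE (sucE v1))) v1 (sucE v1))
    (λ k ps → diagonal k) (λ _ → refl) (λ _ _ → refl))

  abstract
    π₁E : ∀ {n e} → E O n e → E O n (λ xs → π₁ (e xs))
    π₁E = app1 π₁ (v0 ∸E triangleE (diagonalE v0))

    π₂E : ∀ {n e} → E O n e → E O n (λ xs → π₂ (e xs))
    π₂E = app1 π₂ (diagonalE v0 ∸E π₁E v0)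

    pairE : ∀ {n e e′} → E O n e → E O n e′ → E O n (λ xs → pair (e xs) (e′ xs))
    pairE a b = triangleE (a +E b) +E a

  divE : ∀ {n e} k → E O n e → E O n (λ xs → e xs / suc k)
  divE {e = e} k te = Ecast (λ xs → go (e xs))
    (leastBelowE {p = λ q xs → e xs <ᵇ suc q * suc k} (ltB (wk te) (sucE v0 *E cst (suc k))) (sucE te))
    where
    go : ∀ m → leastBelow (λ q → m <ᵇ suc q * suc k) (suc m) ≡ m / suc k
    go m = leastBelow-unique _ _ _ (s≤s (m/n≤m m (suc k)))
      (<⇒ᵇ (subst (_< suc (m / suc k) * suc k) (sym (m≡m%n+[m/n]*n m (suc k)))
        (+-monoˡ-< (m / suc k * suc k) (m%n<n m (suc k)))))
      λ j h → ≮⇒ᵇ (≤⇒≯ (≤-trans (*-monoˡ-≤ (suc k) h) (m/n*n≤m m (suc k))))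

  modE : ∀ {n e} k → E O n e → E O n (λ xs → e xs % suc k)
  modE {e = e} k te = Ecast (λ xs → sym (m%n≡m∸m/n*n (e xs) (suc k))) (te ∸E divE k te *E cst (suc k))

-- Evaluation of recursive terms

mutual
  embPR : ∀ {o n} → PR o n → Rec o n
  embPR zro = zro
  embPR sc = sc
  embPR (proj i) = proj i
  embPR (comp t ts) = comp (embPR t) (embPRs ts)
  embPR (prec t u) = prec (embPR t) (embPR u)
  embPR (orc e) = orc e

  embPRs : ∀ {o n m} → Vec (PR o n) m → Vec (Rec o n) m
  embPRs [] = []
  embPRs (t ∷ ts) = embPR t ∷ embPRs ts

module _ {o : Maybe ℕ} {O : Orc o} where
  mutual
    emb-ev : ∀ {n} (t : PR o n) xs → Ev O (embPR t) xs (evalPR O t xs)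
    emb-ev zro xs = ev-zro
    emb-ev sc (x ∷ []) = ev-sc
    emb-ev (proj i) xs = ev-proj
    emb-ev (comp t ts) xs = ev-comp (embs-ev ts xs) (emb-ev t _)
    emb-ev (prec t u) (zero ∷ xs) = ev-prec0 (emb-ev t xs)
    emb-ev (prec t u) (suc k ∷ xs) = ev-precS (emb-ev (prec t u) (k ∷ xs)) (emb-ev u _)
    emb-ev (orc e) xs = ev-orc e

    embs-ev : ∀ {n m} (ts : Vec (PR o n) m) xs → Evs O (embPRs ts) xs (evalPRs O ts xs)
    embs-ev [] xs = evs-[]
    embs-ev (t ∷ ts) xs = evs-∷ (emb-ev t xs) (embs-ev ts xs)

  E-ev : ∀ {n f} (e : E O n f) xs → Ev O (embPR (proj₁ e)) xs (f xs)
  E-ev (t , p) xs = subst (Ev O (embPR t) xs) (p xs) (emb-ev t xs)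

  mutual
    Ev-det : ∀ {n} (t : Rec o n) {xs v w} → Ev O t xs v → Ev O t xs w → v ≡ w
    Ev-det zro ev-zro ev-zro = refl
    Ev-det sc ev-sc ev-sc = refl
    Ev-det (proj i) ev-proj ev-proj = refl
    Ev-det (comp t ts) (ev-comp a b) (ev-comp c d) with Evs-det ts a c
    ... | refl = Ev-det t b d
    Ev-det (prec t u) (ev-prec0 a) (ev-prec0 b) = Ev-det t a b
    Ev-det (prec t u) {suc k ∷ xs} (ev-precS a b) (ev-precS c d) with Ev-det (prec t u) a c
    ... | refl = Ev-det u b d
    Ev-det (mu t) {xs} {v} {w} (ev-mu a f) (ev-mu b g) with <-cmp v w
    ... | tri≈ _ e _ = e
    ... | tri< h _ _ = case Ev-det t a (proj₂ (g v h)) of λ ()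
    ... | tri> _ _ h = case Ev-det t b (proj₂ (f w h)) of λ ()
    Ev-det (orc e) (ev-orc .e) (ev-orc .e) = refl

    Evs-det : ∀ {n m} (ts : Vec (Rec o n) m) {xs vs ws} → Evs O ts xs vs → Evs O ts xs ws → vs ≡ ws
    Evs-det [] evs-[] evs-[] = refl
    Evs-det (t ∷ ts) (evs-∷ a b) (evs-∷ c d) = cong₂ _∷_ (Ev-det t a c) (Evs-det ts b d)

module _ {k : ℕ} (q : PR nothing k) where
  mutual
    sub : ∀ {n} → Rec (just k) n → Rec nothing n
    sub zro = zro
    sub sc = sc
    sub (proj i) = proj i
    sub (comp t ts) = comp (sub t) (subs ts)
    sub (prec t u) = prec (sub t) (sub u)
    sub (mu t) = mu (sub t)
    sub (orc refl) = embPR q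

    subs : ∀ {n m} → Vec (Rec (just k) n) m → Vec (Rec nothing n) m
    subs [] = []
    subs (t ∷ ts) = sub t ∷ subs ts

  module _ {O : Orc (just k)} (h : ∀ xs → evalPR tt q xs ≡ O xs) where
    mutual
      sub-ev : ∀ {n} (t : Rec (just k) n) {xs v} → Ev O t xs v → Ev tt (sub t) xs v
      sub-ev zro ev-zro = ev-zro
      sub-ev sc ev-sc = ev-sc
      sub-ev (proj i) ev-proj = ev-proj
      sub-ev (comp t ts) (ev-comp a b) = ev-comp (subs-ev ts a) (sub-ev t b)
      sub-ev (prec t u) (ev-prec0 a) = ev-prec0 (sub-ev t a)
      sub-ev (prec t u) {suc k ∷ xs} (ev-precS a b) = ev-precS (sub-ev (prec t u) a) (sub-ev u b)
      sub-ev (mu t) (ev-mu a f) = ev-mu (sub-ev t a) λ z l → proj₁ (f z l) , sub-ev t (proj₂ (f z l))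
      sub-ev (orc refl) {xs} (ev-orc .refl) = subst (Ev tt (embPR q) xs) (h xs) (emb-ev q xs)

      subs-ev : ∀ {n m} (t : Vec (Rec (just k) n) m) {xs v} → Evs O t xs v → Evs tt (subs t) xs v
      subs-ev [] evs-[] = evs-[]
      subs-ev (t ∷ ts) (evs-∷ a b) = evs-∷ (sub-ev t a) (subs-ev ts b)

toMatrix : ∀ {o m} {O : Orc o} {t : Rec o m} → TotalBool O t → ∀ {xs} → ¬ Ev O t xs 0 → Ev O t xs 1
toMatrix tb {xs} n with tb xs
... | inj₁ e = ⊥-elim (n e)
... | inj₂ e = e

-- The use principle for computations from a diagram

Agree : ℕ → Rel → Rel → Set
Agree n R S = ∀ i j → i < n → j < n → R i j ≡ S i j

agree-≤ : ∀ {m n R S} → m ≤ n → Agree n R S → Agree m R S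
agree-≤ h a i j p q = a i j (<-≤-trans p h) (<-≤-trans q h)

bound-below : ∀ (P : ℕ → ℕ → Set) → (∀ {z m n} → m ≤ n → P z m → P z n) →
  ∀ y → (∀ z → z < y → ∃ (P z)) → ∃ λ N → ∀ z → z < y → P z N
bound-below P mono zero h = 0 , λ z ()
bound-below P mono (suc y) h with bound-below P mono y (λ z l → h z (m<n⇒m<1+n l)) | h y ≤-refl
... | N , f | M , p = N ⊔ M , g
  where
  g : ∀ z → z < suc y → P z (N ⊔ M)
  g z l with m≤n⇒m<n∨m≡n (≤-pred l)
  ... | inj₁ l′ = mono (m≤m⊔n N M) (f z l′)
  ... | inj₂ refl = mono (m≤n⊔m N M) p

Uses : ∀ {n} (R : Rel) (t : Rec (just 2) n) (xs : Vec ℕ n) (v N : ℕ) → Set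
Uses R t xs v N = ∀ S → Agree N R S → Ev (diag S) t xs v

mutual
  -- A halting computation asks its oracle finitely often, so it survives in every order that agrees
  -- with R below some N. For `mu` a common bound over all earlier arguments is needed, which
  -- `bound-below` supplies.
  use : ∀ {R n} (t : Rec (just 2) n) {xs v} → Ev (diag R) t xs v → ∃ (Uses R t xs v)
  use zro ev-zro = 0 , λ _ _ → ev-zro
  use sc ev-sc = 0 , λ _ _ → ev-sc
  use (proj i) ev-proj = 0 , λ _ _ → ev-proj
  use (comp t ts) (ev-comp a b) with uses ts a | use t b
  ... | N , f | M , g = N ⊔ M , λ S h → ev-comp (f S (agree-≤ (m≤m⊔n N M) h)) (g S (agree-≤ (m≤n⊔m N M) h))
  use (prec t u) (ev-prec0 a) with use t a
  ... | N , f = N , λ S h → ev-prec0 (f S h)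
  use (prec t u) {suc k ∷ xs} (ev-precS a b) with use (prec t u) a | use u b
  ... | N , f | M , g = N ⊔ M , λ S h → ev-precS (f S (agree-≤ (m≤m⊔n N M) h)) (g S (agree-≤ (m≤n⊔m N M) h))
  use {R} (mu t) {xs} {y} (ev-mu a f) with use t a |
    bound-below (λ z N → ∃ λ v → Uses R t (z ∷ xs) (suc v) N)
      (λ l (v , p) → v , λ S h → p S (agree-≤ l h))
      y (λ z l → let (N , p) = use t (proj₂ (f z l)) in N , proj₁ (f z l) , p)
  ... | N , p | M , q = N ⊔ M , λ S h → ev-mu (p S (agree-≤ (m≤m⊔n N M) h))
    λ z l → proj₁ (q z l) , proj₂ (q z l) S (agree-≤ (m≤n⊔m N M) h)
  use {R} (orc refl) {x ∷ y ∷ []} (ev-orc .refl) = suc (x ⊔ y) , λ S h →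
    subst (Ev (diag S) (orc refl) (x ∷ y ∷ []))
      (sym (cong (λ b → if b then 1 else 0) (h x y (s≤s (m≤m⊔n x y)) (s≤s (m≤n⊔m x y))))) (ev-orc refl)

  uses : ∀ {R n m} (ts : Vec (Rec (just 2) n) m) {xs vs} → Evs (diag R) ts xs vs →
    ∃ λ N → ∀ S → Agree N R S → Evs (diag S) ts xs vs
  uses [] evs-[] = 0 , λ _ _ → evs-[]
  uses (t ∷ ts) (evs-∷ a b) with use t a | uses ts b
  ... | N , f | M , g = N ⊔ M , λ S h → evs-∷ (f S (agree-≤ (m≤m⊔n N M) h)) (g S (agree-≤ (m≤n⊔m N M) h))

-- Step-bounded evaluation

-- All searches are bounded by s; the result is 0 when undecided and suc v when the value is v.
mutual
  stp : ∀ {n} → Rec nothing n → ℕ → Vec ℕ n → ℕ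
  stp zro s xs = 1
  stp sc s xs = 2 + head xs
  stp (proj i) s xs = suc (lookup xs i)
  stp (comp t ts) s xs = cond (allDefined ts s xs) (stp t s (stps ts s xs)) 0
  stp (prec t u) s xs = stpPrec t u s (head xs) (tail xs)
  stp (mu t) s xs = pred (stpMu t s s xs)
  stp (orc ()) s xs

  stpPrec : ∀ {n} → Rec nothing n → Rec nothing (suc (suc n)) → ℕ → ℕ → Vec ℕ n → ℕ
  stpPrec t u s zero xs = stp t s xs
  stpPrec t u s (suc k) xs =
    cond (stpPrec t u s k xs) (stp u s (k ∷ pred (stpPrec t u s k xs) ∷ xs)) 0

  -- 0: no zero found yet; 1: stuck at an undecided value; 2 + j: the zero is j.
  stpMu : ∀ {n} → Rec nothing (suc n) → ℕ → ℕ → Vec ℕ n → ℕ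
  stpMu t s zero xs = 0
  stpMu t s (suc j) xs = cond (stpMu t s j xs) (stpMu t s j xs)
    (cond (stp t s (j ∷ xs)) (cond (pred (stp t s (j ∷ xs))) 0 (2 + j)) 1)

  stps : ∀ {n m} → Vec (Rec nothing n) m → ℕ → Vec ℕ n → Vec ℕ m
  stps [] s xs = []
  stps (t ∷ ts) s xs = pred (stp t s xs) ∷ stps ts s xs

  allDefined : ∀ {n m} → Vec (Rec nothing n) m → ℕ → Vec ℕ n → ℕ
  allDefined [] s xs = 1
  allDefined (t ∷ ts) s xs = cond (stp t s xs) (allDefined ts s xs) 0

mutual
  -- Only `mu` needs the bound s; the other clauses are primitive recursive as they stand. The bound
  -- is an argument of the function, so one term serves all stages.
  stpE : ∀ {n} (t : Rec nothing n) → E tt (suc n) (λ ys → stp t (head ys) (tail ys))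
  stpE zro = cst 1
  stpE sc = sucE (sucE v1)
  stpE (proj i) = Ecast (λ { (y ∷ ys) → refl }) (sucE (proj (suc i) , λ xs → refl))
  stpE (comp t ts) = condE (allE ts) (app (stpE t) (v0 ∷E stpsE ts)) (cst 0)
  stpE (prec t u) = app
    (pr (stpE t) (condE v1 (app (stpE u) (v2 ∷E v0 ∷E predE v1 ∷E tail3Es)) (cst 0))
      (λ k ps → stpPrec t u (head ps) k (tail ps)) (λ _ → refl) (λ _ _ → refl))
    (v1 ∷E v0 ∷E tail2Es)
  stpE (mu t) = predE (app
    (pr (cst 0) (condE v1 v1 (condE body (condE (predE body) (cst 0) (sucE (sucE v0))) (cst 1)))
      (λ j ps → stpMu t (head ps) j (tail ps)) (λ _ → refl) (λ _ _ → refl))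
    (v0 ∷E v0 ∷E tailEs))
    where
    body : E tt _ (λ ys → stp t (a2 ys) (a0 ys ∷ tail (tail (tail ys))))
    body = app (stpE t) (v2 ∷E v0 ∷E tail3Es)
  stpE (orc ())

  stpsE : ∀ {n m} (ts : Vec (Rec nothing n) m) → Es tt (suc n) m (λ ys → stps ts (head ys) (tail ys))
  stpsE [] = []E
  stpsE (t ∷ ts) = predE (stpE t) ∷E stpsE ts

  allE : ∀ {n m} (ts : Vec (Rec nothing n) m) → E tt (suc n) (λ ys → allDefined ts (head ys) (tail ys))
  allE [] = cst 1
  allE (t ∷ ts) = condE (stpE t) (allE ts) (cst 0)

mutual
  stp-sound : ∀ {n} (t : Rec nothing n) s xs {v} → stp t s xs ≡ suc v → Ev tt t xs v
  stp-sound zro s xs refl = ev-zro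
  stp-sound sc s (x ∷ []) refl = ev-sc
  stp-sound (proj i) s xs refl = ev-proj
  stp-sound (comp t ts) s xs h with allDefined ts s xs in e
  ... | suc _ = ev-comp (stps-sound ts s xs e) (stp-sound t s _ h)
  stp-sound (prec t u) s (k ∷ xs) h = stpPrec-sound t u s k xs h
  stp-sound (mu t) s xs {v} h = stpMu-sound t s s xs (lem₁ h)
    where
    lem₁ : ∀ {m} → pred m ≡ suc v → m ≡ 2 + v
    lem₁ {suc m} e = cong suc e
  stp-sound (orc ()) s xs h

  stpPrec-sound : ∀ {n} (t : Rec nothing n) u s k xs {v} → stpPrec t u s k xs ≡ suc v → Ev tt (prec t u) (k ∷ xs) v
  stpPrec-sound t u s zero xs h = ev-prec0 (stp-sound t s xs h)
  stpPrec-sound t u s (suc k) xs h with stpPrec t u s k xs in e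
  ... | suc w = ev-precS (stpPrec-sound t u s k xs e) (stp-sound u s _ h)

  stpMu-below : ∀ {n} (t : Rec nothing (suc n)) s j xs → stpMu t s j xs ≡ 0 →
    ∀ z → z < j → ∃ λ v → Ev tt t (z ∷ xs) (suc v)
  stpMu-below t s (suc j) xs h z l with stpMu t s j xs in e | stp t s (j ∷ xs) in e′
  ... | zero | suc (suc v) with m≤n⇒m<n∨m≡n (≤-pred l)
  ... | inj₁ l′ = stpMu-below t s j xs e z l′
  ... | inj₂ refl = v , stp-sound t s _ e′

  stpMu-sound : ∀ {n} (t : Rec nothing (suc n)) s j xs {v} → stpMu t s j xs ≡ 2 + v → Ev tt (mu t) xs v
  stpMu-sound t s (suc j) xs h with stpMu t s j xs in e | stp t s (j ∷ xs) in e′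
  stpMu-sound t s (suc j) xs h | suc m | _ = stpMu-sound t s j xs (trans e h)
  stpMu-sound t s (suc j) xs refl | zero | suc zero = ev-mu (stp-sound t s _ e′) (stpMu-below t s j xs e)

  stps-sound : ∀ {n m} (ts : Vec (Rec nothing n) m) s xs {v} → allDefined ts s xs ≡ suc v → Evs tt ts xs (stps ts s xs)
  stps-sound [] s xs h = evs-[]
  stps-sound (t ∷ ts) s xs h with stp t s xs in e
  ... | suc w = evs-∷ (stp-sound t s xs e) (stps-sound ts s xs h)

Eventually : (ℕ → Set) → Set
Eventually P = ∃ λ s₀ → ∀ s → s₀ ≤ s → P s

eventually-× : ∀ {P Q : ℕ → Set} → Eventually P → Eventually Q → Eventually (λ s → P s × Q s)
eventually-× (a , f) (b , g) = a ⊔ b , λ s h → f s (m⊔n≤o⇒m≤o a b h) , g s (m⊔n≤o⇒n≤o a b h)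

eventually-map : ∀ {P Q : ℕ → Set} → (∀ s → P s → Q s) → Eventually P → Eventually Q
eventually-map h (a , f) = a , λ s l → h s (f s l)

mutual
  stp-complete : ∀ {n} (t : Rec nothing n) {xs v} → Ev tt t xs v → Eventually (λ s → stp t s xs ≡ suc v)
  stp-complete zro ev-zro = 0 , λ _ _ → refl
  stp-complete sc ev-sc = 0 , λ _ _ → refl
  stp-complete (proj i) ev-proj = 0 , λ _ _ → refl
  stp-complete (comp t ts) {xs} {v} (ev-comp {ys = ys} a b) =
    eventually-map go (eventually-× (stps-complete ts a) (stp-complete t b))
    where
    go : ∀ s → (stps ts s xs ≡ ys × allDefined ts s xs ≡ 1) × stp t s ys ≡ suc v → stp (comp t ts) s xs ≡ suc v
    go s ((refl , e) , h) rewrite e = h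
  stp-complete (prec t u) (ev-prec0 a) = stp-complete t a
  stp-complete (prec t u) {suc k ∷ xs} {v} (ev-precS {w = w} a b) =
    eventually-map go (eventually-× (stp-complete (prec t u) a) (stp-complete u b))
    where
    go : ∀ s → stpPrec t u s k xs ≡ suc w × stp u s (k ∷ w ∷ xs) ≡ suc v → stpPrec t u s (suc k) xs ≡ suc v
    go s (e , h) rewrite e = h
  stp-complete (mu t) {xs} {y} (ev-mu a f) =
    eventually-map go (eventually-× (stp-complete t a) (eventually-× below (suc y , λ s h → h)))
    where
    below : Eventually (λ s → ∀ z → z < y → ∃ λ v → stp t s (z ∷ xs) ≡ 2 + v)
    below = let (N , p) = bound-below (λ z N → ∀ s → N ≤ s → ∃ λ v → stp t s (z ∷ xs) ≡ 2 + v)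
                   (λ l p s h → p s (≤-trans l h)) y
                   (λ z l → let (N , p) = stp-complete t (proj₂ (f z l)) in N , λ s h → proj₁ (f z l) , p s h)
            in N , λ s h z l → p z l s h
    zeros : ∀ s → (∀ z → z < y → ∃ λ v → stp t s (z ∷ xs) ≡ 2 + v) → ∀ j → j ≤ y → stpMu t s j xs ≡ 0
    zeros s h zero l = refl
    zeros s h (suc j) l rewrite zeros s h j (<⇒≤ l) | proj₂ (h j l) = refl
    found : ∀ s → stp t s (y ∷ xs) ≡ 1 → (∀ z → z < y → ∃ λ v → stp t s (z ∷ xs) ≡ 2 + v) →
      ∀ d → stpMu t s (d + suc y) xs ≡ 2 + y
    found s e h zero rewrite zeros s h y ≤-refl | e = refl
    found s e h (suc d) rewrite found s e h d = refl
    go : ∀ s → stp t s (y ∷ xs) ≡ 1 × (∀ z → z < y → ∃ λ v → stp t s (z ∷ xs) ≡ 2 + v) × suc y ≤ s →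
      pred (stpMu t s s xs) ≡ suc y
    go s (e , h , l) = cong pred (subst (λ j → stpMu t s j xs ≡ 2 + y) (m∸n+n≡m l) (found s e h (s ∸ suc y)))
  stp-complete (orc ()) h

  stps-complete : ∀ {n m} (ts : Vec (Rec nothing n) m) {xs vs} → Evs tt ts xs vs →
    Eventually (λ s → stps ts s xs ≡ vs × allDefined ts s xs ≡ 1)
  stps-complete [] evs-[] = 0 , λ _ _ → refl , refl
  stps-complete (t ∷ ts) {xs} {v ∷ vs} (evs-∷ a b) = eventually-map go (eventually-× (stp-complete t a) (stps-complete ts b))
    where
    go : ∀ s → stp t s xs ≡ suc v × (stps ts s xs ≡ vs × allDefined ts s xs ≡ 1) →
      stps (t ∷ ts) s xs ≡ v ∷ vs × allDefined (t ∷ ts) s xs ≡ 1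
    go s (e , refl , h) rewrite e = refl , h

module Classical (lem : (P : Set) → Dec P) where

  -- The limit lemma and the easy inclusion

  module Limit (t : Rec nothing 4) where
    -- w codes a step bound and a value of b. Since `stp` returns the successor of a value,
    -- comparing with 1 tests for the value 0, a counterexample to the candidate.
    hit : ℕ → ℕ → ℕ → Bool
    hit n c w = stp t (π₁ w) (π₂ w ∷ π₁ c ∷ n ∷ π₂ c ∷ []) ≡ᵇ 1

    -- The candidate c = ⟨a , y⟩ for "f n = y with witness a" is refuted when some b < s is seen to give 0.
    refuted : ℕ → ℕ → ℕ → Bool
    refuted n c s = leastBelow (hit n c) s <ᵇ s

    candidate guess : ℕ → ℕ → ℕ
    candidate n s = leastBelow (λ c → not (refuted n c s)) s
    guess n s = π₂ (candidate n s)

    hitE : E tt 3 (λ xs → bit (hit (a2 xs) (a1 xs) (a0 xs)))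
    hitE = eqB (app (stpE t) (π₁E v0 ∷E π₂E v0 ∷E π₁E v1 ∷E v2 ∷E π₂E v1 ∷E []E)) (cst 1)

    refutedE : E tt 3 (λ xs → bit (refuted (a1 xs) (a0 xs) (a2 xs)))
    refutedE = anyB {p = λ w xs → hit (a1 xs) (a0 xs) w} (app hitE (v0 ∷E v1 ∷E v2 ∷E []E)) v2

    guessE : F2 tt guess
    guessE = π₂E (leastBelowE {p = λ c xs → not (refuted (a0 xs) c (a1 xs))} (notB refutedE) v1)

    refuted-from : ∀ n c {w} → hit n c w ≡ true → Eventually (λ s → refuted n c s ≡ true)
    refuted-from n c {w} h = suc w , λ s l → go s l
      where
      go : ∀ s → w < s → refuted n c s ≡ true
      go s l with leastBelow (hit n c) s <ᵇ s in e
      ... | true = refl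
      ... | false = ⊥-elim (true≢false h (leastBelow-min (hit n c) s w (<-≤-trans l (≮⇒≥ (ᵇ⇒≮ e)))))

    refuted-hit : ∀ n c s → refuted n c s ≡ true → ∃ λ w → hit n c w ≡ true
    refuted-hit n c s h = _ , leastBelow-true (hit n c) s (ᵇ⇒< h)

    module _ (f : ℕ → ℕ) (tb : TotalBool tt t)
      (eqv : ∀ xs → (Graph f xs → ∃ λ a → ∀ b → Ev tt t (b ∷ a ∷ xs) 1) ×
                    ((∃ λ a → ∀ b → Ev tt t (b ∷ a ∷ xs) 1) → Graph f xs)) where

      hit-zero : ∀ n c b → Ev tt t (b ∷ π₁ c ∷ n ∷ π₂ c ∷ []) 0 → ∃ λ w → hit n c w ≡ true
      hit-zero n c b h with stp-complete t h
      ... | s , p = pair s b , go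
        where
        go : hit n c (pair s b) ≡ true
        go = trans (cong₂ (λ u v → stp t u (v ∷ π₁ c ∷ n ∷ π₂ c ∷ []) ≡ᵇ 1) (π₁-pair s b) (π₂-pair s b))
          (cong (_≡ᵇ 1) (p s ≤-refl))

      true-candidate : ∀ n c → (∀ w → ¬ hit n c w ≡ true) → f n ≡ π₂ c
      true-candidate n c h = proj₂ (eqv (n ∷ π₂ c ∷ [])) (π₁ c , λ b →
        toMatrix tb (λ e → let (w , p) = hit-zero n c b e in h w p))

      never : ∀ n → ∃ λ c → ∀ w → ¬ hit n c w ≡ true
      never n = let (a , g) = proj₁ (eqv (n ∷ f n ∷ [])) refl in pair a (f n) , λ w h →
        case Ev-det t (g (π₂ w)) (stp-sound t (π₁ w) _ (ᵇ⇒≡ (at-pair a h))) of λ ()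
        where
        at-pair : ∀ a {w} → hit n (pair a (f n)) w ≡ true → (stp t (π₁ w) (π₂ w ∷ a ∷ n ∷ f n ∷ []) ≡ᵇ 1) ≡ true
        at-pair a {w} h = trans (sym (cong₂ (λ u v → stp t (π₁ w) (π₂ w ∷ u ∷ n ∷ v ∷ []) ≡ᵇ 1)
          (π₁-pair a (f n)) (π₂-pair a (f n)))) h

      -- Locates the least candidate that is never refuted, along with a stage from which all
      -- smaller candidates are refuted. Beyond this stage and beyond the candidate itself the guess
      -- no longer moves.
      search : ∀ n k →
        (∃ λ c → (∀ w → ¬ hit n c w ≡ true) × Eventually (λ s → ∀ c′ → c′ < c → refuted n c′ s ≡ true)) ⊎
        ((∀ c → c < k → ∃ λ w → hit n c w ≡ true) × Eventually (λ s → ∀ c → c < k → refuted n c s ≡ true))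
      search n zero = inj₂ ((λ _ ()) , 0 , λ _ _ _ ())
      search n (suc k) with search n k
      ... | inj₁ x = inj₁ x
      ... | inj₂ (g , ev) with lem (∃ λ w → hit n k w ≡ true)
      ... | no none = inj₁ (k , (λ w h → none (w , h)) , ev)
      ... | yes (w , h) = inj₂ ((λ c l → [ g c , (λ { refl → w , h }) ]′ (m≤n⇒m<n∨m≡n (≤-pred l))) ,
        eventually-map (λ s (p , q) c l → [ p c , (λ { refl → q }) ]′ (m≤n⇒m<n∨m≡n (≤-pred l)))
          (eventually-× ev (refuted-from n k h)))

      guess-limit : ∀ n → Eventually (λ s → guess n s ≡ f n)
      guess-limit n with never n
      ... | c₀ , nv with search n (suc c₀)
      ... | inj₂ (g , _) = let (w , h) = g c₀ ≤-refl in ⊥-elim (nv w h)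
      ... | inj₁ (c , h , ev) = eventually-map go (eventually-× ev (suc c , λ s l → l))
        where
        unref : ∀ s → refuted n c s ≡ false
        unref s = ¬true⇒false (λ e → let (w , p) = refuted-hit n c s e in h w p)
        go : ∀ s → (∀ c′ → c′ < c → refuted n c′ s ≡ true) × suc c ≤ s → guess n s ≡ f n
        go s (p , l) = trans (cong π₂ (leastBelow-unique _ s c l (cong not (unref s)) (λ j m → cong not (p j m))))
          (sym (true-candidate n c h))

  limit-lemma : ∀ f → Sigma2 {nothing} tt (Graph f) →
    ∃ λ F → F2 tt F × (∀ n → Eventually (λ s → F n s ≡ f n))
  limit-lemma f (t , tb , eqv) = Limit.guess t , Limit.guessE t , Limit.guess-limit t f tb eqv

  iso-sym : ∀ {A B} (f : ℕ → ℕ) → IsIso A B f → ∃ λ g → IsIso B A g × (∀ x → g (f x) ≡ x) × (∀ y → f (g y) ≡ y)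
  iso-sym {A} {B} f (p , inj , sur) = g , (pg , ig , sg′) , gf , fg
    where
    g : ℕ → ℕ
    g y = proj₁ (sur y)
    fg : ∀ y → f (g y) ≡ y
    fg y = proj₂ (sur y)
    gf : ∀ x → g (f x) ≡ x
    gf x = inj _ _ (fg (f x))
    pg : ∀ x y → B x y ≡ A (g x) (g y)
    pg x y = trans (cong₂ B (sym (fg x)) (sym (fg y))) (sym (p (g x) (g y)))
    ig : ∀ x y → g x ≡ g y → x ≡ y
    ig x y e = trans (sym (fg x)) (trans (cong f e) (fg y))
    sg′ : ∀ y → ∃ λ x → g x ≡ y
    sg′ y = f y , gf y

  iso-∘ : ∀ {A B C} {f g : ℕ → ℕ} → IsIso A B f → IsIso B C g → IsIso A C (g ∘ f)
  iso-∘ {f = f} {g} (p , i , s) (p′ , i′ , s′) = (λ x y → trans (p x y) (p′ _ _)) ,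
    (λ x y e → i x y (i′ _ _ e)) , λ z → let (y , e) = s′ z ; (x , e′) = s y in x , trans (cong g e′) e

  module _ (B : Rel) (pB : Punctual B) where
    private
      q = proj₁ pB
      hq : ∀ xs → evalPR tt q xs ≡ diag B xs
      hq (x ∷ y ∷ []) = proj₂ pB x y

    sigma-sub : ∀ {m} {R : Vec ℕ m → Set} → Sigma2 (diag B) R → Sigma2 {nothing} tt R
    sigma-sub (t , tb , h) = sub q t , tb′ , λ xs →
      (λ r → let (a , g) = proj₁ (h xs) r in a , λ b → sub-ev q hq t (g b)) ,
      λ (a , g) → proj₂ (h xs) (a , λ b → toMatrix tb (λ e →
        case Ev-det (sub q t) (g b) (sub-ev q hq t e) of λ ()))
      where
      tb′ : TotalBool tt (sub q t)
      tb′ xs = [ (λ e → inj₁ (sub-ev q hq t e)) , (λ e → inj₂ (sub-ev q hq t e)) ]′ (tb xs)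

    pi-sub : ∀ {m} {R : Vec ℕ m → Set} → Pi2 (diag B) R → Pi2 {nothing} tt R
    pi-sub (t , tb , h) = sub q t , tb′ , λ xs →
      (λ r a → let (b , g) = proj₁ (h xs) r a in b , sub-ev q hq t g) ,
      λ g → proj₂ (h xs) λ a → let (b , e) = g a in b , toMatrix tb (λ e′ →
        case Ev-det (sub q t) e (sub-ev q hq t e′) of λ ())
      where
      tb′ : TotalBool tt (sub q t)
      tb′ xs = [ (λ e → inj₁ (sub-ev q hq t e)) , (λ e → inj₂ (sub-ev q hq t e)) ]′ (tb xs)

  swapT : Rec nothing 4 → Rec nothing 4
  swapT t = comp t (proj zero ∷ proj (suc zero) ∷ proj (suc (suc (suc zero))) ∷ proj (suc (suc zero)) ∷ [])

  swap-ev : ∀ t {b a x y v} → Ev tt t (b ∷ a ∷ x ∷ y ∷ []) v → Ev tt (swapT t) (b ∷ a ∷ y ∷ x ∷ []) v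
  swap-ev t = ev-comp (evs-∷ ev-proj (evs-∷ ev-proj (evs-∷ ev-proj (evs-∷ ev-proj evs-[]))))

  swap-ev⁻ : ∀ t {b a x y v} → Ev tt (swapT t) (b ∷ a ∷ y ∷ x ∷ []) v → Ev tt t (b ∷ a ∷ x ∷ y ∷ []) v
  swap-ev⁻ t (ev-comp (evs-∷ ev-proj (evs-∷ ev-proj (evs-∷ ev-proj (evs-∷ ev-proj evs-[])))) e) = e

  swap-total : ∀ t → TotalBool tt t → TotalBool tt (swapT t)
  swap-total t tb (b ∷ a ∷ x ∷ y ∷ []) = [ (λ e → inj₁ (swap-ev t e)) , (λ e → inj₂ (swap-ev t e)) ]′ (tb _)

  -- The graph of the inverse is the transposed graph, so it suffices to exchange two arguments of
  -- both matrices.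
  delta2-inverse : ∀ {f g : ℕ → ℕ} → (∀ x → g (f x) ≡ x) → (∀ y → f (g y) ≡ y) →
    Delta2Fun {nothing} tt f → Delta2Fun {nothing} tt g
  delta2-inverse {f} {g} gf fg ((t , tb , h) , (u , ub , k)) =
    (swapT t , swap-total t tb , λ { (x ∷ y ∷ []) →
      (λ e → let (a , q) = proj₁ (h (y ∷ x ∷ [])) (to e) in a , λ b → swap-ev t (q b)) ,
      λ (a , q) → from (proj₂ (h (y ∷ x ∷ [])) (a , λ b → swap-ev⁻ t (q b))) }) ,
    (swapT u , swap-total u ub , λ { (x ∷ y ∷ []) →
      (λ e a → let (b , q) = proj₁ (k (y ∷ x ∷ [])) (to e) a in b , swap-ev u q) ,
      λ q → from (proj₂ (k (y ∷ x ∷ [])) λ a → let (b , e) = q a in b , swap-ev⁻ u e) })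
    where
    to : ∀ {x y} → g x ≡ y → f y ≡ x
    to {x} refl = fg x
    from : ∀ {x y} → f y ≡ x → g x ≡ y
    from {x} {y} refl = gf y

  cone⇒prcat : ∀ {L g} → RelDelta2Cat L → InConeDelta2 g → InPrCat L g
  cone⇒prcat {L} {g} cat cone B pB (f₀ , iso₀) =
    let (f₁ , iso₁ , _) = iso-sym f₀ iso₀
        (h , isoh , (s , p)) = cat B (f₁ , iso₁)
        dh = sigma-sub B pB s , pi-sub B pB p
        (f , isof , fh , hf) = iso-sym h isoh
    in f , h , isof , hf , fh , cone f (delta2-inverse fh hf dh) , cone h dh

  -- Strict weak orders and back-and-forth

  record LO : Set₁ where
    constructor mkLO
    field
      C : Set
      lt : C → C → Set
  open LO public

  record IsLO (X : LO) : Set where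
    constructor mkIsLO
    field
      irr : ∀ {x} → ¬ lt X x x
      tr : ∀ {x y z} → lt X x y → lt X y z → lt X x z
      cotr : ∀ {x z} → lt X x z → ∀ y → lt X x y ⊎ lt X y z
  open IsLO public

  Iff : Set → Set → Set
  Iff P Q = (P → Q) × (Q → P)

  -- Incomparable elements count as equal.
  IsoR : LO → LO → Set₁
  IsoR X Y = Σ (C X → C Y → Set) λ G → (∀ x → ∃ (G x)) × (∀ y → ∃ λ x → G x y) ×
    (∀ {x y x′ y′} → G x y → G x′ y′ → Iff (lt X x x′) (lt Y y y′))

  iso-refl : ∀ {X} → IsoR X X
  iso-refl = _≡_ , (λ x → x , refl) , (λ x → x , refl) , λ { refl refl → id , id }

  iso-flip : ∀ {X Y} → IsoR X Y → IsoR Y X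
  iso-flip (G , t , s , p) = (λ y x → G x y) , s , t , λ a b → swap (p a b)

  iso-trans : ∀ {X Y Z} → IsoR X Y → IsoR Y Z → IsoR X Z
  iso-trans (G , t , s , p) (H , u , r , q) = (λ x z → ∃ λ y → G x y × H y z) ,
    (λ x → let (y , g) = t x ; (z , h) = u y in z , y , g , h) ,
    (λ z → let (y , h) = r z ; (x , g) = s y in x , y , g , h) ,
    λ (y , g , h) (y′ , g′ , h′) → (proj₁ (q h h′) ∘ proj₁ (p g g′)) , (proj₂ (p g g′) ∘ proj₂ (q h h′))

  iso-fun : ∀ {X Y} (f : C X → C Y) → (∀ y → ∃ λ x → f x ≡ y) →
    (∀ {x x′} → Iff (lt X x x′) (lt Y (f x) (f x′))) → IsoR X Y
  iso-fun f s p = (λ x y → f x ≡ y) , (λ x → f x , refl) , s , λ { refl refl → p }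

  one none : LO
  one = mkLO ⊤ (λ _ _ → ⊥)
  none = mkLO ⊥ (λ _ _ → ⊥)

  ofRel : Rel → LO
  ofRel A = mkLO ℕ (λ x y → A x y ≡ true)

  finL : ℕ → LO
  finL k = mkLO (Fin k) (λ i j → toℕ i < toℕ j)

  restr : (X : LO) → (C X → Set) → LO
  restr X P = mkLO (Σ (C X) P) (λ x y → lt X (proj₁ x) (proj₁ y))

  op : LO → LO
  op X = mkLO (C X) (λ x y → lt X y x)

  data SumLt (X Y : LO) : C X ⊎ C Y → C X ⊎ C Y → Set where
    ll : ∀ {x x′} → lt X x x′ → SumLt X Y (inj₁ x) (inj₁ x′)
    lr : ∀ {x y} → SumLt X Y (inj₁ x) (inj₂ y)
    rr : ∀ {y y′} → lt Y y y′ → SumLt X Y (inj₂ y) (inj₂ y′)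

  infixr 5 _⊕_
  infixr 6 _⊗_
  _⊕_ : LO → LO → LO
  X ⊕ Y = mkLO (C X ⊎ C Y) (SumLt X Y)

  LexLt : (X Y : LO) → C X × C Y → C X × C Y → Set
  LexLt X Y (x , y) (x′ , y′) = lt X x x′ ⊎ (¬ lt X x x′ × ¬ lt X x′ x × lt Y y y′)

  _⊗_ : LO → LO → LO
  X ⊗ Y = mkLO (C X × C Y) (LexLt X Y)

  unll : ∀ {X Y x x′} → SumLt X Y (inj₁ x) (inj₁ x′) → lt X x x′
  unll (ll h) = h
  unrr : ∀ {X Y y y′} → SumLt X Y (inj₂ y) (inj₂ y′) → lt Y y y′
  unrr (rr h) = h

  ⊕-iso : ∀ {X X′ Y Y′} → IsoR X X′ → IsoR Y Y′ → IsoR (X ⊕ Y) (X′ ⊕ Y′)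
  ⊕-iso {X} {X′} {Y} {Y′} (G , t , s , p) (H , u , r , q) = K ,
    [ (λ x → inj₁ (proj₁ (t x)) , inj₁ (proj₂ (t x))) , (λ x → inj₂ (proj₁ (u x)) , proj₂ (u x)) ]d ,
    [ (λ x → inj₁ (proj₁ (s x)) , inj₁ (proj₂ (s x))) , (λ x → inj₂ (proj₁ (r x)) , proj₂ (r x)) ]d′ ,
    λ {a} {b} {a′} {b′} → pres {a} {b} {a′} {b′}
    where
    K : C X ⊎ C Y → C X′ ⊎ C Y′ → Set
    K (inj₁ x) (inj₁ x′) = G x x′ ⊎ ⊥
    K (inj₁ x) (inj₂ y) = ⊥
    K (inj₂ y) (inj₁ x) = ⊥
    K (inj₂ y) (inj₂ y′) = H y y′
    [_,_]d : (∀ x → ∃ (K (inj₁ x))) → (∀ y → ∃ (K (inj₂ y))) → ∀ z → ∃ (K z)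
    [ f , g ]d (inj₁ x) = f x
    [ f , g ]d (inj₂ x) = g x
    [_,_]d′ : (∀ x → ∃ λ z → K z (inj₁ x)) → (∀ y → ∃ λ z → K z (inj₂ y)) → ∀ w → ∃ λ z → K z w
    [ f , g ]d′ (inj₁ x) = f x
    [ f , g ]d′ (inj₂ x) = g x
    pres : ∀ {x y x′ y′} → K x y → K x′ y′ → Iff (SumLt X Y x x′) (SumLt X′ Y′ y y′)
    pres {inj₁ _} {inj₁ _} {inj₁ _} {inj₁ _} (inj₁ g) (inj₁ g′) =
      (λ h → ll (proj₁ (p g g′) (unll h))) , λ h → ll (proj₂ (p g g′) (unll h))
    pres {inj₁ _} {inj₁ _} {inj₂ _} {inj₂ _} g g′ = (λ _ → lr) , λ _ → lr
    pres {inj₂ _} {inj₂ _} {inj₁ _} {inj₁ _} g g′ = (λ ()) , λ ()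
    pres {inj₂ _} {inj₂ _} {inj₂ _} {inj₂ _} g g′ =
      (λ h → rr (proj₁ (q g g′) (unrr h))) , λ h → rr (proj₂ (q g g′) (unrr h))

  ⊗-iso : ∀ {X X′ Y Y′} → IsoR X X′ → IsoR Y Y′ → IsoR (X ⊗ Y) (X′ ⊗ Y′)
  ⊗-iso (G , t , s , p) (H , u , r , q) = (λ (x , y) (x′ , y′) → G x x′ × H y y′) ,
    (λ (x , y) → (proj₁ (t x) , proj₁ (u y)) , proj₂ (t x) , proj₂ (u y)) ,
    (λ (x , y) → (proj₁ (s x) , proj₁ (r y)) , proj₂ (s x) , proj₂ (r y)) ,
    λ (g , h) (g′ , h′) →
      (λ { (inj₁ l) → inj₁ (proj₁ (p g g′) l)
         ; (inj₂ (a , b , l)) → inj₂ (a ∘ proj₂ (p g g′) , b ∘ proj₂ (p g′ g) , proj₁ (q h h′) l) }) ,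
      (λ { (inj₁ l) → inj₁ (proj₂ (p g g′) l)
         ; (inj₂ (a , b , l)) → inj₂ (a ∘ proj₁ (p g g′) , b ∘ proj₁ (p g′ g) , proj₂ (q h h′) l) })

  ⊎-assocʳ : ∀ {A B D : Set} → (A ⊎ B) ⊎ D → A ⊎ (B ⊎ D)
  ⊎-assocʳ (inj₁ (inj₁ x)) = inj₁ x
  ⊎-assocʳ (inj₁ (inj₂ y)) = inj₂ (inj₁ y)
  ⊎-assocʳ (inj₂ z) = inj₂ (inj₂ z)

  ⊕-assoc : ∀ {X Y Z} → IsoR ((X ⊕ Y) ⊕ Z) (X ⊕ (Y ⊕ Z))
  ⊕-assoc {X} {Y} {Z} = iso-fun ⊎-assocʳ
    (λ { (inj₁ x) → inj₁ (inj₁ x) , refl ; (inj₂ (inj₁ y)) → inj₁ (inj₂ y) , refl ; (inj₂ (inj₂ z)) → inj₂ z , refl })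
    λ {x} {x′} → to x x′ , from x x′
    where
    to : ∀ x x′ → SumLt (X ⊕ Y) Z x x′ → SumLt X (Y ⊕ Z) (⊎-assocʳ x) (⊎-assocʳ x′)
    to _ _ (ll (ll h)) = ll h
    to _ _ (ll lr) = lr
    to _ _ (ll (rr h)) = rr (ll h)
    to (inj₁ (inj₁ _)) _ lr = lr
    to (inj₁ (inj₂ _)) _ lr = rr lr
    to _ _ (rr h) = rr (rr h)
    from : ∀ x x′ → SumLt X (Y ⊕ Z) (⊎-assocʳ x) (⊎-assocʳ x′) → SumLt (X ⊕ Y) Z x x′
    from (inj₁ (inj₁ _)) (inj₁ (inj₁ _)) (ll h) = ll (ll h)
    from (inj₁ (inj₁ _)) (inj₁ (inj₂ _)) lr = ll lr
    from (inj₁ (inj₁ _)) (inj₂ _) lr = lr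
    from (inj₁ (inj₂ _)) (inj₁ (inj₂ _)) (rr (ll h)) = ll (rr h)
    from (inj₁ (inj₂ _)) (inj₂ _) (rr lr) = lr
    from (inj₂ _) (inj₁ (inj₁ _)) ()
    from (inj₂ _) (inj₁ (inj₂ _)) (rr ())
    from (inj₂ _) (inj₂ _) (rr (rr h)) = rr h

  none-⊕ : ∀ {X} → IsoR (none ⊕ X) X
  none-⊕ = iso-fun (λ { (inj₁ ()) ; (inj₂ x) → x }) (λ x → inj₂ x , refl)
    λ { {inj₁ ()} ; {inj₂ _} {inj₁ ()} ; {inj₂ _} {inj₂ _} → unrr , rr }

  ⊕-none : ∀ {X} → IsoR (X ⊕ none) X
  ⊕-none = iso-fun (λ { (inj₁ x) → x ; (inj₂ ()) }) (λ x → inj₁ x , refl)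
    λ { {inj₂ ()} ; {inj₁ _} {inj₂ ()} ; {inj₁ _} {inj₁ _} → unll , ll }

  ofRel-isLO : ∀ {A} → IsLinearOrder A → IsLO (ofRel A)
  ofRel-isLO {A} (i , t , c) = mkIsLO (λ h → true≢false h (i _)) (λ {x} {y} {z} → t x y z) co
    where
    co : ∀ {x z} → A x z ≡ true → ∀ y → A x y ≡ true ⊎ A y z ≡ true
    co {x} {z} h y with lem (x ≡ y)
    ... | yes refl = inj₂ h
    ... | no n with c x y n
    ... | inj₁ l = inj₁ l
    ... | inj₂ l = inj₂ (t _ _ _ l h)

  op-isLO : ∀ {X} → IsLO X → IsLO (op X)
  op-isLO X = mkIsLO (irr X) (λ a b → tr X b a) (λ h y → [ inj₂ , inj₁ ]′ (cotr X h y))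

  restr-isLO : ∀ {X P} → IsLO X → IsLO (restr X P)
  restr-isLO X = mkIsLO (irr X) (tr X) (λ h y → cotr X h (proj₁ y))

  one-isLO : IsLO one
  one-isLO = mkIsLO (λ ()) (λ ()) (λ ())

  ⊕-isLO : ∀ {X Y} → IsLO X → IsLO Y → IsLO (X ⊕ Y)
  ⊕-isLO {X} {Y} x y = mkIsLO i t c
    where
    i : ∀ {a} → ¬ SumLt X Y a a
    i (ll h) = irr x h
    i (rr h) = irr y h
    t : ∀ {a b c} → SumLt X Y a b → SumLt X Y b c → SumLt X Y a c
    t (ll h) (ll k) = ll (tr x h k)
    t (ll h) lr = lr
    t lr (rr h) = lr
    t (rr h) (rr k) = rr (tr y h k)
    c : ∀ {a b} → SumLt X Y a b → ∀ z → SumLt X Y a z ⊎ SumLt X Y z b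
    c (ll h) (inj₁ z) = [ inj₁ ∘ ll , inj₂ ∘ ll ]′ (cotr x h z)
    c (ll h) (inj₂ z) = inj₁ lr
    c {inj₁ a} lr (inj₁ z) = inj₂ lr
    c lr (inj₂ z) = inj₁ lr
    c (rr h) (inj₁ z) = inj₂ lr
    c (rr h) (inj₂ z) = [ inj₁ ∘ rr , inj₂ ∘ rr ]′ (cotr y h z)

  ⊗-isLO : ∀ {X Y} → IsLO X → IsLO Y → IsLO (X ⊗ Y)
  ⊗-isLO {X} {Y} x y = mkIsLO i t c
    where
    i : ∀ {a} → ¬ LexLt X Y a a
    i (inj₁ h) = irr x h
    i (inj₂ (_ , _ , h)) = irr y h
    t : ∀ {a b c} → LexLt X Y a b → LexLt X Y b c → LexLt X Y a c
    t (inj₁ h) (inj₁ k) = inj₁ (tr x h k)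
    t {c = c} (inj₁ h) (inj₂ (n , m , _)) = inj₁ ([ id , (λ l → ⊥-elim (m l)) ]′ (cotr x h (proj₁ c)))
    t {a} (inj₂ (n , m , _)) (inj₁ k) = inj₁ ([ (λ l → ⊥-elim (m l)) , id ]′ (cotr x k (proj₁ a)))
    t {a} {b} (inj₂ (n , m , h)) (inj₂ (n′ , m′ , k)) = inj₂
      ((λ l → [ n , n′ ]′ (cotr x l (proj₁ b))) , (λ l → [ m′ , m ]′ (cotr x l (proj₁ b))) , tr y h k)
    c : ∀ {a b} → LexLt X Y a b → ∀ z → LexLt X Y a z ⊎ LexLt X Y z b
    c (inj₁ h) (z , _) = [ inj₁ ∘ inj₁ , inj₂ ∘ inj₁ ]′ (cotr x h z)
    c {a , a′} {b , b′} (inj₂ (n , m , h)) (z , z′) with lem (lt X a z) | lem (lt X z b) | cotr y h z′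
    ... | yes l | _ | _ = inj₁ (inj₁ l)
    ... | no _ | yes l | _ = inj₂ (inj₁ l)
    ... | no p | no q | inj₁ k = inj₁ (inj₂ (p , (λ l → [ q , m ]′ (cotr x l b)) , k))
    ... | no p | no q | inj₂ k = inj₂ (inj₂ (q , (λ l → [ m , p ]′ (cotr x l a)) , k))

  finL-isLO : ∀ {k} → IsLO (finL k)
  finL-isLO {k} = mkIsLO (<-irrefl refl) <-trans co
    where
    co : ∀ {x z : Fin k} → toℕ x < toℕ z → ∀ y → toℕ x < toℕ y ⊎ toℕ y < toℕ z
    co {x} h y with toℕ x <? toℕ y
    ... | yes l = inj₁ l
    ... | no n = inj₂ (≤-<-trans (≮⇒≥ n) h)

  Iff-bool : ∀ {a b} → Iff (a ≡ true) (b ≡ true) → a ≡ b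
  Iff-bool {true} {true} h = refl
  Iff-bool {false} {false} h = refl
  Iff-bool {true} {false} (f , _) = sym (f refl)
  Iff-bool {false} {true} (_ , g) = g refl

  Conn : Rel → Set
  Conn B = ∀ x y → x ≢ y → B x y ≡ true ⊎ B y x ≡ true

  toIsIso : ∀ {A B} → IsLinearOrder A → Conn B → (i : IsoR (ofRel A) (ofRel B)) →
    IsIso A B (λ x → proj₁ (proj₁ (proj₂ i) x))
  toIsIso {A} {B} (ir , _ , cn) cB (G , t , s , p) = pres , inj , sur
    where
    f : ℕ → ℕ
    f x = proj₁ (t x)
    pres : ∀ x y → A x y ≡ B (f x) (f y)
    pres x y = Iff-bool (p (proj₂ (t x)) (proj₂ (t y)))
    inj : ∀ x y → f x ≡ f y → x ≡ y
    inj x y e with x ≟ y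
    ... | yes q = q
    ... | no n with cn x y n
    ... | inj₁ h = ⊥-elim (true≢false h (trans (pres x y) (trans (cong (B (f x)) (sym e)) (trans (sym (pres x x)) (ir x)))))
    ... | inj₂ h = ⊥-elim (true≢false h (trans (pres y x) (trans (cong (B (f y)) e) (trans (sym (pres y y)) (ir y)))))
    sur : ∀ y → ∃ λ x → f x ≡ y
    sur y with s y
    ... | x , g with f x ≟ y
    ... | yes e = x , e
    ... | no n with cB (f x) y n
    ... | inj₁ h = ⊥-elim (true≢false (proj₂ (p (proj₂ (t x)) g) h) (ir x))
    ... | inj₂ h = ⊥-elim (true≢false (proj₂ (p g (proj₂ (t x))) h) (ir x))

  ofIsIso : ∀ {A B f} → IsIso A B f → IsoR (ofRel A) (ofRel B)
  ofIsIso {A} {B} {f} (p , _ , s) = iso-fun f s λ {x} {y} → trans (sym (p x y)) , trans (p x y)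

  Pattern : (X Y : LO) → List (C X × C Y) → Set
  Pattern X Y zs = ∀ {z w} → z ∈ zs → w ∈ zs → Iff (lt X (proj₁ z) (proj₁ w)) (lt Y (proj₂ z) (proj₂ w))

  Fits : (X Y : LO) → C X → C Y → List (C X × C Y) → Set
  Fits X Y x y zs = ∀ {z} → z ∈ zs →
    Iff (lt X x (proj₁ z)) (lt Y y (proj₂ z)) × Iff (lt X (proj₁ z) x) (lt Y (proj₂ z) y)

  Lower : ∀ {A : Set} → (A → Set) → List A → Maybe A → Set
  Lower P zs nothing = ⊤
  Lower P zs (just z) = z ∈ zs × P z

  OnJust : ∀ {A : Set} → (A → Set) → Maybe A → Set
  OnJust P nothing = ⊤
  OnJust P (just z) = P z

  module _ {X Y : LO} (iX : IsLO X) (iY : IsLO Y) where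
    pattern-∷ : ∀ {x y zs} → Pattern X Y zs → Fits X Y x y zs → Pattern X Y ((x , y) ∷ zs)
    pattern-∷ p f (here refl) (here refl) = (λ h → ⊥-elim (irr iX h)) , λ h → ⊥-elim (irr iY h)
    pattern-∷ p f (here refl) (there w) = proj₁ (f w)
    pattern-∷ p f (there z) (here refl) = proj₂ (f z)
    pattern-∷ p f (there z) (there w) = p z w

    nearest : ∀ x (zs : List (C X × C Y)) → ∃ λ m → Lower (λ z → lt X (proj₁ z) x) zs m ×
      (∀ {z} → z ∈ zs → lt X (proj₁ z) x → ∃ λ w → m ≡ just w × ¬ lt X (proj₁ w) (proj₁ z))
    nearest x [] = nothing , tt , λ ()
    nearest x (z ∷ zs) with nearest x zs | lem (lt X (proj₁ z) x)
    ... | nothing , l , h | no n = nothing , tt ,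
          λ { (here refl) k → ⊥-elim (n k) ; (there i) k → h i k }
    ... | just w , (i , l) , h | no n = just w , (there i , l) ,
          λ { (here refl) k → ⊥-elim (n k) ; (there i) k → h i k }
    ... | nothing , l , h | yes y = just z , (here refl , y) ,
          λ { (here refl) k → z , refl , irr iX ; (there i) k → case h i k of λ () }
    ... | just w , (i , l) , h | yes y with lem (lt X (proj₁ w) (proj₁ z))
    ... | no n = just w , (there i , l) , λ { (here refl) k → w , refl , n ; (there i) k → h i k }
    ... | yes q = just z , (here refl , y) , λ { (here refl) k → z , refl , irr iX
          ; (there i) k → z , refl , λ r → case h i k of λ { (_ , refl , n) → n (tr iX q r) } }

  module _ {X Y : LO} (iX : IsLO X) (iY : IsLO Y) where
    -- Only the nearest listed elements on both sides of x matter: a point between their images is,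
    -- by cotransitivity, correctly placed against all other images. If x is incomparable with a
    -- listed element, the image of that element is reused.
    extend : ∀ zs → Pattern X Y zs → ∀ x →
      (∀ l u → Lower (λ z → lt X (proj₁ z) x) zs l → Lower (λ z → lt X x (proj₁ z)) zs u →
        ∃ λ y → OnJust (λ z → lt Y (proj₂ z) y) l × OnJust (λ z → lt Y y (proj₂ z)) u) →
      ∃ λ y → Fits X Y x y zs
    extend zs p x between with lem (∃ λ z → z ∈ zs × ¬ lt X x (proj₁ z) × ¬ lt X (proj₁ z) x)
    ... | yes ((x₁ , y₁) , i , n , m) = y₁ , λ {z} j →
      ((λ h → proj₁ (p i j) ([ (λ k → ⊥-elim (n k)) , id ]′ (cotr iX h x₁))) ,
       (λ h → [ (λ k → ⊥-elim (m k)) , id ]′ (cotr iX (proj₂ (p i j) h) x))) ,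
      ((λ h → proj₁ (p j i) ([ id , (λ k → ⊥-elim (m k)) ]′ (cotr iX h x₁))) ,
       (λ h → [ id , (λ k → ⊥-elim (n k)) ]′ (cotr iX (proj₂ (p j i) h) x)))
    ... | no new with nearest iX iY x zs | nearest (op-isLO iX) (op-isLO iY) x zs
    ... | l , lo , hl | u , up , hu with between l u lo up
    ... | y , yl , yu = y , fits
      where
      low : ∀ {z} → z ∈ zs → lt X (proj₁ z) x → lt Y (proj₂ z) y
      low {z} i h with hl i h
      low {z} i h | w , refl , n = [ (λ k → ⊥-elim (n (proj₂ (p (proj₁ lo) i) k))) , id ]′ (cotr iY yl (proj₂ z))
      high : ∀ {z} → z ∈ zs → lt X x (proj₁ z) → lt Y y (proj₂ z)
      high {z} i h with hu i h
      high {z} i h | w , refl , n = [ id , (λ k → ⊥-elim (n (proj₂ (p i (proj₁ up)) k))) ]′ (cotr iY yu (proj₂ z))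
      fits : Fits X Y x y zs
      fits {z} i with lem (lt X x (proj₁ z)) | lem (lt X (proj₁ z) x)
      ... | yes h | _ = ((λ _ → high i h) , (λ _ → h)) ,
        (λ k → ⊥-elim (irr iX (tr iX h k))) , λ k → ⊥-elim (irr iY (tr iY (high i h) k))
      ... | no n | yes h = ((λ k → ⊥-elim (n k)) , (λ k → ⊥-elim (irr iY (tr iY (low i h) k)))) ,
        (λ _ → low i h) , λ _ → h
      ... | no n | no m = ⊥-elim (new (_ , i , n , m))

  pattern-swap : ∀ {X Y zs} → Pattern X Y zs → Pattern Y X (map swap zs)
  pattern-swap p i j with ∈-map⁻ swap i | ∈-map⁻ swap j
  ... | z , i′ , refl | w , j′ , refl = swap (p i′ j′)

  fits-swap : ∀ {X Y x y zs} → Fits Y X y x (map swap zs) → Fits X Y x y zs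
  fits-swap f i = let (a , b) = f (∈-map⁺ swap i) in swap a , swap b

  iso-limit : ∀ {X Y} → IsLO X → IsLO Y → (H : ℕ → List (C X × C Y)) → (∀ n → Pattern X Y (H n)) → (∀ n {z} → z ∈ H n → z ∈ H (suc n)) →
    (∀ x → ∃ λ n → ∃ λ z → z ∈ H n × ¬ lt X x (proj₁ z) × ¬ lt X (proj₁ z) x) →
    (∀ y → ∃ λ n → ∃ λ z → z ∈ H n × ¬ lt Y y (proj₂ z) × ¬ lt Y (proj₂ z) y) → IsoR X Y
  iso-limit {X} {Y} iX iY H p mono cx cy = G ,
    (λ x → let (n , z , i , e) = cx x in proj₂ z , n , z , i , e , irr iY , irr iY) ,
    (λ y → let (n , z , i , e) = cy y in proj₁ z , n , z , i , (irr iX , irr iX) , e) , pres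
    where
    G : C X → C Y → Set
    G x y = ∃ λ n → ∃ λ z → z ∈ H n × (¬ lt X x (proj₁ z) × ¬ lt X (proj₁ z) x) × (¬ lt Y y (proj₂ z) × ¬ lt Y (proj₂ z) y)
    up : ∀ n d {z} → z ∈ H n → z ∈ H (d + n)
    up n zero i = i
    up n (suc d) i = mono (d + n) (up n d i)
    move : ∀ {Z} → IsLO Z → ∀ {a a′ b b′} → (¬ lt Z a a′ × ¬ lt Z a′ a) → (¬ lt Z b b′ × ¬ lt Z b′ b) → lt Z a b → lt Z a′ b′
    move iZ {a} {a′} {b} {b′} (n , m) (n′ , m′) h with cotr iZ h a′
    ... | inj₁ k = ⊥-elim (n k)
    ... | inj₂ k with cotr iZ k b′
    ... | inj₁ l = l
    ... | inj₂ l = ⊥-elim (m′ l)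
    pres : ∀ {x y x′ y′} → G x y → G x′ y′ → Iff (lt X x x′) (lt Y y y′)
    pres (n , z , i , e , e′) (m , w , j , f , f′) =
      (λ h → move iY (swap e′) (swap f′) (proj₁ q (move iX e f h))) ,
      (λ h → move iX (swap e) (swap f) (proj₂ q (move iY e′ f′ h)))
      where
      q = p (m + n) (up n m i) (subst (λ k → w ∈ H k) (+-comm n m) (up m n j))

  Countable : LO → Set
  Countable X = Σ (ℕ → Maybe (C X)) λ e → ∀ x → ∃ λ n → ∃ λ x′ → e n ≡ just x′ × ¬ lt X x x′ × ¬ lt X x′ x

  Limit-point : (X : LO) → C X → Set
  Limit-point X x = (∃ λ z → lt X z x) × (∃ λ z → lt X x z) ×
    (∀ y → lt X y x → ∃ λ z → lt X y z × lt X z x) × (∀ y → lt X x y → ∃ λ z → lt X x z × lt X z y)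

  private
    dense-between : ∀ {X Y} → (∀ y → Limit-point Y y) → C Y → (iX : IsLO X) → ∀ zs → Pattern X Y zs → ∀ x l u →
      Lower (λ z → lt X (proj₁ z) x) zs l → Lower (λ z → lt X x (proj₁ z)) zs u →
      ∃ λ y → OnJust (λ z → lt Y (proj₂ z) y) l × OnJust (λ z → lt Y y (proj₂ z)) u
    dense-between d y₀ iX zs p x nothing nothing _ _ = y₀ , tt , tt
    dense-between d y₀ iX zs p x (just l) nothing _ _ = let (y , h) = proj₁ (proj₂ (d (proj₂ l))) in y , h , tt
    dense-between d y₀ iX zs p x nothing (just u) _ _ = let (y , h) = proj₁ (d (proj₂ u)) in y , tt , h
    dense-between d y₀ iX zs p x (just l) (just u) (i , h) (j , k) =
      proj₁ (proj₂ (proj₂ (d (proj₂ u)))) (proj₂ l) (proj₁ (p i j) (tr iX h k))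

  cantor : ∀ {X Y} → IsLO X → IsLO Y → Countable X → Countable Y → C X → C Y →
    (∀ x → Limit-point X x) → (∀ y → Limit-point Y y) → IsoR X Y
  cantor {X} {Y} iX iY (eX , hX) (eY , hY) x₀ y₀ dX dY = iso-limit iX iY
    (λ n → proj₁ (st n)) (λ n → proj₂ (st n))
    (λ n i → proj₁ (proj₂ (back (eY n) (proj₁ (forth (eX n) (st n))))) (proj₁ (proj₂ (forth (eX n) (st n))) i))
    (λ x → let (n , x′ , e , h) = hX x ; (y , i) = proj₂ (proj₂ (forth (eX n) (st n))) x′ e
           in suc n , _ , proj₁ (proj₂ (back (eY n) (proj₁ (forth (eX n) (st n))))) i , h)
    (λ y → let (n , y′ , e , h) = hY y ; (x , i) = proj₂ (proj₂ (back (eY n) (proj₁ (forth (eX n) (st n))))) y′ e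
           in suc n , _ , i , h)
    where
    St : Set
    St = Σ (List (C X × C Y)) (Pattern X Y)
    forth : (m : Maybe (C X)) (s : St) → Σ St λ s′ → (∀ {z} → z ∈ proj₁ s → z ∈ proj₁ s′) ×
      (∀ x → m ≡ just x → ∃ λ y → (x , y) ∈ proj₁ s′)
    forth nothing s = s , id , λ _ ()
    forth (just x) (zs , p) = let (y , f) = extend iX iY zs p x (dense-between dY y₀ iX zs p x)
      in ((x , y) ∷ zs , pattern-∷ iX iY p f) , there , λ { x refl → y , here refl }
    back : (m : Maybe (C Y)) (s : St) → Σ St λ s′ → (∀ {z} → z ∈ proj₁ s → z ∈ proj₁ s′) ×
      (∀ y → m ≡ just y → ∃ λ x → (x , y) ∈ proj₁ s′)
    back nothing s = s , id , λ _ ()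
    back (just y) (zs , p) =
      let (x , f) = extend iY iX _ (pattern-swap p) y (dense-between dX x₀ iY _ (pattern-swap p) y)
      in ((x , y) ∷ zs , pattern-∷ iX iY p (fits-swap {X} {Y} f)) , there , λ { y refl → x , here refl }
    st : ℕ → St
    st zero = [] , λ ()
    st (suc n) = proj₁ (back (eY n) (proj₁ (forth (eX n) (st n))))

  -- Chains, gaps and domination

  flip-linear : ∀ {A} → IsLinearOrder A → IsLinearOrder (flip A)
  flip-linear (i , t , c) = i , (λ x y z h k → t z y x k h) , λ x y n → [ inj₂ , inj₁ ]′ (c x y n)

  override : ℕ → ℕ → (ℕ → ℕ) → ℕ → ℕ
  override n y F i with i ≟ n
  ... | yes _ = y
  ... | no _ = F i

  override-< : ∀ n y F i → i < n → override n y F i ≡ F i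
  override-< n y F i l with i ≟ n
  ... | yes refl = ⊥-elim (<-irrefl refl l)
  ... | no _ = refl

  override-≡ : ∀ n y F → override n y F n ≡ y
  override-≡ n y F with n ≟ n
  ... | yes _ = refl
  ... | no m = ⊥-elim (m refl)

  module Order (A : Rel) (linA : IsLinearOrder A) where
    infix 4 _≺_
    _≺_ : ℕ → ℕ → Set
    x ≺ y = A x y ≡ true

    ≺-irr : ∀ {x} → ¬ x ≺ x
    ≺-irr {x} h = true≢false h (proj₁ linA x)

    ≺-tr : ∀ {x y z} → x ≺ y → y ≺ z → x ≺ z
    ≺-tr {x} {y} {z} = proj₁ (proj₂ linA) x y z

    cmp : ∀ x y → x ≺ y ⊎ x ≡ y ⊎ y ≺ x
    cmp x y with x ≟ y
    ... | yes e = inj₂ (inj₁ e)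
    ... | no n = [ inj₁ , inj₂ ∘ inj₂ ]′ (proj₂ (proj₂ linA) x y n)

    infixl 8 _↓_ _↑_
    _↓_ _↑_ : (ℕ → Set) → ℕ → ℕ → Set
    (P ↓ x) y = P y × y ≺ x
    (P ↑ x) y = P y × x ≺ y

    -- An ascending chain, so `Ch P k` says that P has at least k elements. Cardinalities are
    -- handled through such lower bounds: `Small` means finite, `Big` means infinite, and a
    -- comparison of sizes is an implication between chains.
    Ch : (ℕ → Set) → ℕ → Set
    Ch P zero = ⊤
    Ch P (suc k) = ∃ λ x → P x × Ch (P ↑ x) k

    ch-map : ∀ {P Q : ℕ → Set} k → (∀ {x} → P x → Q x) → Ch P k → Ch Q k
    ch-map zero h c = tt
    ch-map (suc k) h (x , p , c) = x , h p , ch-map k (λ (q , l) → h q , l) c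

    ch-drop : ∀ {P} k → Ch P (suc k) → Ch P k
    ch-drop zero c = tt
    ch-drop (suc k) (x , p , c) = x , p , ch-drop k c

    ch-≤ : ∀ {P j k} → j ≤ k → Ch P k → Ch P j
    ch-≤ {P} {j} {k} l c = go (k ∸ j) (subst (Ch P) (sym (m∸n+n≡m l)) c)
      where
      go : ∀ d → Ch P (d + j) → Ch P j
      go zero c = c
      go (suc d) c = go d (ch-drop (d + j) c)

    ch-cat : ∀ {P x} i {j} → Ch (P ↓ x) i → P x → Ch (P ↑ x) j → Ch P (i + suc j)
    ch-cat zero c p d = _ , p , d
    ch-cat (suc i) (y , (q , l) , c) p d = y , q , ch-cat i
      (ch-map i (λ ((a , b) , c) → (a , c) , b) c) (p , l)
      (ch-map _ (λ (a , b) → (a , ≺-tr l b) , b) d)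

    ch-split : ∀ {P} i {j} → Ch P (i + suc j) → ∃ λ x → P x × Ch (P ↓ x) i × Ch (P ↑ x) j
    ch-split zero (x , p , c) = x , p , tt , c
    ch-split (suc i) (y , q , c) with ch-split i c
    ... | x , (p , l) , d , e = x , p , (y , (q , l) , ch-map i (λ ((a , b) , c) → (a , c) , b) d) ,
      ch-map _ (λ ((a , _) , c) → a , c) e

    -- Cutting a chain at an arbitrary x loses at most x itself, which accounts for the successor.
    ch-cut : ∀ {P} k → Ch P k → ∀ x → ∃ λ i → ∃ λ j → Ch (P ↓ x) i × Ch (P ↑ x) j × k ≤ i + suc j
    ch-cut zero c x = 0 , 0 , tt , tt , z≤n
    ch-cut (suc k) (y , q , c) x with cmp y x
    ... | inj₁ l = let (i , j , d , e , h) = ch-cut k c x in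
      suc i , j , (y , (q , l) , ch-map i (λ ((a , b) , c) → (a , c) , b) d) , ch-map j (λ ((a , _) , c) → a , c) e , s≤s h
    ... | inj₂ (inj₁ refl) = 0 , k , tt , c , ≤-refl
    ... | inj₂ (inj₂ l) = 0 , suc k , tt , (y , (q , l) , ch-map k (λ (a , b) → (a , ≺-tr l b) , b) c) , n≤1+n _

    Small Big : (ℕ → Set) → Set
    Small P = ∃ λ k → ¬ Ch P k
    Big P = ∀ k → Ch P k

    small-big : ∀ P → Small P ⊎ Big P
    small-big P with lem (Small P)
    ... | yes h = inj₁ h
    ... | no n = inj₂ λ k → case lem (Ch P k) of λ { (yes c) → c ; (no m) → ⊥-elim (n (k , m)) }

    small-⊥ : ∀ {P} → Small P → ¬ Big P
    small-⊥ (k , n) b = n (b k)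

    small-map : ∀ {P Q : ℕ → Set} → (∀ {x} → P x → Q x) → Small Q → Small P
    small-map h (k , n) = k , λ c → n (ch-map k h c)

    big-map : ∀ {P Q : ℕ → Set} → (∀ {x} → P x → Q x) → Big P → Big Q
    big-map h b k = ch-map k h (b k)

    small-empty : ∀ {P : ℕ → Set} → (∀ {x} → ¬ P x) → Small P
    small-empty h = 1 , λ (x , p , _) → h p

    small-join : ∀ {P} x → Small (P ↓ x) → Small (P ↑ x) → Small P
    small-join x (k , n) (m , o) = k + m , λ c → let (i , j , d , e , h) = ch-cut (k + m) c x in
      case <-≤-connex i k of λ
        { (inj₂ l) → n (ch-≤ l d)
        ; (inj₁ l) → o (ch-≤ (+-cancelˡ-≤ k m j (≤-trans h (subst (_≤ k + j) (sym (+-suc i j)) (+-monoˡ-≤ j l)))) e) }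

    ch-pull : ∀ {f} → IsIso A A f → ∀ {P Q : ℕ → Set} k → (∀ y → P (f y) → Q y) → Ch P k → Ch Q k
    ch-pull i zero h c = tt
    ch-pull i@(p , _ , s) (suc k) h (x , q , c) with s x
    ... | y , refl = y , h y q , ch-pull i k (λ z (a , b) → h z a , trans (p y z) b) c

    In : Maybe ℕ → Maybe ℕ → ℕ → Set
    In lo hi x = OnJust (_≺ x) lo × OnJust (x ≺_) hi

    below-tr : ∀ {lo x y} → OnJust (_≺ x) lo → x ≺ y → OnJust (_≺ y) lo
    below-tr {nothing} h k = tt
    below-tr {just a} h k = ≺-tr h k

    above-tr : ∀ {hi x y} → x ≺ y → OnJust (y ≺_) hi → OnJust (x ≺_) hi
    above-tr {nothing} h k = tt
    above-tr {just a} h k = ≺-tr h k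

    widenʳ : ∀ {lo hi x y} → OnJust (x ≺_) hi → In lo (just x) y → In lo hi y
    widenʳ {hi = hi} h (a , b) = a , above-tr {hi} b h

    widenˡ : ∀ {lo hi x y} → OnJust (_≺ x) lo → In (just x) hi y → In lo hi y
    widenˡ {lo} h (a , b) = below-tr {lo} h a , b

    GapRel : Set₁
    GapRel = Maybe ℕ → Maybe ℕ → Maybe ℕ → Maybe ℕ → Set

    -- Two tuples are listed side by side, and Γ relates each gap of the first to the corresponding
    -- gap of the second. As both coordinates increase along the list, it is also a partial
    -- isomorphism, see `gaps-pattern`.
    Gaps : GapRel → Maybe ℕ → Maybe ℕ → List (ℕ × ℕ) → Maybe ℕ → Maybe ℕ → Set
    Gaps Γ lo lo′ [] hi hi′ = Γ lo hi lo′ hi′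
    Gaps Γ lo lo′ ((x , y) ∷ zs) hi hi′ =
      In lo hi x × In lo′ hi′ y × Γ lo (just x) lo′ (just y) × Gaps Γ (just x) (just y) zs hi hi′

    gaps-map : ∀ {Γ Δ : GapRel} → (∀ lo hi lo′ hi′ → Γ lo hi lo′ hi′ → Δ lo hi lo′ hi′) →
      ∀ {lo lo′} zs {hi hi′} → Gaps Γ lo lo′ zs hi hi′ → Gaps Δ lo lo′ zs hi hi′
    gaps-map h [] g = h _ _ _ _ g
    gaps-map h (z ∷ zs) (a , b , g , r) = a , b , h _ _ _ _ g , gaps-map h zs r

    gaps-in : ∀ {Γ lo lo′} zs {hi hi′} → Gaps Γ lo lo′ zs hi hi′ → ∀ {x y} → (x , y) ∈ zs → In lo hi x × In lo′ hi′ y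
    gaps-in (z ∷ zs) (a , b , g , r) (here refl) = a , b
    gaps-in {lo = lo} {lo′} (z ∷ zs) {hi} {hi′} (a , b , g , r) (there i) = let (c , d) = gaps-in zs r i in
      widenˡ {lo} {hi} (proj₁ a) c , widenˡ {lo′} {hi′} (proj₁ b) d

    gaps-pattern : ∀ {Γ lo lo′} zs {hi hi′} → Gaps Γ lo lo′ zs hi hi′ → ∀ {x y x′ y′} → (x , y) ∈ zs → (x′ , y′) ∈ zs →
      Iff (x ≺ x′) (y ≺ y′)
    gaps-pattern (z ∷ zs) g (here refl) (here refl) = (λ h → ⊥-elim (≺-irr h)) , λ h → ⊥-elim (≺-irr h)
    gaps-pattern (z ∷ zs) (a , b , g , r) (here refl) (there j) = let ((c , _) , (d , _)) = gaps-in zs r j in (λ _ → d) , λ _ → c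
    gaps-pattern (z ∷ zs) (a , b , g , r) (there i) (here refl) = let ((c , _) , (d , _)) = gaps-in zs r i in
      (λ h → ⊥-elim (≺-irr (≺-tr c h))) , λ h → ⊥-elim (≺-irr (≺-tr d h))
    gaps-pattern (z ∷ zs) (a , b , g , r) (there i) (there j) = gaps-pattern zs r i j

    gaps-functional : ∀ {Γ lo lo′} zs {hi hi′} → Gaps Γ lo lo′ zs hi hi′ → ∀ {x y x′ y′} → (x , y) ∈ zs → (x′ , y′) ∈ zs → Iff (x ≡ x′) (y ≡ y′)
    gaps-functional zs g {x} {y} {x′} {y′} i j = to , from
      where
      to : x ≡ x′ → y ≡ y′
      to refl with cmp y y′
      ... | inj₁ h = ⊥-elim (≺-irr (proj₂ (gaps-pattern zs g i j) h))
      ... | inj₂ (inj₁ e) = e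
      ... | inj₂ (inj₂ h) = ⊥-elim (≺-irr (proj₂ (gaps-pattern zs g j i) h))
      from : y ≡ y′ → x ≡ x′
      from refl with cmp x x′
      ... | inj₁ h = ⊥-elim (≺-irr (proj₁ (gaps-pattern zs g i j) h))
      ... | inj₂ (inj₁ e) = e
      ... | inj₂ (inj₂ h) = ⊥-elim (≺-irr (proj₁ (gaps-pattern zs g j i) h))

    -- One move of a one-sided Ehrenfeucht game: the gap that contains x is split by a reply y,
    -- while the other gaps only pass from Γ to Δ. An x that is listed already keeps its partner.
    insert : ∀ {Γ Δ : GapRel} x {hi hi′} →
      (∀ lo hi lo′ hi′ → Γ lo hi lo′ hi′ → In lo hi x →
        ∃ λ y → In lo′ hi′ y × Δ lo (just x) lo′ (just y) × Δ (just x) hi (just y) hi′) →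
      (∀ lo hi lo′ hi′ → Γ lo hi lo′ hi′ → Δ lo hi lo′ hi′) →
      ∀ {lo lo′} zs → In lo hi x → Gaps Γ lo lo′ zs hi hi′ →
      ∃ λ y → ∃ λ zs′ → Gaps Δ lo lo′ zs′ hi hi′ × (x , y) ∈ zs′ × (∀ {z} → z ∈ zs → z ∈ zs′)
    insert x st keep [] i g with st _ _ _ _ g i
    ... | y , j , g₁ , g₂ = y , (x , y) ∷ [] , (i , j , g₁ , g₂) , here refl , λ ()
    insert x {hi} {hi′} st keep ((x₁ , y₁) ∷ zs) i@(i₁ , i₂) (a , b , g , r) with cmp x x₁
    ... | inj₁ l = let (y , (j , k) , g₁ , g₂) = st _ _ _ _ g (i₁ , l) in
      y , (x , y) ∷ (x₁ , y₁) ∷ zs ,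
      (i , (j , above-tr {hi′} k (proj₂ b)) , g₁ , (l , proj₂ a) , (k , proj₂ b) , g₂ , gaps-map keep zs r) , here refl , there
    ... | inj₂ (inj₁ refl) = y₁ , (x₁ , y₁) ∷ zs , (a , b , keep _ _ _ _ g , gaps-map keep zs r) , here refl , id
    ... | inj₂ (inj₂ l) = let (y , zs′ , r′ , m , s) = insert x st keep zs (l , i₂) r in
      y , (x₁ , y₁) ∷ zs′ , (a , b , keep _ _ _ _ g , r′) , there m , λ { (here e) → here e ; (there k) → there (s k) }

    Dominated : GapRel
    Dominated lo hi lo′ hi′ = ∀ c → Ch (In lo hi) c → Ch (In lo′ hi′) c

    DominatedTo : ℕ → GapRel
    DominatedTo M lo hi lo′ hi′ = ∀ c → c ≤ M → Ch (In lo hi) c → Ch (In lo′ hi′) c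

    longest : ∀ P M → ∃ λ c → c ≤ M × Ch P c × (∀ c′ → c′ ≤ M → Ch P c′ → c′ ≤ c)
    longest P zero = 0 , z≤n , tt , λ c l _ → l
    longest P (suc M) with lem (Ch P (suc M)) | longest P M
    ... | yes h | _ = suc M , ≤-refl , h , λ c l _ → l
    ... | no n | c , l , h , m = c , m≤n⇒m≤1+n l , h , λ c′ l′ h′ →
      [ (λ k → m c′ (≤-pred k) h′) , (λ { refl → ⊥-elim (n h′) }) ]′ (m≤n⇒m<n∨m≡n l′)

    -- Counted up to M, the two parts of the gap cut by x have i and j elements; with x this makes i
    -- + 1 + j, at most M + 1 + M. The other gap has a chain of this length, and its element with i
    -- chain elements below it is the reply.
    dominatedTo-split : ∀ M x lo hi lo′ hi′ → DominatedTo (M + suc M) lo hi lo′ hi′ → In lo hi x →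
      ∃ λ y → In lo′ hi′ y × DominatedTo M lo (just x) lo′ (just y) × DominatedTo M (just x) hi (just y) hi′
    dominatedTo-split M x lo hi lo′ hi′ g (a , b) with longest (In lo (just x)) M | longest (In (just x) hi) M
    ... | i , i≤ , ci , mi | j , j≤ , cj , mj with ch-split i (g (i + suc j) (+-mono-≤ i≤ (s≤s j≤))
            (ch-cat i (ch-map i (λ (p , q) → (p , above-tr {hi} q b) , q) ci) (a , b) (ch-map j (λ (p , q) → (below-tr {lo} a p , q) , p) cj)))
    ... | y , p , d , e = y , p ,
      (λ c l h → ch-≤ (mi c l h) (ch-map i (λ ((u , _) , v) → u , v) d)) ,
      (λ c l h → ch-≤ (mj c l h) (ch-map j (λ ((_ , u) , v) → v , u) e))

    -- F′ satisfies no more existential formulas than F (on the arguments below n).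
    Dominates : ℕ → (ℕ → ℕ) → (ℕ → ℕ) → Set
    Dominates n F F′ = ∀ m (G′ : ℕ → ℕ) → n ≤ m → (∀ i → i < n → G′ i ≡ F′ i) →
      ∃ λ (G : ℕ → ℕ) → (∀ i → i < n → G i ≡ F i) × (∀ i j → i < m → j < m → A (G i) (G j) ≡ A (G′ i) (G′ j))

    private
      -- This is 2^d - 1, the size up to which gaps must be compared when d further elements are to
      -- be matched.
      budget : ℕ → ℕ
      budget zero = 0
      budget (suc d) = budget d + suc (budget d)

      dominates-upto : ∀ d n (F G′ : ℕ → ℕ) zs → Gaps (DominatedTo (budget d)) nothing nothing zs nothing nothing →
        (∀ i → i < n → (G′ i , F i) ∈ zs) →
        ∃ λ (G : ℕ → ℕ) → (∀ i → i < n → G i ≡ F i) × (∀ i j → i < d + n → j < d + n → A (G i) (G j) ≡ A (G′ i) (G′ j))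
      dominates-upto zero n F G′ zs g h = F , (λ _ _ → refl) , λ i j p q → sym (Iff-bool (gaps-pattern zs g (h i p) (h j q)))
      dominates-upto (suc d) n F G′ zs g h
        with insert (G′ n) (dominatedTo-split (budget d) (G′ n)) (λ _ _ _ _ p c l → p c (≤-trans l (m≤m+n _ _))) zs (tt , tt) g
      ... | y , zs′ , g′ , m , s with dominates-upto d (suc n) (override n y F) G′ zs′ g′ mem
        where
        mem : ∀ i → i < suc n → (G′ i , override n y F i) ∈ zs′
        mem i l with m≤n⇒m<n∨m≡n (≤-pred l)
        ... | inj₁ k rewrite override-< n y F i k = s (h i k)
        ... | inj₂ refl rewrite override-≡ n y F = m
      ... | G , e , p = G , (λ i l → trans (e i (m<n⇒m<1+n l)) (override-< n y F i l)) ,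
        λ i j a b → p i j (subst (i <_) (sym (+-suc d n)) a) (subst (j <_) (sym (+-suc d n)) b)

    gaps⇒dominates : ∀ n (F F′ : ℕ → ℕ) zs → Gaps Dominated nothing nothing zs nothing nothing → (∀ i → i < n → (F′ i , F i) ∈ zs) → Dominates n F F′
    gaps⇒dominates n F F′ zs g h m G′ l e =
      let (G , a , b) = dominates-upto (m ∸ n) n F G′ zs (gaps-map (λ _ _ _ _ p c _ → p c) zs g)
                          (λ i k → subst (λ v → (v , F i) ∈ zs) (sym (e i k)) (h i k))
          q = m∸n+n≡m l
      in G , a , λ i j p r → b i j (subst (i <_) (sym q) p) (subst (j <_) (sym q) r)

    Sorted : Maybe ℕ → List ℕ → Maybe ℕ → Set
    Sorted lo [] hi = ⊤
    Sorted lo (w ∷ ws) hi = In lo hi w × Sorted (just w) ws hi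

    sorted-in : ∀ {lo ws hi} → Sorted lo ws hi → ∀ {w} → w ∈ ws → In lo hi w
    sorted-in {ws = w ∷ ws} (a , s) (here refl) = a
    sorted-in {lo} {w ∷ ws} {hi} (a , s) (there i) = widenˡ {lo} {hi} (proj₁ a) (sorted-in s i)

    sorted-split : ∀ {lo ws hi x} → Sorted lo ws hi → x ∈ ws →
      ∃ λ ws₁ → ∃ λ ws₂ → ws ≡ ws₁ ++ x ∷ ws₂ × Sorted lo ws₁ (just x) × Sorted (just x) ws₂ hi
    sorted-split {ws = w ∷ ws} (a , s) (here refl) = [] , ws , refl , tt , s
    sorted-split {ws = w ∷ ws} (a , s) (there i) with sorted-split s i
    ... | ws₁ , ws₂ , refl , s₁ , s₂ = w ∷ ws₁ , ws₂ , refl , ((proj₁ a , proj₁ (sorted-in s i)) , s₁) , s₂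

    dupl : List ℕ → List (ℕ × ℕ)
    dupl = map (λ w → w , w)

    dupl-proj : ∀ ws → map proj₂ (dupl ws) ≡ ws
    dupl-proj [] = refl
    dupl-proj (w ∷ ws) = cong (w ∷_) (dupl-proj ws)

    dupl-gaps : ∀ {lo} ws {hi} → Sorted lo ws hi → Gaps Dominated lo lo (dupl ws) hi hi
    dupl-gaps [] s = λ c h → h
    dupl-gaps (w ∷ ws) (a , s) = a , a , (λ c h → h) , dupl-gaps ws s

    gaps-++ : ∀ {Γ lo lo′} zs {ws x y hi hi′} → Gaps Γ lo lo′ zs (just x) (just y) → In lo hi x → In lo′ hi′ y →
      Gaps Γ (just x) (just y) ws hi hi′ → Gaps Γ lo lo′ (zs ++ (x , y) ∷ ws) hi hi′
    gaps-++ [] g a b h = a , b , g , h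
    gaps-++ ((x , y) ∷ zs) {hi = hi} {hi′} ((p , p′) , (q , q′) , γ , g) a b h =
      (p , above-tr {hi} p′ (proj₂ a)) , (q , above-tr {hi′} q′ (proj₂ b)) , γ ,
      gaps-++ zs g (p′ , proj₂ a) (q′ , proj₂ b) h

    Moves : Maybe ℕ → Maybe ℕ → List ℕ → List (ℕ × ℕ) → Set
    Moves lo hi us zs = ∃ λ f → IsIso A A f × OnJust (λ a → f a ≡ a) lo × OnJust (λ a → f a ≡ a) hi ×
      (∀ {x′ x} → (x′ , x) ∈ zs → x ∈ us → f x′ ≡ x)

    -- Over the parameters S, every tuple from the interval has an extension ws such that
    -- automorphisms carry to it all tuples whose gaps are dominated by those of ws.
    Good : List ℕ → Maybe ℕ → Maybe ℕ → Set
    Good S lo hi = ∀ us → (∀ {u} → u ∈ us → In lo hi u) →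
      ∃ λ ws → (∀ {u} → u ∈ us → u ∈ ws) × (∀ {s} → s ∈ S → In lo hi s → s ∈ ws) × Sorted lo ws hi ×
      (∀ zs → map proj₂ zs ≡ ws → Gaps Dominated lo lo zs hi hi → (∀ {s} → s ∈ S → In lo hi s → (s , s) ∈ zs) →
        Moves lo hi us zs)

    good-drop : ∀ {s S lo hi} → ¬ In lo hi s → Good (s ∷ S) lo hi → Good S lo hi
    good-drop n g us h with g us h
    ... | ws , a , b , c , d = ws , a , (λ i → b (there i)) , c , λ zs e k p → d zs e k
      λ { (here refl) q → ⊥-elim (n q) ; (there i) q → p i q }

    split-below : ∀ {hi x} ws₁ {ws₂} → Sorted (just x) ws₂ hi → ∀ {u} → u ∈ ws₁ ++ x ∷ ws₂ → u ≺ x → u ∈ ws₁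
    split-below ws₁ s i l with ∈-++⁻ ws₁ i
    ... | inj₁ j = j
    ... | inj₂ (here refl) = ⊥-elim (≺-irr l)
    ... | inj₂ (there j) = ⊥-elim (≺-irr (≺-tr l (proj₁ (sorted-in s j))))

    split-above : ∀ {lo x} ws₁ {ws₂} → Sorted lo ws₁ (just x) → ∀ {u} → u ∈ ws₁ ++ x ∷ ws₂ → x ≺ u → u ∈ ws₂
    split-above ws₁ s i l with ∈-++⁻ ws₁ i
    ... | inj₁ j = ⊥-elim (≺-irr (≺-tr l (proj₂ (sorted-in s j))))
    ... | inj₂ (here refl) = ⊥-elim (≺-irr l)
    ... | inj₂ (there j) = j

    -- The cut point x is added to the tuple. A competing tuple to the left of x is completed by the
    -- identity to the right of x, so the automorphism granted for the whole interval fixes x and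
    -- serves the left part.
    good-left : ∀ {S lo hi x} → In lo hi x → Good S lo hi → Good S lo (just x)
    good-left {S} {lo} {hi} {x} ix g us h
      with g (x ∷ us) (λ { (here refl) → ix ; (there i) → widenʳ {lo} {hi} (proj₂ ix) (h i) })
    ... | ws , a , b , c , d with sorted-split c (a (here refl))
    ... | ws₁ , ws₂ , refl , s₁ , s₂ = ws₁ , (λ i → split-below ws₁ s₂ (a (there i)) (proj₂ (h i))) ,
        (λ i q → split-below ws₁ s₂ (b i (widenʳ {lo} {hi} (proj₂ ix) q)) (proj₂ q)) , s₁ , fin
      where
      fin : ∀ zs → map proj₂ zs ≡ ws₁ → Gaps Dominated lo lo zs (just x) (just x) →
        (∀ {s} → s ∈ S → In lo (just x) s → (s , s) ∈ zs) → Moves lo (just x) us zs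
      fin zs e k p with d (zs ++ (x , x) ∷ dupl ws₂)
        (trans (map-++ proj₂ zs _) (cong₂ (λ u v → u ++ x ∷ v) e (dupl-proj ws₂)))
        (gaps-++ zs k ix ix (dupl-gaps ws₂ s₂))
        (λ {s} i q → case cmp s x of λ
          { (inj₁ l) → ∈-++⁺ˡ (p i (proj₁ q , l))
          ; (inj₂ (inj₁ refl)) → ∈-++⁺ʳ zs (here refl)
          ; (inj₂ (inj₂ l)) → ∈-++⁺ʳ zs (there (∈-map⁺ _ (split-above ws₁ s₁ (b i q) l))) })
      ... | f , iso , fl , fh , ft = f , iso , fl , ft (∈-++⁺ʳ zs (here refl)) (here refl) ,
        λ i j → ft (∈-++⁺ˡ i) (there j)

    good-right : ∀ {S lo hi x} → In lo hi x → Good S lo hi → Good S (just x) hi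
    good-right {S} {lo} {hi} {x} ix g us h
      with g (x ∷ us) (λ { (here refl) → ix ; (there i) → widenˡ {lo} {hi} (proj₁ ix) (h i) })
    ... | ws , a , b , c , d with sorted-split c (a (here refl))
    ... | ws₁ , ws₂ , refl , s₁ , s₂ = ws₂ , (λ i → split-above ws₁ s₁ (a (there i)) (proj₁ (h i))) ,
        (λ i q → split-above ws₁ s₁ (b i (widenˡ {lo} {hi} (proj₁ ix) q)) (proj₁ q)) , s₂ , fin
      where
      fin : ∀ zs → map proj₂ zs ≡ ws₂ → Gaps Dominated (just x) (just x) zs hi hi →
        (∀ {s} → s ∈ S → In (just x) hi s → (s , s) ∈ zs) → Moves (just x) hi us zs
      fin zs e k p with d (dupl ws₁ ++ (x , x) ∷ zs)
        (trans (map-++ proj₂ (dupl ws₁) _) (cong₂ (λ u v → u ++ x ∷ v) (dupl-proj ws₁) e))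
        (gaps-++ (dupl ws₁) (dupl-gaps ws₁ s₁) ix ix k)
        (λ {s} i q → case cmp s x of λ
          { (inj₁ l) → ∈-++⁺ˡ (∈-map⁺ _ (split-below ws₁ s₂ (b i q) l))
          ; (inj₂ (inj₁ refl)) → ∈-++⁺ʳ (dupl ws₁) (here refl)
          ; (inj₂ (inj₂ l)) → ∈-++⁺ʳ (dupl ws₁) (there (p i (l , proj₂ q))) })
      ... | f , iso , fl , fh , ft = f , iso , ft (∈-++⁺ʳ (dupl ws₁) (here refl)) (here refl) , fh ,
        λ i j → ft (∈-++⁺ʳ (dupl ws₁) (there i)) (there j)

  -- A generic copy and its Scott family

  -- Requirements in the generic construction are numbered, so oracle terms have to be enumerated.
  -- Trees are an untyped syntax for them: `decRec` reads a tree at any arity, turning malformed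
  -- ones into `zro`, and `decRec-onto` shows that every term is reached.
  data Tree : Set where
    leaf : Tree
    node : Tree → Tree → Tree

  toN : Tree → ℕ
  toN leaf = 0
  toN (node _ b) = suc (toN b)

  ofN : ℕ → Tree
  ofN zero = leaf
  ofN (suc n) = node leaf (ofN n)

  toN-ofN : ∀ n → toN (ofN n) ≡ n
  toN-ofN zero = refl
  toN-ofN (suc n) = cong suc (toN-ofN n)

  sc? orc? : ∀ n → Rec (just 2) n
  sc? 1 = sc
  sc? _ = zro
  orc? 2 = orc refl
  orc? _ = zro

  proj? : ∀ n → ℕ → Rec (just 2) n
  proj? zero k = zro
  proj? (suc n) zero = proj zero
  proj? (suc zero) (suc k) = zro
  proj? (suc (suc n)) (suc k) with proj? (suc n) k
  ... | proj i = proj (suc i)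
  ... | _ = zro

  mutual
    decRec : Tree → ∀ n → Rec (just 2) n
    decRec leaf n = zro
    decRec (node a b) n = decTag (toN a) b n

    decTag : ℕ → Tree → ∀ n → Rec (just 2) n
    decTag 0 b n = sc? n
    decTag 1 b n = proj? n (toN b)
    decTag 2 (node m (node f gs)) n = comp (decRec f (toN m)) (decVec gs n (toN m))
    decTag 3 (node f g) (suc n) = prec (decRec f n) (decRec g (suc (suc n)))
    decTag 4 b n = mu (decRec b (suc n))
    decTag 5 b n = orc? n
    decTag _ _ n = zro

    decVec : Tree → ∀ n m → Vec (Rec (just 2) n) m
    decVec t n zero = []
    decVec leaf n (suc m) = zro ∷ decVec leaf n m
    decVec (node a b) n (suc m) = decRec a n ∷ decVec b n m

  proj?-toℕ : ∀ {n} (i : Fin n) → proj? n (toℕ i) ≡ proj i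
  proj?-toℕ {suc n} zero = refl
  proj?-toℕ {suc (suc n)} (suc i) rewrite proj?-toℕ i = refl

  mutual
    decRec-onto : ∀ {n} (t : Rec (just 2) n) → ∃ λ T → decRec T n ≡ t
    decRec-onto zro = leaf , refl
    decRec-onto sc = node (ofN 0) leaf , refl
    decRec-onto {n} (proj i) = node (ofN 1) (ofN (toℕ i)) ,
      trans (cong (proj? n) (toN-ofN (toℕ i))) (proj?-toℕ i)
    decRec-onto {n} (comp {m} f gs) with decRec-onto f | decVec-onto gs
    ... | F , refl | G , refl = node (ofN 2) (node (ofN m) (node F G)) ,
      cong (λ k → comp (decRec F k) (decVec G n k)) (toN-ofN m)
    decRec-onto (prec f g) with decRec-onto f | decRec-onto g
    ... | F , refl | G , refl = node (ofN 3) (node F G) , refl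
    decRec-onto (mu f) with decRec-onto f
    ... | F , refl = node (ofN 4) F , refl
    decRec-onto (orc refl) = node (ofN 5) leaf , refl

    decVec-onto : ∀ {n m} (ts : Vec (Rec (just 2) n) m) → ∃ λ T → decVec T n m ≡ ts
    decVec-onto [] = leaf , refl
    decVec-onto (t ∷ ts) with decRec-onto t | decVec-onto ts
    ... | F , refl | G , refl = node F G , refl

  -- The depth bound k makes the recursion structural; `treeOf` reads the bound off the code as
  -- well, so the enumeration remains onto.
  treeUpTo : ℕ → ℕ → Tree
  treeUpTo zero c = leaf
  treeUpTo (suc k) zero = leaf
  treeUpTo (suc k) (suc c) = node (treeUpTo k (π₁ c)) (treeUpTo k (π₂ c))

  treeOf : ℕ → Tree
  treeOf n = treeUpTo (π₁ n) (π₂ n)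

  treeUpTo-onto : ∀ T → ∃ λ c → Eventually (λ k → treeUpTo k c ≡ T)
  treeUpTo-onto leaf = 0 , 0 , λ { zero _ → refl ; (suc k) _ → refl }
  treeUpTo-onto (node a b) with treeUpTo-onto a | treeUpTo-onto b
  ... | c , u | d , v with eventually-× u v
  ... | k₀ , h = suc (pair c d) , suc k₀ , λ { (suc k) (s≤s l) → cong₂ node
    (trans (cong (treeUpTo k) (π₁-pair c d)) (proj₁ (h k l)))
    (trans (cong (treeUpTo k) (π₂-pair c d)) (proj₂ (h k l))) }

  treeOf-onto : ∀ T → ∃ λ n → treeOf n ≡ T
  treeOf-onto T with treeUpTo-onto T
  ... | c , k , h = pair k c , trans (cong₂ treeUpTo (π₁-pair k c) (π₂-pair k c)) (h k ≤-refl)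

  -- A finite injection: only the values of fn below len matter.
  record Cond : Set where
    constructor mkCond
    field
      len : ℕ
      fn : ℕ → ℕ
      inj : ∀ i j → i < len → j < len → fn i ≡ fn j → i ≡ j
  open Cond

  infix 4 _⊑_ _⊏_
  _⊑_ : Cond → Cond → Set
  p ⊑ q = len p ≤ len q × (∀ i → i < len p → fn q i ≡ fn p i)

  _⊏_ : Cond → (ℕ → ℕ) → Set
  p ⊏ F = ∀ i → i < len p → F i ≡ fn p i

  ⊑-refl : ∀ {p} → p ⊑ p
  ⊑-refl = ≤-refl , λ _ _ → refl

  ⊑-trans : ∀ {p q r} → p ⊑ q → q ⊑ r → p ⊑ r
  ⊑-trans (l , f) (m , g) = ≤-trans l m , λ i h → trans (g i (<-≤-trans h l)) (f i h)

  ⊏-⊑ : ∀ {p q F} → p ⊏ F → q ⊏ F → len p ≤ len q → p ⊑ q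
  ⊏-⊑ a b l = l , λ i h → trans (sym (b i (<-≤-trans h l))) (a i h)

  ⊏-dir : ∀ {p q F} → p ⊏ F → q ⊏ F → ∃ λ r → r ⊏ F × p ⊑ r × q ⊑ r
  ⊏-dir {p} {q} a b with ≤-total (len p) (len q)
  ... | inj₁ l = q , b , ⊏-⊑ {p} {q} a b l , ⊑-refl {q}
  ... | inj₂ l = p , a , ⊑-refl {p} , ⊏-⊑ {q} {p} b a l

  append : ∀ p v → (∀ i → i < len p → fn p i ≢ v) → ∃ λ q → p ⊑ q × len q ≡ suc (len p) × fn q (len p) ≡ v
  append p v new = mkCond (suc n) (override n v (fn p)) ij ,
    (n≤1+n n , override-< n v (fn p)) , refl , override-≡ n v (fn p)
    where
    n = len p
    ij : ∀ i j → i < suc n → j < suc n → override n v (fn p) i ≡ override n v (fn p) j → i ≡ j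
    ij i j a b e with m≤n⇒m<n∨m≡n (≤-pred a) | m≤n⇒m<n∨m≡n (≤-pred b)
    ... | inj₁ a | inj₁ b = inj p i j a b (trans (sym (override-< n v (fn p) i a)) (trans e (override-< n v (fn p) j b)))
    ... | inj₁ a | inj₂ refl = ⊥-elim (new i a (trans (sym (override-< n v (fn p) i a)) (trans e (override-≡ n v (fn p)))))
    ... | inj₂ refl | inj₁ b = ⊥-elim (new j b (trans (sym (override-< n v (fn p) j b)) (trans (sym e) (override-≡ n v (fn p)))))
    ... | inj₂ refl | inj₂ refl = refl

  cover : ∀ p v → ∃ λ q → p ⊑ q × (∃ λ i → i < len q × fn q i ≡ v)
  cover p v with lem (∃ λ i → i < len p × fn p i ≡ v)
  ... | yes h = p , ⊑-refl {p} , h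
  ... | no n with append p v (λ i l e → n (i , l , e))
  ... | q , s , e , f = q , s , len p , subst (len p <_) (sym e) ≤-refl , f

  lengthen : ∀ p → ∃ λ q → p ⊑ q × len p < len q
  lengthen p with bound-below (λ z N → fn p z < N) (λ l h → <-≤-trans h l) (len p) (λ z _ → suc (fn p z) , ≤-refl)
  ... | N , h with append p N (λ i l e → <-irrefl e (h i l))
  ... | q , s , e , _ = q , s , subst (len p <_) (sym e) ≤-refl

  -- Each requirement is settled in one step: either some extension of the current condition meets
  -- it and is taken, or the current condition itself excludes it for good. Covering makes F onto,
  -- lengthening makes it total.
  generic : (Q : ℕ → Cond → Set) → ∃ λ F → (∀ i j → F i ≡ F j → i ≡ j) × (∀ v → ∃ λ i → F i ≡ v) ×
    (∀ N → ∃ λ p → p ⊏ F × N ≤ len p) ×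
    (∀ k → (∃ λ q → q ⊏ F × Q k q) ⊎ (∃ λ p → p ⊏ F × (∀ q → p ⊑ q → ¬ Q k q)))
  generic Q = F , Finj , Fsur , (λ N → c N , c⊏F N , c-len N) , decided
    where
    pick : ∀ k p → ∃ λ q → p ⊑ q × (Q k q ⊎ (∀ r → p ⊑ r → ¬ Q k r))
    pick k p with lem (∃ λ q → p ⊑ q × Q k q)
    ... | yes (q , s , h) = q , s , inj₁ h
    ... | no n = p , ⊑-refl {p} , inj₂ λ r s h → n (r , s , h)
    next : ℕ → Cond → Cond
    next k p = proj₁ (lengthen (proj₁ (cover (proj₁ (pick k p)) k)))
    c : ℕ → Cond
    c zero = mkCond 0 id λ _ _ ()
    c (suc k) = next k (c k)
    picked : ℕ → Cond
    picked k = proj₁ (pick k (c k))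
    s₁ : ∀ k → c k ⊑ picked k
    s₁ k = proj₁ (proj₂ (pick k (c k)))
    s₂ : ∀ k → picked k ⊑ proj₁ (cover (picked k) k)
    s₂ k = proj₁ (proj₂ (cover (picked k) k))
    s₃ : ∀ k → proj₁ (cover (picked k) k) ⊑ c (suc k)
    s₃ k = proj₁ (proj₂ (lengthen (proj₁ (cover (picked k) k))))
    s₂₃ : ∀ k → picked k ⊑ c (suc k)
    s₂₃ k = ⊑-trans {picked k} {proj₁ (cover (picked k) k)} {c (suc k)} (s₂ k) (s₃ k)
    step : ∀ k → c k ⊑ c (suc k)
    step k = ⊑-trans {c k} {picked k} {c (suc k)} (s₁ k) (s₂₃ k)
    c-mono : ∀ k d → c k ⊑ c (d + k)
    c-mono k zero = ⊑-refl {c k}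
    c-mono k (suc d) = ⊑-trans {c k} {c (d + k)} {c (suc (d + k))} (c-mono k d) (step (d + k))
    c-≤ : ∀ {k m} → k ≤ m → c k ⊑ c m
    c-≤ {k} {m} l = subst (λ z → c k ⊑ c z) (m∸n+n≡m l) (c-mono k (m ∸ k))
    c-len : ∀ k → k ≤ len (c k)
    c-len zero = z≤n
    c-len (suc k) = ≤-<-trans (c-len k) (≤-<-trans (≤-trans (proj₁ (s₁ k)) (proj₁ (s₂ k)))
      (proj₂ (proj₂ (lengthen (proj₁ (cover (picked k) k))))))
    F : ℕ → ℕ
    F i = fn (c (suc i)) i
    c⊏F : ∀ k → c k ⊏ F
    c⊏F k i l with ≤-total k (suc i)
    ... | inj₁ h = proj₂ (c-≤ h) i l
    ... | inj₂ h = sym (proj₂ (c-≤ h) i (c-len (suc i)))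
    Finj : ∀ i j → F i ≡ F j → i ≡ j
    Finj i j e = inj (c k) i j li lj (trans (sym (c⊏F k i li)) (trans e (c⊏F k j lj)))
      where
      k = suc (i ⊔ j)
      li : i < len (c k)
      li = <-≤-trans (s≤s (m≤m⊔n i j)) (c-len k)
      lj : j < len (c k)
      lj = <-≤-trans (s≤s (m≤n⊔m i j)) (c-len k)
    Fsur : ∀ v → ∃ λ i → F i ≡ v
    Fsur v with proj₂ (proj₂ (cover (picked v) v))
    ... | i , l , e = i , trans (c⊏F (suc v) i (<-≤-trans l (proj₁ (s₃ v)))) (trans (proj₂ (s₃ v) i l) e)
    picked⊏F : ∀ k → picked k ⊏ F
    picked⊏F k i l = trans (c⊏F (suc k) i (<-≤-trans l (proj₁ (s₂₃ k)))) (proj₂ (s₂₃ k) i l)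
    decided : ∀ k → (∃ λ q → q ⊏ F × Q k q) ⊎ (∃ λ p → p ⊏ F × (∀ q → p ⊑ q → ¬ Q k q))
    decided k with proj₂ (proj₂ (pick k (c k)))
    ... | inj₁ h = inj₁ (picked k , picked⊏F k , h)
    ... | inj₂ h = inj₂ (c k , c⊏F k , h)

  pull : (ℕ → ℕ) → Rel → Rel
  pull F A i j = A (F i) (F j)

  -- Forcing the values of a Δ⁰₂ isomorphism

  module Forcing (A : Rel) (linA : IsLinearOrder A) where
    open Order A linA using (Dominates)

    Refutes : Cond → ∀ {n} → Rec (just 2) n → Vec ℕ n → Set
    Refutes q t xs = ∀ R → Agree (len q) (pull (fn q) A) R → Ev (diag R) t xs 0

    -- Forcing for the Σ⁰₂ formula with matrix t at the pair i, y. For a fixed a, its failure is an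
    -- existential property of the tuple q: some extension refutes the matrix at some b.
    Forces : Cond → Rec (just 2) 4 → ℕ → ℕ → Set
    Forces q t i y = ∃ λ a → ∀ r → q ⊑ r → ∀ b → ¬ Refutes r t (b ∷ a ∷ i ∷ y ∷ [])

    forces-⊑ : ∀ {q r t i y} → q ⊑ r → Forces q t i y → Forces r t i y
    forces-⊑ {q} {r} s (a , h) = a , λ u s′ → h u (⊑-trans {q} {r} {u} s s′)

    MovesTo : Cond → ℕ → (ℕ → ℕ) → Set
    MovesTo q n Y = ∃ λ f → IsIso A A f × (∀ i → i < n → f (fn q i) ≡ Y i)

    -- Suppose an extension r of q′ refutes the matrix. By domination the order pattern of r is
    -- realised by an extension of q, which gives the same oracle answers and so refutes there what
    -- q forces.
    forces-dominates : ∀ {q q′ t i y} → len q ≡ len q′ → Dominates (len q) (fn q) (fn q′) → Forces q t i y → Forces q′ t i y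
    forces-dominates {q} {q′} e dom (a , h) = a , λ r s b ref →
      let (G , g , pat) = dom (len r) (fn r) (subst (_≤ len r) (sym e) (proj₁ s))
                            (λ i l → proj₂ s i (subst (i <_) e l))
      in h (mkCond (len r) G (λ i j li lj eq → inj r i j li lj (ij r G pat i j li lj eq)))
           (subst (_≤ len r) (sym e) (proj₁ s) , g) b
           λ R ag → ref R λ i j li lj → trans (sym (pat i j li lj)) (ag i j li lj)
      where
      ij : ∀ r (G : ℕ → ℕ) → (∀ i j → i < len r → j < len r → A (G i) (G j) ≡ A (fn r i) (fn r j)) →
        ∀ i j → i < len r → j < len r → G i ≡ G j → fn r i ≡ fn r j
      ij r G pat i j li lj eq with fn r i ≟ fn r j
      ... | yes e = e
      ... | no n with proj₂ (proj₂ linA) _ _ n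
      ... | inj₁ l = ⊥-elim (true≢false l (trans (sym (pat i j li lj)) (trans (cong (A (G i)) (sym eq)) (proj₁ linA (G i)))))
      ... | inj₂ l = ⊥-elim (true≢false l (trans (sym (pat j i lj li)) (trans (cong (A (G j)) eq) (proj₁ linA (G j)))))

    -- The two obstacles to reading t as an isomorphism from the generic copy: an argument at which
    -- no value can be forced, and forced values that no automorphism produces.
    Undefined Wrong : Rec (just 2) 4 → Cond → Set
    Undefined t q = ∃ λ i → ∀ r → q ⊑ r → ∀ y → ¬ Forces r t i y
    Wrong t q = ∃ λ n → n ≤ len q × (∃ λ Y → (∀ i → i < n → Forces q t i (Y i)) × ¬ MovesTo q n Y)

    -- Three kinds of requirement, told apart by the shape of the tree; deciding all of them is the
    -- genericity that the proof uses. The third kind decides whether a witness a of the Σ⁰₂ formula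
    -- is refuted by some b.
    request : Tree → Cond → Set
    request leaf q = ⊥
    request (node T leaf) = Undefined (decRec T 4)
    request (node T (node leaf _)) = Wrong (decRec T 4)
    request (node T (node (node a i) y)) q =
      ∃ λ b → Refutes q (decRec T 4) (b ∷ toN a ∷ toN i ∷ toN y ∷ [])

    -- A Scott family of dominated tuples, read off a sufficiently generic copy.
    Scott : Set
    Scott = ∃ λ p → ∀ q₀ → p ⊑ q₀ → ∃ λ q₁ → q₀ ⊑ q₁ × (∀ q₁′ → p ⊑ q₁′ → len q₁ ≡ len q₁′ →
      Dominates (len q₁) (fn q₁) (fn q₁′) → ∃ λ f → IsIso A A f × (∀ i → i < len q₀ → f (fn q₁′ i) ≡ fn q₁ i))

    module _ (t : Rec (just 2) 4) (p : Cond) (defined : ∀ q → p ⊑ q → ¬ Undefined t q) (right : ∀ q → p ⊑ q → ¬ Wrong t q) where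
      force-below : ∀ n q → p ⊑ q → ∃ λ r → q ⊑ r × (∃ λ (Y : ℕ → ℕ) → ∀ i → i < n → Forces r t i (Y i))
      force-below zero q s = q , ⊑-refl {q} , id , λ _ ()
      force-below (suc n) q s with force-below n q s
      ... | r , s′ , Y , h with lem (∃ λ u → r ⊑ u × (∃ λ y → Forces u t n y))
      ... | no none = ⊥-elim (defined r (⊑-trans {p} {q} {r} s s′) (n , λ u s″ y k → none (u , s″ , y , k)))
      ... | yes (u , s″ , y , k) = u , ⊑-trans {q} {r} {u} s′ s″ , override n y Y , g
        where
        g : ∀ i → i < suc n → Forces u t i (override n y Y i)
        g i l with m≤n⇒m<n∨m≡n (≤-pred l)
        ... | inj₁ l = subst (Forces u t i) (sym (override-< n y Y i l)) (forces-⊑ {r} {u} s″ (h i l))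
        ... | inj₂ refl = subst (Forces u t i) (sym (override-≡ n y Y)) k

      moves : ∀ q n Y → p ⊑ q → n ≤ len q → (∀ i → i < n → Forces q t i (Y i)) → MovesTo q n Y
      moves q n Y s l h with lem (MovesTo q n Y)
      ... | yes m = m
      ... | no m = ⊥-elim (right q s (n , l , Y , h , m))

      -- Both q₁ and q₁′ force the same values Y on the arguments of q₀, the latter by
      -- `forces-dominates`. Automorphisms f and g take the two tuples to Y, so g followed by the
      -- inverse of f takes the second tuple to the first.
      scott : Scott
      scott = p , λ q₀ s → let (q₁ , s′ , Y , h) = force-below (len q₀) q₀ s in q₁ , s′ , λ q₁′ s″ e dom →
        let (f , if , mf) = moves q₁ (len q₀) Y (⊑-trans {p} {q₀} {q₁} s s′) (proj₁ s′) h
            (g , ig , mg) = moves q₁′ (len q₀) Y s″ (subst (len q₀ ≤_) e (proj₁ s′))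
                              (λ i l → forces-dominates {q₁} {q₁′} e dom (h i l))
            (f⁻ , if⁻ , ff , _) = iso-sym {A} {A} f if
        in f⁻ ∘ g , iso-∘ {A} {A} {A} {g} {f⁻} ig if⁻ , λ i l → trans (cong f⁻ (trans (mg i l) (sym (mf i l)))) (ff _)

    -- Along the generic F forced values are true, since a false instance is refuted by finitely
    -- many oracle answers; and true values are forced, since the request for their witness a was
    -- decided. So no initial segment of F is `Undefined` or `Wrong`, and genericity gives one all
    -- of whose extensions are neither.
    delta2⇒scott : RelDelta2Cat A → Scott
    delta2⇒scott cat with generic (λ k → request (treeOf k))
    ... | F , Finj , Fsur , long , decided with cat (pull F A) (F , (λ _ _ → refl) , Finj , Fsur)
    ... | h , isoh , (t , tb , eqv) , _ with decRec-onto t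
    ... | T , refl = scott t p (λ q s → proj₂ (proj₂ notU) q (⊑-trans {proj₁ notU} {p} {q} (proj₁ (proj₂ (proj₂ dir))) s))
                               (λ q s → proj₂ (proj₂ notW) q (⊑-trans {proj₁ notW} {p} {q} (proj₂ (proj₂ (proj₂ dir))) s))
      where
      decide : ∀ U → (∃ λ q → q ⊏ F × request U q) ⊎ (∃ λ p → p ⊏ F × (∀ q → p ⊑ q → ¬ request U q))
      decide U = subst (λ V → (∃ λ q → q ⊏ F × request V q) ⊎ (∃ λ p → p ⊏ F × (∀ q → p ⊑ q → ¬ request V q)))
        (proj₂ (treeOf-onto U)) (decided (proj₁ (treeOf-onto U)))

      refute-ev : ∀ {q n} {t : Rec (just 2) n} {xs} → q ⊏ F → Refutes q t xs → Ev (diag (pull F A)) t xs 0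
      refute-ev s ref = ref (pull F A) λ i j li lj → sym (cong₂ A (s i li) (s j lj))

      ev-refute : ∀ q {xs} → q ⊏ F → Ev (diag (pull F A)) t xs 0 → ∃ λ r → q ⊑ r × Refutes r t xs
      ev-refute q s e with use t e
      ... | N , u with long (N ⊔ len q)
      ... | r , s′ , l = r , ⊏-⊑ {q} {r} s s′ (m⊔n≤o⇒n≤o N _ l) , λ R ag → u R λ i j li lj →
        trans (cong₂ A (s′ i (<-≤-trans li l′)) (s′ j (<-≤-trans lj l′))) (ag i j (<-≤-trans li l′) (<-≤-trans lj l′))
        where
        l′ : N ≤ len r
        l′ = m⊔n≤o⇒m≤o N _ l

      forced-value : ∀ q i y → q ⊏ F → Forces q t i y → h i ≡ y
      forced-value q i y s (a , no-ref) = proj₂ (eqv (i ∷ y ∷ [])) (a , λ b → toMatrix tb λ e →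
        let (r , s′ , ref) = ev-refute q s e in no-ref r s′ b ref)

      value-forced : ∀ i → ∃ λ p → p ⊏ F × Forces p t i (h i)
      value-forced i with proj₁ (eqv (i ∷ h i ∷ [])) refl
      ... | a , ev with decide (node T (node (node (ofN a) (ofN i)) (ofN (h i))))
      ... | r rewrite toN-ofN a | toN-ofN i | toN-ofN (h i) with r
      ... | inj₁ (q , s , b , ref) = ⊥-elim (case Ev-det t (ev b) (refute-ev {q} s ref) of λ ())
      ... | inj₂ (p , s , n) = p , s , a , λ q s′ b ref → n q s′ (b , ref)

      notU : ∃ λ p → p ⊏ F × (∀ q → p ⊑ q → ¬ Undefined t q)
      notU with decide (node T leaf)
      ... | inj₂ r = r
      ... | inj₁ (q , s , i , u) with value-forced i
      ... | p , s′ , k with ⊏-dir {q} {p} s s′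
      ... | r , _ , a , b = ⊥-elim (u r a (h i) (forces-⊑ {p} {r} b k))

      notW : ∃ λ p → p ⊏ F × (∀ q → p ⊑ q → ¬ Wrong t q)
      notW with decide (node T (node leaf leaf))
      ... | inj₂ r = r
      ... | inj₁ (q , s , n , l , Y , k , m) with iso-sym {pull F A} {A} F ((λ _ _ → refl) , Finj , Fsur)
      -- The automorphism h ∘ F⁻ of A takes `fn q i` to h i, which is the forced value; this
      -- contradicts `Wrong`.
      ... | F⁻ , iF⁻ , FF , _ = ⊥-elim (m (h ∘ F⁻ , iso-∘ {A} {pull F A} {A} {F⁻} {h} iF⁻ isoh , λ i li →
        trans (cong (λ z → h (F⁻ z)) (sym (s i (<-≤-trans li l)))) (trans (cong h (FF i)) (forced-value q i (Y i) s (k i li)))))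

      dir : ∃ λ r → r ⊏ F × proj₁ notU ⊑ r × proj₁ notW ⊑ r
      dir = ⊏-dir {proj₁ notU} {proj₁ notW} (proj₁ (proj₂ notU)) (proj₁ (proj₂ notW))
      p = proj₁ dir

  range : Cond → List ℕ
  range p = map (fn p) (upTo (len p))

  module _ (A : Rel) (linA : IsLinearOrder A) where
    open Order A linA
    open Forcing A linA using (Scott)

    insert-sorted : ∀ x ws {lo hi} → In lo hi x → Sorted lo ws hi →
      ∃ λ ws′ → Sorted lo ws′ hi × x ∈ ws′ × (∀ {w} → w ∈ ws → w ∈ ws′)
    insert-sorted x [] i s = x ∷ [] , (i , tt) , here refl , λ ()
    insert-sorted x (w ∷ ws) i (j , s) with cmp x w
    ... | inj₁ l = x ∷ w ∷ ws , (i , (l , proj₂ j) , s) , here refl , there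
    ... | inj₂ (inj₁ refl) = w ∷ ws , (j , s) , here refl , id
    ... | inj₂ (inj₂ l) = let (ws′ , s′ , m , k) = insert-sorted x ws (l , proj₂ i) s in
      w ∷ ws′ , (j , s′) , there m , λ { (here e) → here e ; (there q) → there (k q) }

    sort-range : ∀ n (F : ℕ → ℕ) → ∃ λ ws → Sorted nothing ws nothing × (∀ i → i < n → F i ∈ ws)
    sort-range zero F = [] , tt , λ _ ()
    sort-range (suc n) F with sort-range n F
    ... | ws , s , h with insert-sorted (F n) ws (tt , tt) s
    ... | ws′ , s′ , m , k = ws′ , s′ , λ i l → [ (λ l′ → k (h i l′)) , (λ { refl → m }) ]′ (m≤n⇒m<n∨m≡n (≤-pred l))

    cover-all : ∀ p us → ∃ λ q → p ⊑ q × (∀ {u} → u ∈ us → ∃ λ i → i < len q × fn q i ≡ u)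
    cover-all p [] = p , ⊑-refl {p} , λ ()
    cover-all p (u ∷ us) with cover-all p us
    ... | q , s , h with cover q u
    ... | r , s′ , k = r , ⊑-trans {p} {q} {r} s s′ , λ
      { (here refl) → k
      ; (there i) → let (j , l , e) = h i in j , <-≤-trans l (proj₁ s′) , trans (proj₂ s′ j l) e }

    -- The tuple is covered by a condition over p, the Scott family extends it to q₁, and ws is the
    -- sorted range of q₁. A competing list is read as a condition q₁′ with the same indices; it
    -- extends p because the parameters are paired with themselves.
    scott⇒good : (sc : Scott) → Good (range (proj₁ sc)) nothing nothing
    scott⇒good (p , scott) us _ with cover-all p us
    ... | q₀ , s₀ , cov with scott q₀ s₀
    ... | q₁ , s₁ , fam with sort-range (len q₁) (fn q₁)
    ... | ws , sw , mem = ws , us⊆ , S⊆ , sw , fin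
      where
      us⊆ : ∀ {u} → u ∈ us → u ∈ ws
      us⊆ i with cov i
      ... | j , l , refl = subst (_∈ ws) (proj₂ s₁ j l) (mem j (<-≤-trans l (proj₁ s₁)))
      s₀₁ : p ⊑ q₁
      s₀₁ = ⊑-trans {p} {q₀} {q₁} s₀ s₁
      S⊆ : ∀ {s} → s ∈ range p → In nothing nothing s → s ∈ ws
      S⊆ i _ with ∈-map⁻ (fn p) i
      ... | j , m , refl = subst (_∈ ws) (proj₂ s₀₁ j (∈-upTo⁻ m)) (mem j (<-≤-trans (∈-upTo⁻ m) (proj₁ s₀₁)))
      fin : ∀ zs → map proj₂ zs ≡ ws → Gaps Dominated nothing nothing zs nothing nothing →
        (∀ {s} → s ∈ range p → In nothing nothing s → (s , s) ∈ zs) → Moves nothing nothing us zs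
      fin zs refl g S∈ = f , iso , tt , tt , λ {x′} {x} → ft {x′} {x}
        where
        partner : ∀ i → ∃ λ x → i < len q₁ → (x , fn q₁ i) ∈ zs
        partner i with i <? len q₁
        ... | no n = 0 , λ l → ⊥-elim (n l)
        ... | yes l with ∈-map⁻ proj₂ (mem i l)
        ... | (x , _) , m , refl = x , λ _ → m
        q₁′ : Cond
        q₁′ = mkCond (len q₁) (λ i → proj₁ (partner i)) λ i j li lj e → inj q₁ i j li lj
          (proj₁ (gaps-functional zs g (proj₂ (partner i) li) (proj₂ (partner j) lj)) e)
        p⊑ : p ⊑ q₁′
        p⊑ = proj₁ s₀₁ , λ i l → proj₂ (gaps-functional zs g (proj₂ (partner i) (<-≤-trans l (proj₁ s₀₁)))
          (S∈ (∈-map⁺ (fn p) (∈-upTo⁺ l)) (tt , tt))) (proj₂ s₀₁ i l)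
        res = fam q₁′ p⊑ refl (gaps⇒dominates (len q₁) (fn q₁) (fn q₁′) zs g (λ i l → proj₂ (partner i) l))
        f = proj₁ res
        iso = proj₁ (proj₂ res)
        ft : ∀ {x′ x} → (x′ , x) ∈ zs → x ∈ us → f x′ ≡ x
        ft {x′} {x} i u with cov u
        ... | j , l , refl = trans (cong f (proj₂ (gaps-functional zs g i (proj₂ (partner j) (<-≤-trans l (proj₁ s₁)))) (sym (proj₂ s₁ j l))))
          (trans (proj₂ (proj₂ res) j l) (proj₂ s₁ j l))

  -- Makes every later argument about left ends available for right ends.
  scott-flip : ∀ {A} (linA : IsLinearOrder A) → Forcing.Scott A linA → Forcing.Scott (flip A) (flip-linear linA)
  scott-flip linA (p , h) = p , λ q₀ s → let (q₁ , s′ , k) = h q₀ s in q₁ , s′ , λ q₁′ s″ e dom →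
    let (f , (pf , rest) , m) = k q₁′ s″ e λ n G′ l a → let (G , b , c) = dom n G′ l a in G , b , λ i j li lj → c j i lj li
    in f , ((λ x y → pf y x) , rest) , m

  -- A punctual dense order

  shift : ℕ → ℕ → ℕ
  shift zero x = x
  shift (suc i) x = shift i x / 3

  digit : ℕ → ℕ → ℕ
  digit i x = shift i x % 3

  rank : ℕ → ℕ
  rank 0 = 1
  rank 1 = 0
  rank (suc (suc n)) = suc (suc n)

  rank-inj : ∀ a b → rank a ≡ rank b → a ≡ b
  rank-inj 0 0 _ = refl
  rank-inj 0 1 ()
  rank-inj 0 (suc (suc b)) ()
  rank-inj 1 1 _ = refl
  rank-inj (suc (suc a)) (suc (suc b)) e = e

  differ : ℕ → ℕ → ℕ → Bool
  differ x y i = not (digit i x ≡ᵇ digit i y)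

  abstract
    -- A dense order without endpoints: base-3 expansions are compared at their lowest difference,
    -- with the digits ordered 1 < 0 < 2, so that the padding digit 0 is the middle one.
    Q : Rel
    Q x y = rank (digit (leastBelow (differ x y) (x + y)) x) <ᵇ rank (digit (leastBelow (differ x y) (x + y)) y)

  Below : ℕ → ℕ → ℕ → Set
  Below i x y = (∀ j → j < i → digit j x ≡ digit j y) × rank (digit i x) < rank (digit i y)

  shift-/ : ∀ i x → shift i (x / 3) ≡ shift i x / 3
  shift-/ zero x = refl
  shift-/ (suc i) x = cong (_/ 3) (shift-/ i x)

  shift-≤ : ∀ i x → shift i x ≤ x ∸ i
  shift-≤ zero x = ≤-refl
  shift-≤ (suc i) x = ≤-trans (third (shift i x)) (subst (pred (shift i x) ≤_) (pred[m∸n]≡m∸[1+n] x i) (pred-mono-≤ (shift-≤ i x)))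
    where
    third : ∀ m → m / 3 ≤ pred m
    third zero = z≤n
    third (suc m) = ≤-pred (m/n<m (suc m) 3 (s≤s (s≤s z≤n)))

  -- All digits of x and y vanish from position x + y on, which is why `Q` may search for a
  -- difference below x + y only.
  digit-≥ : ∀ i x → x ≤ i → digit i x ≡ 0
  digit-≥ i x l = cong (_% 3) (n≤0⇒n≡0 (subst (shift i x ≤_) (m≤n⇒m∸n≡0 l) (shift-≤ i x)))

  same-digit : ∀ {x y i} → differ x y i ≡ false → digit i x ≡ digit i y
  same-digit {x} {y} {i} e with digit i x ≡ᵇ digit i y in e′
  ... | true = ᵇ⇒≡ e′

  first-differ : ∀ x y j → j < leastBelow (differ x y) (x + y) → digit j x ≡ digit j y
  first-differ x y j l = same-digit {x} {y} {j} (leastBelow-min (differ x y) (x + y) j l)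

  abstract
    Q→Below : ∀ {x y} → Q x y ≡ true → ∃ λ i → Below i x y
    Q→Below {x} {y} h = _ , first-differ x y , ᵇ⇒< h

    Below→Q : ∀ {x y} i → Below i x y → Q x y ≡ true
    Below→Q {x} {y} i (e , l) = subst (λ k → (rank (digit k x) <ᵇ rank (digit k y)) ≡ true) (sym first) (<⇒ᵇ l)
      where
      i< : i < x + y
      i< with i <? x + y
      ... | yes h = h
      ... | no n = ⊥-elim (<-irrefl (cong rank (trans (digit-≥ i x (m+n≤o⇒m≤o x (≮⇒≥ n))) (sym (digit-≥ i y (m+n≤o⇒n≤o x (≮⇒≥ n)))))) l)
      here? : differ x y i ≡ true
      here? with digit i x ≡ᵇ digit i y in e′
      ... | true = ⊥-elim (<-irrefl (cong rank (ᵇ⇒≡ {digit i x} e′)) l)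
      ... | false = refl
      before : ∀ j → j < i → differ x y j ≡ false
      before j h rewrite e j h | ≡ᵇ-refl (digit j y) = refl
      first : leastBelow (differ x y) (x + y) ≡ i
      first = leastBelow-unique _ _ _ i< here? before

  digits-inj : ∀ x y → (∀ i → digit i x ≡ digit i y) → x ≡ y
  digits-inj x y h = go (x + y) (trans (shift-0 x (m≤m+n x y)) (sym (shift-0 y (m≤n+m y x))))
    where
    shift-0 : ∀ z → z ≤ x + y → shift (x + y) z ≡ 0
    shift-0 z l = n≤0⇒n≡0 (subst (shift (x + y) z ≤_) (m≤n⇒m∸n≡0 l) (shift-≤ (x + y) z))
    go : ∀ n → shift n x ≡ shift n y → x ≡ y
    go zero e = e
    go (suc n) e = go n (trans (m≡m%n+[m/n]*n (shift n x) 3)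
      (trans (cong₂ (λ a b → a + b * 3) (h n) e) (sym (m≡m%n+[m/n]*n (shift n y) 3))))

  Q-linear : IsLinearOrder Q
  Q-linear = (λ x → ¬true⇒false λ h → <-irrefl refl (proj₂ (proj₂ (Q→Below h)))) , trans-Q , conn-Q
    where
    trans-Q : ∀ x y z → Q x y ≡ true → Q y z ≡ true → Q x z ≡ true
    trans-Q x y z h k with Q→Below h | Q→Below k
    ... | i , e , l | j , e′ , l′ with <-cmp i j
    ... | tri< a _ _ = Below→Q i ((λ m p → trans (e m p) (e′ m (<-trans p a))) , subst (λ d → rank (digit i x) < rank d) (e′ i a) l)
    ... | tri≈ _ refl _ = Below→Q i ((λ m p → trans (e m p) (e′ m p)) , <-trans l l′)
    ... | tri> _ _ a = Below→Q j ((λ m p → trans (e m (<-trans p a)) (e′ m p)) , subst (λ d → rank d < rank (digit j z)) (sym (e j a)) l′)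
    conn-Q : ∀ x y → x ≢ y → Q x y ≡ true ⊎ Q y x ≡ true
    conn-Q x y n with <-cmp (rank (digit (leastBelow (differ x y) (x + y)) x)) (rank (digit (leastBelow (differ x y) (x + y)) y))
    ... | tri< l _ _ = inj₁ (Below→Q _ (first-differ x y , l))
    ... | tri> _ _ l = inj₂ (Below→Q _ ((λ j p → sym (first-differ x y j p)) , l))
    ... | tri≈ _ e _ = ⊥-elim (n (digits-inj x y all))
      where
      k = leastBelow (differ x y) (x + y)
      all : ∀ i → digit i x ≡ digit i y
      all i with <-cmp i k
      ... | tri< l _ _ = first-differ x y i l
      ... | tri≈ _ refl _ = rank-inj _ _ e
      ... | tri> _ _ l with m≤n⇒m<n∨m≡n (leastBelow-≤ (differ x y) (x + y))
      ... | inj₁ l′ = ⊥-elim (true≢false (leastBelow-true (differ x y) (x + y) l′) (cong not (trans (cong (_≡ᵇ digit k y) (rank-inj _ _ e)) (≡ᵇ-refl (digit k y)))))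
      ... | inj₂ e′ = trans (digit-≥ i x (≤-trans (m≤m+n x y) (subst (_≤ i) e′ (<⇒≤ l))))
        (sym (digit-≥ i y (≤-trans (m≤n+m y x) (subst (_≤ i) e′ (<⇒≤ l)))))

  -- The first M base-3 digits of x, followed by the digit c and then zeros.
  put : ℕ → ℕ → ℕ → ℕ
  put zero c x = c
  put (suc M) c x = x % 3 + put M c (x / 3) * 3

  put-/ : ∀ M c x → put (suc M) c x / 3 ≡ put M c (x / 3)
  put-/ M c x = trans (+-distrib-/-∣ʳ (x % 3) (divides-refl (put M c (x / 3))))
    (cong₂ _+_ (m<n⇒m/n≡0 (m%n<n x 3)) (m*n/n≡m (put M c (x / 3)) 3))

  digit-suc : ∀ j x → digit (suc j) x ≡ digit j (x / 3)
  digit-suc j x = cong (_% 3) (sym (shift-/ j x))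

  put-< : ∀ M c x j → j < M → digit j (put M c x) ≡ digit j x
  put-< (suc M) c x zero _ = trans ([m+kn]%n≡m%n (x % 3) (put M c (x / 3)) 3) (m%n%n≡m%n x 3)
  put-< (suc M) c x (suc j) (s≤s l) = trans (digit-suc j (put (suc M) c x))
    (trans (cong (digit j) (put-/ M c x)) (trans (put-< M c (x / 3) j l) (sym (digit-suc j x))))

  put-≡ : ∀ M c x → c < 3 → digit M (put M c x) ≡ c
  put-≡ zero c x l = m<n⇒m%n≡m l
  put-≡ (suc M) c x l = trans (digit-suc M (put (suc M) c x)) (trans (cong (digit M) (put-/ M c x)) (put-≡ M c (x / 3) l))

  Q-above : ∀ x M → x ≤ M → Q x (put M 2 x) ≡ true
  Q-above x M l = Below→Q M ((λ j h → sym (put-< M 2 x j h)) ,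
    subst (λ d → rank (digit M x) < rank d) (sym (put-≡ M 2 x ≤-refl))
      (subst (λ d → rank d < 2) (sym (digit-≥ M x l)) ≤-refl))

  Q-below : ∀ x → Q (put x 1 x) x ≡ true
  Q-below x = Below→Q x ((λ j h → put-< x 1 x j h) ,
    subst (λ d → rank d < rank (digit x x)) (sym (put-≡ x 1 x (s≤s (s≤s z≤n))))
      (subst (λ d → 0 < rank d) (sym (digit-≥ x x ≤-refl)) ≤-refl))

  Q-between : ∀ x y → Q x y ≡ true → ∃ λ z → Q x z ≡ true × Q z y ≡ true
  Q-between x y h with Q→Below h
  -- Position M lies past all digits of x, where x has the middle digit 0, so writing 2 there moves
  -- up. It also lies past i, so the comparison with y is unchanged.
  ... | i , e , l = put M 2 x , Q-above x M (m≤n⇒m≤1+n (m≤m+n x i)) ,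
    Below→Q i ((λ j k → trans (put-< M 2 x j (<-trans k i<M)) (e j k)) ,
      subst (λ d → rank d < rank (digit i y)) (sym (put-< M 2 x i i<M)) l)
    where
    M = suc (x + i)
    i<M : i < M
    i<M = s≤s (m≤n+m i x)

  QL : LO
  QL = ofRel Q

  QL-isLO : IsLO QL
  QL-isLO = ofRel-isLO Q-linear

  Q-limit : ∀ x → Limit-point QL x
  Q-limit x = (_ , Q-below x) , (_ , Q-above x x ≤-refl) , (λ y → Q-between y x) , Q-between x

  Q-countable : Countable QL
  Q-countable = just , λ x → x , x , refl , irr QL-isLO {x} , irr QL-isLO {x}

  abstract
    QE : ∀ {o} {O : Orc o} → B2 O Q
    QE {o} {O} = ltB (rankE (digitE at v0)) (rankE (digitE at v1))
      where
      shiftE : ∀ {n e e′} → E O n e → E O n e′ → E O n (λ xs → shift (e xs) (e′ xs))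
      shiftE = app2 shift (pr v0 (divE 2 v1) (λ k ps → shift k (head ps)) (λ _ → refl) (λ _ _ → refl))
      digitE : ∀ {n e e′} → E O n e → E O n e′ → E O n (λ xs → digit (e xs) (e′ xs))
      digitE a b = modE 2 (shiftE a b)
      rank-if : ∀ m → (if m ≡ᵇ 0 then 1 else (if m ≡ᵇ 1 then 0 else m)) ≡ rank m
      rank-if 0 = refl
      rank-if 1 = refl
      rank-if (suc (suc m)) = refl
      rankE : ∀ {n e} → E O n e → E O n (λ xs → rank (e xs))
      rankE {e = e} a = Ecast (λ xs → rank-if (e xs)) (ifE (eqB a (cst 0)) (cst 1) (ifE (eqB a (cst 1)) (cst 0) a))
      at : E O 2 (λ xs → leastBelow (differ (a0 xs) (a1 xs)) (a0 xs + a1 xs))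
      at = leastBelowE {p = λ i xs → differ (a0 xs) (a1 xs) i} (notB (eqB (digitE v0 v1) (digitE v0 v2))) (v0 +E v1)

  -- Ends of intervals

  natL : LO
  natL = mkLO ℕ _<_

  module Ends (A : Rel) (linA : IsLinearOrder A) where
    open Order A linA public

    XL : (ℕ → Set) → LO
    XL P = restr (ofRel A) P

    below-pull : ∀ {f lo y} → IsIso A A f → OnJust (λ a → f a ≡ a) lo → OnJust (_≺ f y) lo → OnJust (_≺ y) lo
    below-pull {lo = nothing} i e h = tt
    below-pull {f} {just a} {y} (p , _) e h = trans (p a y) (subst (_≺ f y) (sym e) h)

    below-push : ∀ {f lo y} → IsIso A A f → OnJust (λ a → f a ≡ a) lo → OnJust (_≺ y) lo → OnJust (_≺ f y) lo
    below-push {lo = nothing} i e h = tt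
    below-push {f} {just a} {y} (p , _) e h = subst (_≺ f y) e (trans (sym (p a y)) h)

    above-push : ∀ {f hi y} → IsIso A A f → OnJust (λ a → f a ≡ a) hi → OnJust (y ≺_) hi → OnJust (f y ≺_) hi
    above-push {hi = nothing} i e h = tt
    above-push {f} {just a} {y} (p , _) e h = subst (f y ≺_) e (trans (sym (p y a)) h)

    partner : ∀ {zs : List (ℕ × ℕ)} {ws : List ℕ} {x : ℕ} → map {A = ℕ × ℕ} proj₂ zs ≡ ws → x ∈ ws → ∃ λ x′ → (x′ , x) ∈ zs
    partner refl i with ∈-map⁻ proj₂ i
    ... | (x′ , _) , m , refl = x′ , m

    nth : ∀ {P : ℕ → Set} → (∀ {x} → P x → Small (P ↓ x)) → (∀ k → ∃ λ x → P x × Ch (P ↓ x) k) →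
      ∀ n → ∃ λ x → P x × Ch (P ↓ x) n × ¬ Ch (P ↓ x) (suc n)
    nth {P} sm big n with big n
    ... | x , p , c with sm p
    ... | k , nk = go k x p c nk
      where
      go : ∀ k x → P x → Ch (P ↓ x) n → ¬ Ch (P ↓ x) k → ∃ λ x → P x × Ch (P ↓ x) n × ¬ Ch (P ↓ x) (suc n)
      go zero x p c nk = ⊥-elim (nk tt)
      go (suc k) x p c nk with lem (Ch (P ↓ x) (suc n))
      ... | no n′ = x , p , c , n′
      ... | yes c′ with ch-split n (subst (Ch (P ↓ x)) (sym (+-comm n 1)) c′)
      ... | y , (q , l) , d , _ = go k y q (ch-map n (λ ((a , _) , b) → a , b) d) λ e →
        nk (subst (Ch (P ↓ x)) (+-comm k 1) (ch-cat k (ch-map k (λ (a , b) → (a , ≺-tr b l) , b) e) (q , l) tt))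

    ch-below : ∀ {P x y} k → x ≺ y → P x → Ch (P ↓ x) k → Ch (P ↓ y) (suc k)
    ch-below {P} {x} {y} k l p c = subst (Ch (P ↓ y)) (+-comm k 1)
      (ch-cat k (ch-map k (λ (a , b) → (a , ≺-tr b l) , b) c) (p , l) tt)

    -- An element corresponds to the number of its predecessors; `nth` shows that every number
    -- occurs.
    omega : ∀ {P : ℕ → Set} → (∀ {x} → P x → Small (P ↓ x)) → (∀ k → ∃ λ x → P x × Ch (P ↓ x) k) → IsoR (XL P) natL
    omega {P} sm big = G , tot , sur , λ {x} {n} {x′} {n′} → pres {x} {n} {x′} {n′}
      where
      G : Σ ℕ P → ℕ → Set
      G (x , _) n = Ch (P ↓ x) n × ¬ Ch (P ↓ x) (suc n)
      tot : ∀ x → ∃ (G x)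
      tot (x , p) with sm p
      ... | k , nk with longest (P ↓ x) k
      ... | c , l , h , m = c , h , λ h′ → case m≤n⇒m<n∨m≡n l of λ
        { (inj₁ c<k) → <-irrefl refl (m (suc c) c<k h′) ; (inj₂ refl) → nk h }
      sur : ∀ n → ∃ λ x → G x n
      sur n = let (x , p , g) = nth sm big n in (x , p) , g
      pres : ∀ {x n x′ n′} → G x n → G x′ n′ → Iff (lt (XL P) x x′) (n < n′)
      pres {x , p} {n} {x′ , p′} {n′} (c , d) (c′ , d′) = to , from
        where
        to : x ≺ x′ → n < n′
        to h with <-≤-connex n n′
        ... | inj₁ l = l
        ... | inj₂ l = ⊥-elim (d′ (ch-≤ (s≤s l) (ch-below n h p c)))
        from : n < n′ → x ≺ x′
        from h with cmp x x′
        ... | inj₁ l = l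
        ... | inj₂ (inj₁ refl) = ⊥-elim (d (ch-≤ h c′))
        ... | inj₂ (inj₂ l) = ⊥-elim (<-asym h (≤-pred (≰⇒> λ q → d (ch-≤ (s≤s (≤-trans (<⇒≤ h) ≤-refl)) (ch-below n′ l p′ c′)))))

    maximum : ∀ {P : ℕ → Set} → Small P → ∃ P → ∃ λ x → P x × (∀ y → P y → ¬ x ≺ y)
    maximum {P} (k , n) (x , p) = go k x p (λ c → n (ch-map k proj₁ c))
      where
      go : ∀ k x → P x → ¬ Ch (P ↑ x) k → ∃ λ x → P x × (∀ y → P y → ¬ x ≺ y)
      go zero x p n = ⊥-elim (n tt)
      go (suc k) x p n with lem (∃ (P ↑ x))
      ... | no none = x , p , λ y q l → none (y , q , l)
      ... | yes (y , q , l) = go k y q λ c → n (y , (q , l) , ch-map k (λ (a , b) → (a , ≺-tr l b) , b) c)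

    Finite-left : Maybe ℕ → Maybe ℕ → ℕ → Set
    Finite-left lo hi x = In lo hi x × Small (In lo (just x))

    not-small : ∀ {P} → ¬ Small P → Big P
    not-small {P} n = [ (λ s → ⊥-elim (n s)) , id ]′ (small-big P)

    small-In : ∀ {lo hi} x → Small (In lo (just x)) → Small (In (just x) hi) → Small (In lo hi)
    small-In x s t = small-join x (small-map (λ ((a , _) , b) → a , b) s) (small-map (λ ((_ , a) , b) → b , a) t)

    -- The interval is cut at the last element x with finitely many predecessors, if there is one.
    -- An element beyond x with finitely many predecessors counted from x would have finitely many
    -- in the whole interval, against the choice of x.
    trim : ∀ lo hi → Small (Finite-left lo hi) → (∀ {x} → In lo hi x → Big (In lo (just x))) ⊎
      (∃ λ x → In lo hi x × Small (In lo (just x)) × (∀ {u} → In (just x) hi u → Big (In (just x) (just u))))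
    trim lo hi sm with lem (∃ (Finite-left lo hi))
    ... | no none = inj₁ λ {x} i → not-small λ s → none (x , i , s)
    ... | yes e with maximum sm e
    ... | x , (i , s) , mx = inj₂ (x , i , s , λ {u} j → not-small λ s′ →
      mx u (widenˡ {lo} {hi} (proj₁ i) j , small-In {lo} {just u} x s s′) (proj₁ j))

    record Run (lo hi : Maybe ℕ) (k : ℕ) (r : ℕ → ℕ) : Set where
      field
        inside : ∀ i → i < k → In lo hi (r i)
        next : ∀ i → suc i < k → r i ≺ r (suc i)
        consecutive : ∀ i → suc i < k → ∀ {z} → ¬ In (just (r i)) (just (r (suc i))) z
        far : ∀ i → i < k → Big (In (just (r i)) hi)
    open Run

    dominated-empty : ∀ {lo hi lo′ hi′} → (∀ {z} → ¬ In lo hi z) → Dominated lo hi lo′ hi′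
    dominated-empty n zero c = tt
    dominated-empty n (suc c) (z , i , _) = ⊥-elim (n i)

    -- Elements of ws with infinitely many elements above them go to consecutive members of r, the
    -- others stay. Gaps inside the run are empty, and the gap that follows the run faces an
    -- infinite gap of ws, so ws dominates the new tuple as soon as this holds for the first gap.
    -- The bounds lo and lo′ are the elements treated last on the two sides.
    collapse : ∀ {lo₀ hi k r} → Run lo₀ hi k r → ∀ ws i lo′ lo → Sorted lo ws hi → i + length ws ≤ k → Big (In lo hi) →
      (i < k → ∀ {w} → In lo hi w → Big (In (just w) hi) → Dominated lo′ (just (r i)) lo (just w)) →
      (i < k → OnJust (_≺ r i) lo′) → (∀ {w} → OnJust (_≺ w) lo → Small (In (just w) hi) → OnJust (_≺ w) lo′) →
      ∃ λ zs → map proj₂ zs ≡ ws × Gaps Dominated lo′ lo zs hi hi ×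
        (∀ {x′ x} → (x′ , x) ∈ zs → Big (In (just x) hi) → ∃ λ j → j < k × x′ ≡ r j)
    collapse R [] i lo′ lo s l big _ _ _ = [] , refl , (λ c _ → big c) , λ ()
    collapse {lo₀} {hi} {k} {r} R (w ∷ ws) i lo′ lo (iw , s) l big nx lw sw with small-big (In (just w) hi)
    ... | inj₁ sm = dupl (w ∷ ws) , dupl-proj (w ∷ ws) ,
        ((sw (proj₁ iw) sm , proj₂ iw) , iw , (λ c _ → lo-big c) , dupl-gaps ws s) , absurd
      where
      lo-big : Big (In lo (just w))
      lo-big = not-small λ s′ → small-⊥ (small-In {lo} {hi} w s′ sm) big
      absurd : ∀ {x′ x} → (x′ , x) ∈ dupl (w ∷ ws) → Big (In (just x) hi) → ∃ λ j → j < k × x′ ≡ r j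
      absurd (here refl) b = ⊥-elim (small-⊥ sm b)
      absurd (there m) b with ∈-map⁻ (λ w → w , w) m
      ... | x , m′ , refl = ⊥-elim (small-⊥ (small-map (λ (p , q) → ≺-tr (proj₁ (sorted-in s m′)) p , q) sm) b)
    ... | inj₂ bw with collapse R ws (suc i) (just (r i)) (just w) s (subst (_≤ k) (+-suc i _) l) bw
          (λ h _ _ → dominated-empty (consecutive R i h)) (next R i)
          (λ {v} w<v sv → case cmp (r i) v of λ
            { (inj₁ q) → q
            ; (inj₂ (inj₁ refl)) → ⊥-elim (small-⊥ sv (far R i i<k))
            ; (inj₂ (inj₂ q)) → ⊥-elim (small-⊥ sv (big-map (λ (a , b) → ≺-tr q a , b) (far R i i<k))) })
      where
      i<k : i < k
      i<k = <-≤-trans (m<m+n i (s≤s z≤n)) l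
    ... | zs , e , g , h = (r i , w) ∷ zs , cong (w ∷_) e ,
        ((lw i<k , proj₂ (inside R i i<k)) , iw , nx i<k iw bw , g) ,
        λ { (here refl) _ → i , i<k , refl ; (there m) b → h m b }
      where
      i<k : i < k
      i<k = <-≤-trans (m<m+n i (s≤s z≤n)) l

    finite-left-run : ∀ {lo hi} → Big (Finite-left lo hi) → ∃ λ r → (∀ k → Run lo hi k r) ×
      (∀ {z} → ¬ In lo (just (r 0)) z) × (∀ i → Small (In lo (just (r i))))
    finite-left-run {lo} {hi} big = r , (λ k → record
        { inside = λ i _ → proj₁ (r∈ i) ; next = λ i _ → r-next i ; consecutive = λ i _ → r-cons i
        ; far = λ i _ → not-small λ s → small-⊥ (small-In {lo} {hi} (r i) (proj₂ (r∈ i)) s) (big-map proj₁ big) }) ,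
      (λ j → proj₂ (proj₂ (r! 0)) (_ , (D-≺ 0 j , proj₂ j) , tt)) , λ i → proj₂ (r∈ i)
      where
      D = Finite-left lo hi
      Dsm : ∀ {x} → D x → Small (D ↓ x)
      Dsm (_ , s) = small-map (λ (((a , _) , _) , b) → a , b) s
      Dbig : ∀ k → ∃ λ x → D x × Ch (D ↓ x) k
      Dbig k with ch-split k (subst (Ch D) (+-comm 1 k) (big (suc k)))
      ... | x , d , c , _ = x , d , c
      r : ℕ → ℕ
      r n = proj₁ (nth Dsm Dbig n)
      r∈ : ∀ n → D (r n)
      r∈ n = proj₁ (proj₂ (nth Dsm Dbig n))
      r! : ∀ n → D (r n) × Ch (D ↓ r n) n × ¬ Ch (D ↓ r n) (suc n)
      r! n = proj₂ (nth Dsm Dbig n)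
      D-≺ : ∀ n {z} → In lo (just (r n)) z → D z
      D-≺ n (a , b) = (a , above-tr {hi} b (proj₂ (proj₁ (r∈ n)))) , small-map (λ (p , q) → p , ≺-tr q b) (proj₂ (r∈ n))
      r-next : ∀ i → r i ≺ r (suc i)
      r-next i with cmp (r i) (r (suc i))
      ... | inj₁ l = l
      ... | inj₂ (inj₁ e) = ⊥-elim (proj₂ (proj₂ (r! i)) (subst (λ x → Ch (D ↓ x) (suc i)) (sym e) (proj₁ (proj₂ (r! (suc i))))))
      ... | inj₂ (inj₂ l) = ⊥-elim (proj₂ (proj₂ (r! i)) (ch-drop (suc i) (ch-below (suc i) l (r∈ (suc i)) (proj₁ (proj₂ (r! (suc i)))))))
      r-cons : ∀ i {z} → ¬ In (just (r i)) (just (r (suc i))) z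
      r-cons i {z} (a , b) = proj₂ (proj₂ (r! (suc i))) (ch-below (suc i) b (D-≺ (suc i) (below-tr {lo} (proj₁ (proj₁ (r∈ i))) a , b))
        (ch-below i a (r∈ i) (proj₁ (proj₂ (r! i)))))

    -- Suppose u has infinitely many elements on both sides. Collapsing a tuple around u onto the
    -- initial run of type ω gives an automorphism that takes some r j to u, and r j has only
    -- finitely many predecessors.
    finite-left⇒finite-right : ∀ {lo hi} → Good [] lo hi → Big (Finite-left lo hi) → ∀ {u} → In lo hi u →
      Small (In lo (just u)) ⊎ Small (In (just u) hi)
    finite-left⇒finite-right {lo} {hi} good big {u} iu with small-big (In lo (just u)) | small-big (In (just u) hi)
    ... | inj₁ s | _ = inj₁ s
    ... | inj₂ _ | inj₁ s = inj₂ s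
    ... | inj₂ bl | inj₂ bu with finite-left-run {lo} {hi} big
    ... | r , run , empty , sm with good (u ∷ []) (λ { (here refl) → iu })
    ... | ws , us⊆ , _ , sw , mv with collapse (run (length ws)) ws 0 lo lo sw ≤-refl (big-map proj₁ big)
            (λ _ {w} _ _ → dominated-empty {lo} {just (r 0)} {lo} {just w} empty) (λ _ → proj₁ (Run.inside (run 1) 0 ≤-refl)) (λ h _ → h)
    ... | zs , e , g , h with mv zs e g (λ ()) | partner e (us⊆ (here refl))
    ... | f , iso , fl , fh , ft | x′ , m with h m bu
    ... | j , _ , refl = inj₁ (let (k , n) = sm j in k , λ c → n (ch-pull iso k
        (λ y (a , b) → below-pull {lo = lo} iso fl a , trans (proj₁ iso y (r j)) (subst (f y ≺_) (sym (ft m (here refl))) b)) c))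

  -- Intervals as finite sums

  -- `eta k` stands for a dense sum of blocks of k + 1 points, so `eta 0` is η itself and is the
  -- only `eta` without adjacencies.
  data Piece : Set where
    pt om mo : Piece
    eta : ℕ → Piece

  T : Piece → LO
  T pt = one
  T om = natL
  T mo = op natL
  T (eta k) = QL ⊗ finL (suc k)

  Ts : List Piece → LO
  Ts [] = none
  Ts (p ∷ σ) = T p ⊕ Ts σ

  Ts-++ : ∀ σ τ → IsoR (Ts σ ⊕ Ts τ) (Ts (σ ++ τ))
  Ts-++ [] τ = none-⊕
  Ts-++ (p ∷ σ) τ = iso-trans {_} {T p ⊕ (Ts σ ⊕ Ts τ)} {_} ⊕-assoc (⊕-iso iso-refl (Ts-++ σ τ))

  Ts-one : ∀ p → IsoR (T p) (Ts (p ∷ []))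
  Ts-one p = iso-flip ⊕-none

  restr-countable : ∀ {A P} → IsLO (ofRel A) → Countable (restr (ofRel A) P)
  restr-countable {A} {P} iA = e , λ (x , p) → x , hit x p
    where
    e : ℕ → Maybe (Σ ℕ P)
    e n with lem (P n)
    ... | yes p = just (n , p)
    ... | no _ = nothing
    hit : ∀ x (p : P x) → ∃ λ z → e x ≡ just z × ¬ A x (proj₁ z) ≡ true × ¬ A (proj₁ z) x ≡ true
    hit x p with lem (P x)
    ... | yes q = (x , q) , refl , irr iA , irr iA
    ... | no n = ⊥-elim (n p)

  module Classify (A : Rel) (linA : IsLinearOrder A) where
    open Ends A linA public
    module F = Ends (flip A) (flip-linear linA)

    to-flip : ∀ {P} k → Ch P k → F.Ch P k
    to-flip zero c = tt
    to-flip {P} (suc k) (x , p , c) = subst (F.Ch P) (+-comm k 1) (F.ch-cat k (to-flip k c) p tt)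

    from-flip : ∀ {P} k → F.Ch P k → Ch P k
    from-flip zero c = tt
    from-flip {P} (suc k) (x , p , c) = subst (Ch P) (+-comm k 1) (ch-cat k (from-flip k c) p tt)

    small-from : ∀ {P Q : ℕ → Set} → (∀ {x} → P x → Q x) → F.Small Q → Small P
    small-from h (k , n) = k , λ c → n (to-flip k (ch-map k h c))

    small-to : ∀ {P Q : ℕ → Set} → (∀ {x} → P x → Q x) → Small Q → F.Small P
    small-to h (k , n) = k , λ c → n (ch-map k h (from-flip k c))

    big-from : ∀ {P Q : ℕ → Set} → (∀ {x} → P x → Q x) → F.Big P → Big Q
    big-from h b k = ch-map k h (from-flip k (b k))

    Cls : (ℕ → Set) → Set₁
    Cls P = Σ (List Piece) λ σ → IsoR (XL P) (Ts σ)

    cls-join : ∀ {P Q R : ℕ → Set} → Cls P → Cls Q → (∀ {x y} → P x → Q y → x ≺ y) → (∀ {x} → R x → P x ⊎ Q x) →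
      (∀ {x} → P x → R x) → (∀ {x} → Q x → R x) → Cls R
    cls-join {P} {Q} {R} (σ , i) (τ , j) sep spl p⊆ q⊆ = σ ++ τ , iso-trans {_} {XL P ⊕ XL Q} {_} sum
      (iso-trans {_} {Ts σ ⊕ Ts τ} {_} (⊕-iso i j) (Ts-++ σ τ))
      where
      val : Σ ℕ P ⊎ Σ ℕ Q → ℕ
      val = [ proj₁ , proj₁ ]′
      sum : IsoR (XL R) (XL P ⊕ XL Q)
      sum = (λ (x , _) z → x ≡ val z) ,
        (λ (x , r) → [ (λ p → inj₁ (x , p) , refl) , (λ q → inj₂ (x , q) , refl) ]′ (spl r)) ,
        (λ { (inj₁ (x , p)) → (x , p⊆ p) , refl ; (inj₂ (x , q)) → (x , q⊆ q) , refl }) ,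
        λ { {y = z} {y′ = z′} refl refl → to z z′ , from z z′ }
        where
        to : ∀ z z′ → val z ≺ val z′ → SumLt (XL P) (XL Q) z z′
        to (inj₁ _) (inj₁ _) h = ll h
        to (inj₁ _) (inj₂ _) h = lr
        to (inj₂ (_ , q)) (inj₁ (_ , p)) h = ⊥-elim (≺-irr (≺-tr h (sep p q)))
        to (inj₂ _) (inj₂ _) h = rr h
        from : ∀ z z′ → SumLt (XL P) (XL Q) z z′ → val z ≺ val z′
        from (inj₁ _) (inj₁ _) (ll h) = h
        from (inj₁ (_ , p)) (inj₂ (_ , q)) lr = sep p q
        from (inj₂ _) (inj₂ _) (rr h) = h

    cls-≗ : ∀ {P R : ℕ → Set} → Cls P → (∀ {x} → R x → P x) → (∀ {x} → P x → R x) → Cls R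
    cls-≗ {P} {R} (σ , G , t , s , p) h k = σ , (λ (x , _) y → ∃ λ q → G (x , q) y) ,
      (λ (x , r) → let (y , g) = t (x , h r) in y , h r , g) ,
      (λ y → let ((x , q) , g) = s y in (x , k q) , q , g) , λ (_ , g) (_ , g′) → p g g′

    cls-empty : ∀ {P : ℕ → Set} → (∀ {x} → ¬ P x) → Cls P
    cls-empty n = [] , (λ _ ()) , (λ (_ , p) → ⊥-elim (n p)) , (λ ()) , λ {_} {}

    cls-one : ∀ {P : ℕ → Set} x → P x → (∀ {y} → P y → y ≡ x) → Cls P
    cls-one {P} x p u = pt ∷ [] , iso-trans {_} {one} {_} i (Ts-one pt)
      where
      i : IsoR (XL P) one
      i = (λ _ _ → ⊤) , (λ _ → tt , tt) , (λ _ → (x , p) , tt) , λ { {y , q} {_} {z , r} _ _ →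
        (λ h → ≺-irr (subst (_≺ x) (u q) (subst (y ≺_) (u r) h))) , λ () }

    cls-piece : ∀ {P : ℕ → Set} p → IsoR (XL P) (T p) → Cls P
    cls-piece p i = p ∷ [] , iso-trans {_} {T p} {_} i (Ts-one p)

    cls-cut : ∀ {P : ℕ → Set} {x} → P x → Cls (P ↓ x) → Cls (P ↑ x) → Cls P
    cls-cut {P} {x} p l u = cls-join {P ↓ x} {λ y → P y × ¬ y ≺ x} {P} l
      (cls-join {_≡ x} {P ↑ x} (cls-one x refl id) u (λ { refl (_ , h) → h })
        (λ {y} (q , n) → case cmp y x of λ { (inj₁ h) → ⊥-elim (n h) ; (inj₂ (inj₁ e)) → inj₁ e ; (inj₂ (inj₂ h)) → inj₂ (q , h) })
        (λ { refl → p , ≺-irr }) (λ (q , h) → q , λ k → ≺-irr (≺-tr h k)))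
      (λ {y} {z} (_ , h) (_ , n) → [ id , (λ k → ⊥-elim (n k)) ]′ (cotr (ofRel-isLO linA) h z))
      (λ {y} q → case lem (y ≺ x) of λ { (yes h) → inj₁ (q , h) ; (no n) → inj₂ (q , n) }) proj₁ proj₁

    cls-small : ∀ {P : ℕ → Set} → Small P → Cls P
    cls-small (k , n) = go k n
      where
      go : ∀ k {P : ℕ → Set} → ¬ Ch P k → Cls P
      go zero n = ⊥-elim (n tt)
      go (suc k) {P} n with lem (∃ P)
      ... | no none = cls-empty λ p → none (_ , p)
      ... | yes (x , p) = cls-cut {P} {x} p
        (go k λ c → n (subst (Ch P) (+-comm k 1) (ch-cat k c p tt))) (go k λ c → n (ch-cat 0 tt p c))

    In-↓ : ∀ {lo hi x} → In lo hi x → Cls (In lo (just x)) → Cls (In lo hi ↓ x)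
    In-↓ {lo} {hi} i c = cls-≗ c (λ ((a , _) , b) → a , b) (λ (a , b) → (a , above-tr {hi} b (proj₂ i)) , b)

    In-↑ : ∀ {lo hi x} → In lo hi x → Cls (In (just x) hi) → Cls (In lo hi ↑ x)
    In-↑ {lo} {hi} i c = cls-≗ c (λ ((_ , a) , b) → b , a) (λ (a , b) → (below-tr {lo} (proj₁ i) a , b) , a)

    cls-cut-In : ∀ {lo hi x} → In lo hi x → Cls (In lo (just x)) → Cls (In (just x) hi) → Cls (In lo hi)
    cls-cut-In {lo} {hi} i l u = cls-cut i (In-↓ {lo} {hi} i l) (In-↑ {lo} {hi} i u)

    -- The elements with finitely many predecessors form an initial segment that is finite or of
    -- type ω. All others have finitely many successors and form a final segment that is finite or
    -- of type ω*.
    cls-ends : ∀ {lo hi} → (∀ {u} → In lo hi u → Small (In lo (just u)) ⊎ Small (In (just u) hi)) → Cls (In lo hi)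
    cls-ends {lo} {hi} h = cls-join {D} {R} clsD clsR
      (λ {x} {y} ((_ , b) , s) ((a , _) , n) → case cmp x y of λ
        { (inj₁ l) → l
        ; (inj₂ (inj₁ refl)) → ⊥-elim (n s)
        ; (inj₂ (inj₂ l)) → ⊥-elim (n (small-map (λ (p , q) → p , ≺-tr q l) s)) })
      (λ {x} i → case lem (Small (In lo (just x))) of λ { (yes s) → inj₁ (i , s) ; (no n) → inj₂ (i , n) }) proj₁ proj₁
      where
      D R : ℕ → Set
      D = Finite-left lo hi
      R x = In lo hi x × ¬ Small (In lo (just x))
      R-small : ∀ {x} → R x → Small (R ↑ x)
      R-small (i , n) = small-map (λ (((_ , a) , _) , b) → b , a) ([ (λ s → ⊥-elim (n s)) , id ]′ (h i))
      clsD : Cls D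
      clsD with small-big D
      ... | inj₁ s = cls-small s
      ... | inj₂ b = cls-piece om (omega (λ (i , s) → small-map (λ (((p , _) , _) , q) → p , q) s)
        λ k → let (x , d , c , _) = ch-split k (subst (Ch D) (+-comm 1 k) (b (suc k))) in x , d , c)
      clsR : Cls R
      clsR with small-big R
      ... | inj₁ s = cls-small s
      ... | inj₂ b = let (G , t , s , p) = F.omega {R} (λ r → small-to id (R-small r))
                           (λ k → let (x , r , c) = b (suc k) in x , r , to-flip k c)
                     in cls-piece mo (G , t , s , λ {x} {y} {x′} {y′} g g′ → p {x′} {y′} {x} {y} g′ g)

    Good₂ : List ℕ → Maybe ℕ → Maybe ℕ → Set
    Good₂ S lo hi = Good S lo hi × F.Good S hi lo

    good₂-left : ∀ {S lo hi x} → In lo hi x → Good₂ S lo hi → Good₂ S lo (just x)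
    good₂-left i (a , b) = good-left i a , F.good-right (swap i) b

    good₂-right : ∀ {S lo hi x} → In lo hi x → Good₂ S lo hi → Good₂ S (just x) hi
    good₂-right i (a , b) = good-right i a , F.good-left (swap i) b

    Adj : ℕ → ℕ → Set
    Adj x y = x ≺ y × (∀ {z} → ¬ In (just x) (just y) z)

    Steps : ℕ → ℕ → ℕ → Set
    Steps x zero y = x ≡ y
    Steps x (suc n) y = ∃ λ z → Adj x z × Steps z n y

    infix 4 _≼_
    _≼_ : ℕ → ℕ → Set
    x ≼ y = x ≡ y ⊎ x ≺ y

    ≼≺ : ∀ {x y z} → x ≼ y → y ≺ z → x ≺ z
    ≼≺ (inj₁ refl) h = h
    ≼≺ (inj₂ k) h = ≺-tr k h

    ≺≼ : ∀ {x y z} → x ≺ y → y ≼ z → x ≺ z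
    ≺≼ h (inj₁ refl) = h
    ≺≼ h (inj₂ k) = ≺-tr h k

    ≼-tr : ∀ {x y z} → x ≼ y → y ≼ z → x ≼ z
    ≼-tr (inj₁ refl) h = h
    ≼-tr (inj₂ k) h = inj₂ (≺≼ k h)

    In-mid : ∀ {lo hi x y z} → In lo hi x → In lo hi z → x ≼ y → y ≼ z → In lo hi y
    In-mid i j (inj₁ refl) q = i
    In-mid i j (inj₂ h) (inj₁ refl) = j
    In-mid {lo} {hi} i j (inj₂ h) (inj₂ k) = below-tr {lo} (proj₁ i) h , above-tr {hi} k (proj₂ j)

    adj-det : ∀ {x y z} → Adj x y → Adj x z → y ≡ z
    adj-det {x} {y} {z} (l , n) (l′ , n′) with cmp y z
    ... | inj₁ h = ⊥-elim (n′ (l , h))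
    ... | inj₂ (inj₁ e) = e
    ... | inj₂ (inj₂ h) = ⊥-elim (n (l′ , h))

    steps-det : ∀ n {x y z} → Steps x n y → Steps x n z → y ≡ z
    steps-det zero refl refl = refl
    steps-det (suc n) (w , a , s) (w′ , a′ , s′) with adj-det a a′
    ... | refl = steps-det n s s′

    steps-≼ : ∀ n {x y} → Steps x n y → x ≼ y
    steps-≼ zero e = inj₁ e
    steps-≼ (suc n) (z , (l , _) , s) = inj₂ (≺≼ l (steps-≼ n s))

    steps-≺ : ∀ n {x y} → Steps x (suc n) y → x ≺ y
    steps-≺ n (z , (l , _) , s) = ≺≼ l (steps-≼ n s)

    steps-++ : ∀ m {n x y z} → Steps x m y → Steps y n z → Steps x (m + n) z
    steps-++ zero refl t = t
    steps-++ (suc m) (w , a , s) t = w , a , steps-++ m s t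

    steps-split : ∀ m {n x z} → Steps x (m + n) z → ∃ λ y → Steps x m y × Steps y n z
    steps-split zero s = _ , refl , s
    steps-split (suc m) (w , a , s) = let (y , p , q) = steps-split m s in y , (w , a , p) , q

    steps-small : ∀ n {x y} → Steps x n y → Small (In (just x) (just y))
    steps-small zero refl = small-empty λ (a , b) → ≺-irr (≺-tr a b)
    steps-small (suc n) {x} {y} (z , (_ , e) , s) = small-In {just x} {just y} z (small-empty e) (steps-small n s)

    small-steps : ∀ {x y} → x ≺ y → Small (In (just x) (just y)) → ∃ λ d → Steps x (suc d) y
    small-steps l (k , n) = go k l n
      where
      go : ∀ k {x y} → x ≺ y → ¬ Ch (In (just x) (just y)) k → ∃ λ d → Steps x (suc d) y
      go zero l n = ⊥-elim (n tt)
      go (suc k) {x} {y} l n with lem (∃ (In (just x) (just y)))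
      ... | no none = 0 , y , (l , λ i → none (_ , i)) , refl
      ... | yes (z , i@(a , b)) with go k a (λ c → n (subst (Ch (In (just x) (just y))) (+-comm k 1)
                  (ch-cat k (ch-map k (λ (p , q) → (p , ≺-tr q b) , q) c) i tt)))
                | go k b (λ c → n (ch-cat 0 tt i (ch-map k (λ (p , q) → (≺-tr a p , q) , p) c)))
      ... | d , s | d′ , s′ = d + suc d′ , steps-++ (suc d) s s′

    steps-iso : ∀ {f} → IsIso A A f → ∀ n {x y} → Steps x n y → Steps (f x) n (f y)
    steps-iso i zero refl = refl
    steps-iso {f} i@(p , _ , sur) (suc n) {x} (z , (l , e) , s) = f z , (trans (sym (p x z)) l , emp) , steps-iso i n s
      where
      emp : ∀ {w} → ¬ In (just (f x)) (just (f z)) w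
      emp {w} (a , b) with sur w
      ... | w₀ , refl = e {w₀} (trans (p x w₀) a , trans (p w₀ z) b)

    element : ∀ n {x y} → Steps x n y → ℕ → ℕ
    element zero {x} s i = x
    element (suc n) {x} s zero = x
    element (suc n) (z , _ , s) (suc i) = element n s i

    element-adj : ∀ n {x y} (s : Steps x n y) i → suc i ≤ n → Adj (element n s i) (element n s (suc i))
    element-adj (suc zero) (z , a , refl) zero l = a
    element-adj (suc (suc n)) (z , a , s) zero l = a
    element-adj (suc n) (z , _ , s) (suc i) (s≤s l) = element-adj n s i l

    element-In : ∀ n {x y lo hi} (s : Steps x n y) i → In lo hi x → In lo hi y → In lo hi (element n s i)
    element-In zero s i p q = p
    element-In (suc n) s zero p q = p
    element-In (suc n) {lo = lo} {hi} (z , (l , _) , s) (suc i) p q =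
      element-In n {lo = lo} {hi} s i (In-mid {lo} {hi} p q (inj₂ l) (steps-≼ n s)) q

    NoEnds : Maybe ℕ → Maybe ℕ → Set
    NoEnds a b = ∀ {u} → In a b u → Big (In a (just u)) × Big (In (just u) b)

    HasRun : ℕ → Maybe ℕ → Maybe ℕ → Set
    HasRun n a b = ∃ λ x → ∃ λ y → In a b x × In a b y × Steps x n y

    -- Arbitrarily long runs: two elements can be moved into one run, so all distances are finite.
    cls-unbounded : ∀ {a b} → Good [] a b → NoEnds a b → (∀ n → HasRun n a b) → Cls (In a b)
    cls-unbounded {a} {b} good ne runs with runs 0
    -- All distances being finite, the part below x has type ω* and the part above it type ω.
    ... | x , _ , ix , _ = cls-cut-In {a} {b} ix
        (cls-ends {a} {just x} λ {u} (p , q) → inj₂ (near (p , above-tr {b} q (proj₂ ix)) ix q))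
        (cls-ends {just x} {b} λ {u} (p , q) → inj₁ (near ix (below-tr {a} (proj₁ ix) p , q) p))
      where
      near : ∀ {u v} → In a b u → In a b v → u ≺ v → Small (In (just u) (just v))
      near {u} {v} iu iv l with good (u ∷ v ∷ []) (λ { (here refl) → iu ; (there (here refl)) → iv })
      ... | ws , us⊆ , _ , sw , mv with runs (length ws)
      ... | y , z , iy , iz , s = res
        where
        k = length ws
        r = element k s
        r∈ : ∀ i → In a b (r i)
        r∈ i = element-In k {lo = a} {b} s i iy iz
        run : Run a b k r
        run = record { inside = λ i _ → r∈ i ; next = λ i h → proj₁ (element-adj k s i (<⇒≤ h))
                     ; consecutive = λ i h → proj₂ (element-adj k s i (<⇒≤ h)) ; far = λ i _ → proj₂ (ne (r∈ i)) }
        r-mono : ∀ i d → i + d < k → r i ≼ r (i + d)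
        r-mono i zero h = inj₁ (cong r (sym (+-identityʳ i)))
        r-mono i (suc d) h = ≼-tr (r-mono i d (<-trans (+-monoʳ-< i ≤-refl) h))
          (inj₂ (subst (λ m → r (i + d) ≺ r m) (sym (+-suc i d)) (proj₁ (element-adj k s (i + d) (<⇒≤ (subst (_< k) (+-suc i d) h))))))
        r-small : ∀ i d → i + d < k → Small (In (just (r i)) (just (r (i + d))))
        r-small i zero h = small-empty λ (p , q) → ≺-irr (≺-tr p (subst (λ m → _ ≺ r m) (+-identityʳ i) q))
        r-small i (suc d) h = small-In {just (r i)} {just (r (i + suc d))} (r (i + d)) (r-small i d (<-trans (+-monoʳ-< i ≤-refl) h))
          (small-empty (subst (λ m → ∀ {z} → ¬ In (just (r (i + d))) (just (r m)) z) (sym (+-suc i d))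
            (proj₂ (element-adj k s (i + d) (<⇒≤ (subst (_< k) (+-suc i d) h))))))
        r-near : ∀ i j → i < k → j < k → Small (In (just (r i)) (just (r j)))
        r-near i j li lj with ≤-total i j
        ... | inj₁ h = subst (λ m → Small (In (just (r i)) (just (r m)))) (m+[n∸m]≡n h)
          (r-small i (j ∸ i) (subst (_< k) (sym (m+[n∸m]≡n h)) lj))
        ... | inj₂ h = small-empty λ (p , q) → ≺-irr (≼≺ (subst (λ m → r j ≼ r m) (m+[n∸m]≡n h)
          (r-mono j (i ∸ j) (subst (_< k) (sym (m+[n∸m]≡n h)) li))) (≺-tr p q))
        res : Small (In (just u) (just v))
        res with collapse run ws 0 a a sw ≤-refl
              (big-map (λ (p , q) → p , above-tr {b} q (proj₂ iu)) (proj₁ (ne iu)))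
              (λ _ iw _ c _ → proj₁ (ne iw) c) (λ h → proj₁ (r∈ 0)) (λ h _ → h)
        ... | zs , e , g , h with mv zs e g (λ ()) | partner e (us⊆ (here refl)) | partner e (us⊆ (there (here refl)))
        ... | f , iso , _ , _ , ft | u′ , m₁ | v′ , m₂ with h m₁ (proj₂ (ne iu)) | h m₂ (proj₂ (ne iv))
        ... | i , li , refl | j , lj , refl with r-near i j li lj
        ... | m , n = m , λ c → n (ch-pull iso m (λ w (p , q) →
          trans (proj₁ iso (r i) w) (subst (_≺ f w) (sym (ft m₁ (here refl))) p) ,
          trans (proj₁ iso w (r j)) (subst (f w ≺_) (sym (ft m₂ (there (here refl)))) q)) c)

  -- Blocks of maximal length

  module Blocks (A : Rel) (linA : IsLinearOrder A) where
    open Classify A linA public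

    -- The first element of a run of N + 1 points. Where longer runs are excluded, these runs are
    -- the blocks of maximal length and x is the head of its block.
    Block : ℕ → Maybe ℕ → Maybe ℕ → ℕ → Set
    Block N a b x = In a b x × ∃ λ y → In a b y × Steps x N y

    module Uniform (N : ℕ) (a b : Maybe ℕ) (good : Good [] a b) (ne : NoEnds a b) (short : ¬ HasRun (suc N) a b)
      (many : Big (Block N a b)) where

      no-long : ∀ {x z} d → In a b x → In a b z → ¬ Steps x (suc N + d) z
      no-long {x} {z} d ix iz s with steps-split (suc N) s
      ... | y , p , q = short (x , y , ix , In-mid {a} {b} ix iz (steps-≼ (suc N) p) (steps-≼ d q) , p)

      no-long′ : ∀ {x z} d → In a b x → In a b z → ¬ Steps x (d + suc N) z
      no-long′ {x} {z} d ix iz s = no-long d ix iz (subst (λ m → Steps x m z) (+-comm d (suc N)) s)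

      InBlock : ℕ → Set
      InBlock z = ∃ λ h → ∃ λ j → Block N a b h × Steps h j z

      overtake : ∀ j {h w g} → Steps h j w → h ≺ g → ¬ w ≺ g → ∃ λ i → Steps h (suc i) g
      overtake zero refl l n = ⊥-elim (n l)
      overtake (suc j) {h} {w} {g} (z , a@(_ , e) , s) l n with cmp z g
      ... | inj₁ k = let (i , t) = overtake j s k n in suc i , z , a , t
      ... | inj₂ (inj₁ refl) = 0 , z , a , refl
      ... | inj₂ (inj₂ k) = ⊥-elim (e (l , k))

      -- Otherwise g would be reached from h in at least one step, and going on through the block of
      -- g would give a run longer than allowed.
      separate : ∀ {h g w j} → Block N a b h → Block N a b g → h ≺ g → Steps h j w → w ≺ g
      separate {h} {g} {w} {j} (ih , _) (ig , y , iy , t) l s with lem (w ≺ g)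
      ... | yes k = k
      ... | no n with overtake j s l n
      ... | i , s′ = ⊥-elim (no-long′ i ih iy (subst (λ m → Steps h m y) (sym (+-suc i N)) (steps-++ (suc i) s′ t)))

      -- Elements at finite distance go to consecutive points of one full block, elements at
      -- infinite distance to the head of a fresh block taken from the chain. Gaps inside a block
      -- are empty and all other gaps face infinite ones, so ws dominates. The image w′ of w has
      -- position j in the block of h with `rem` points to come, and w itself ends a run of j steps
      -- that starts in x.
      spread : ∀ ws {w w′ h x y j rem} → Sorted (just w) ws b → In a b w → j + rem ≡ N → Block N a b h →
        Steps h j w′ → In a b w′ → In a b y → Steps w′ rem y → In a b x → Steps x j w →
        Ch (Block N a b ↑ h) (length ws) →
        ∃ λ zs → map proj₂ zs ≡ ws × Gaps Dominated (just w′) (just w) zs b b × (∀ {x′ x} → (x′ , x) ∈ zs → InBlock x′)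
      spread [] s iw e bh sh iw′ iy sy ix sx c = [] , refl , (λ k _ → proj₂ (ne iw) k) , λ ()
      spread (v ∷ ws) {w} {w′} {h} {x} {y} {j} {rem} (iv , s) iw e bh sh iw′ iy sy ix sx c
        with small-big (In (just w) (just v))
      ... | inj₂ big with c
      ... | g , (bg@(ig , y′ , iy′ , t) , l) , c′ with spread ws s (widenˡ {a} {b} (proj₁ iw) iv) refl bg refl ig iy′ t
              (widenˡ {a} {b} (proj₁ iw) iv) refl (ch-map _ (λ ((p , _) , q) → p , q) c′)
      ... | zs , e′ , gd , m = (g , v) ∷ zs , cong (v ∷_) e′ ,
          ((separate bh bg l sh , proj₂ ig) , iv , (λ k _ → big k) , gd) ,
          λ { (here refl) → g , 0 , bg , refl ; (there i) → m i }
      spread (v ∷ ws) {w} {w′} {h} {x} {y} {j} {rem} (iv , s) iw e bh sh iw′ iy sy ix sx c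
          | inj₁ sm with small-steps (proj₁ iv) sm | widenˡ {a} {b} (proj₁ iw) iv
      -- The block is used up, so j is N, and a further element at finite distance from w would
      -- prolong the run from x beyond the allowed length.
      spread (v ∷ ws) {w} {w′} {h} {x} {y} {j} {zero} (iv , s) iw e bh sh iw′ iy sy ix sx c | inj₁ sm | d , t | iv′ =
        ⊥-elim (no-long d ix iv′ (subst (λ m → Steps x m v) (trans (cong (_+ suc d) (trans (sym (+-identityʳ j)) e)) (+-suc N d)) (steps-++ j sx t)))
      spread (v ∷ ws) {w} {w′} {h} {x} {y} {j} {suc rem} (iv , s) iw e bh sh iw′ iy (w″ , adj@(l , emp) , sy) ix sx c | inj₁ sm | d , t | iv′
        -- Of the run from x to v only the last j + 1 steps are kept, so that v again ends a run as
        -- long as the position of its image requires.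
        with steps-split d (subst (λ m → Steps x m v) (trans (+-suc j d) (trans (cong suc (+-comm j d)) (sym (+-suc d j)))) (steps-++ j sx t))
      ... | x″ , p , q with spread ws {w = v} {w″} {h} {x″} {y} {suc j} {rem} s iv′ (trans (sym (+-suc j rem)) e) bh
              (subst (λ m → Steps h m w″) (+-comm j 1) (steps-++ j sh (w″ , adj , refl)))
              iw″ iy sy (In-mid {a} {b} ix iv′ (steps-≼ d p) (steps-≼ (suc j) q)) q (ch-drop _ c)
        where
        iw″ : In a b w″
        iw″ = In-mid {a} {b} iw′ iy (inj₂ l) (steps-≼ rem sy)
      ... | zs , e′ , gd , m = (w″ , v) ∷ zs , cong (v ∷_) e′ ,
          ((l , proj₂ (In-mid {a} {b} iw′ iy (inj₂ l) (steps-≼ rem sy))) , iv , dominated-empty emp , gd) ,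
          λ { (here refl) → h , suc j , bh , subst (λ m → Steps h m w″) (+-comm j 1) (steps-++ j sh (w″ , adj , refl))
            ; (there i) → m i }

      -- A tuple containing u dominates one that lies in full blocks. The automorphism obtained
      -- carries the block of the point u′ matched with u to a block containing u.
      in-block : ∀ {u} → In a b u → InBlock u
      in-block {u} iu with good (u ∷ []) (λ { (here refl) → iu })
      ... | [] , us⊆ , _ = case us⊆ (here refl) of λ ()
      ... | w ∷ ws , us⊆ , _ , (iw , s) , mv with many (suc (length ws))
      ... | h , bh@(ih , y , iy , t) , c with spread ws s iw refl bh refl ih iy t iw refl c
      ... | zs , e , gd , m with mv ((h , w) ∷ zs) (cong (w ∷_) e) (ih , iw , (λ k _ → proj₁ (ne iw) k) , gd) (λ ())
              | partner {(h , w) ∷ zs} (cong (w ∷_) e) (us⊆ (here refl))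
      ... | f , iso , fa , fb , ft | u′ , i with blk i
        where
        blk : ∀ {x′ x} → (x′ , x) ∈ (h , w) ∷ zs → InBlock x′
        blk (here refl) = h , 0 , bh , refl
        blk (there i) = m i
      ... | g , j , (ig , y′ , iy′ , t′) , s′ = f g , j ,
        ((push ig) , f y′ , push iy′ , steps-iso iso N t′) , subst (Steps (f g) j) (ft i (here refl)) (steps-iso iso j s′)
        where
        push : ∀ {z} → In a b z → In a b (f z)
        push (p , q) = below-push {lo = a} iso fa p , above-push {hi = b} iso fb q

      D : LO
      D = XL (Block N a b)

      D-isLO : IsLO D
      D-isLO = restr-isLO (ofRel-isLO linA)

      index-≤ : ∀ {h j u} → Block N a b h → In a b u → Steps h j u → j ≤ N
      index-≤ {h} {j} {u} (ih , _) iu s = ≮⇒≥ λ l → no-long (j ∸ suc N) ih iu (subst (λ m → Steps h m u) (sym (m+[n∸m]≡n l)) s)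

      after : ∀ {h x y} → Block N a b h → Steps h N y → In a b x → y ≺ x → ∃ λ g → Block N a b g × h ≺ g × g ≼ x
      after {h} {x} {y} bh t ix l with in-block ix
      ... | g , j , bg , s with cmp h g
      ... | inj₁ k = g , bg , k , steps-≼ j s
      ... | inj₂ (inj₂ k) = ⊥-elim (≺-irr (≺-tr (separate bg bh k s) (≼≺ (steps-≼ N t) l)))
      ... | inj₂ (inj₁ refl) with steps-split j (subst (λ m → Steps h m y) (sym (m+[n∸m]≡n (index-≤ bh ix s))) t)
      ... | x₁ , p , q with steps-det j s p
      ... | refl = ⊥-elim (≺-irr (≼≺ (steps-≼ (N ∸ j) q) l))

      -- Two blocks with only finitely many elements between them would form one run that is too
      -- long. So there is an element in between, and its block provides the head k.
      D-between : ∀ {h g} → Block N a b h → Block N a b g → h ≺ g → ∃ λ k → Block N a b k × h ≺ k × k ≺ g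
      D-between {h} {g} bh@(ih , y , iy , t) bg@(ig , _) l with small-big (In (just y) (just g))
      ... | inj₁ s = let (d , s′) = small-steps (separate bh bg l t) s in
        ⊥-elim (no-long d ih ig (subst (λ m → Steps h m g) (+-suc N d) (steps-++ N t s′)))
      ... | inj₂ big with big 1
      ... | x , (p , q) , _ with after bh t (below-tr {a} (proj₁ iy) p , above-tr {b} q (proj₂ ig)) p
      ... | k , bk , r , r′ = k , bk , r , ≼≺ r′ q

      D-limit : ∀ h → Limit-point D h
      D-limit (h , bh@(ih , y , iy , t)) = before , behind ,
        (λ (g , bg) l → let (k , bk , p , q) = D-between bg bh l in (k , bk) , p , q) ,
        (λ (g , bg) l → let (k , bk , p , q) = D-between bh bg l in (k , bk) , p , q)
        where
        before : ∃ λ g → lt D g (h , bh)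
        before with proj₁ (ne ih) 1
        ... | x , (p , q) , _ with in-block (p , above-tr {b} q (proj₂ ih))
        ... | g , j , bg , s = (g , bg) , ≼≺ (steps-≼ j s) q
        behind : ∃ λ g → lt D (h , bh) g
        behind with proj₂ (ne iy) 1
        ... | x , (p , q) , _ with after bh t (below-tr {a} (proj₁ iy) p , q) p
        ... | g , bg , l , _ = (g , bg) , l

      blocks-iso : IsoR (XL (In a b)) (D ⊗ finL (suc N))
      blocks-iso = G , tot , sur , λ {x} {y} {x′} {y′} g g′ → to {x} {y} {x′} {y′} g g′ , from {x} {y} {x′} {y′} g g′
        where
        G : Σ ℕ (In a b) → Σ ℕ (Block N a b) × Fin (suc N) → Set
        G (x , _) ((h , _) , i) = Steps h (toℕ i) x
        tot : ∀ x → ∃ (G x)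
        tot (x , ix) with in-block ix
        ... | h , j , bh , s = ((h , bh) , fromℕ< (s≤s (index-≤ bh ix s))) , subst (λ m → Steps h m x) (sym (toℕ-fromℕ< _)) s
        sur : ∀ y → ∃ λ x → G x y
        sur ((h , bh@(ih , y , iy , t)) , i) with steps-split (toℕ i) (subst (λ m → Steps h m y) (sym (m+[n∸m]≡n (≤-pred (toℕ<n i)))) t)
        ... | x , p , q = (x , In-mid {a} {b} ih iy (steps-≼ (toℕ i) p) (steps-≼ (N ∸ toℕ i) q)) , p
        from : ∀ {x y x′ y′} → G x y → G x′ y′ → lt (D ⊗ finL (suc N)) y y′ → proj₁ x ≺ proj₁ x′
        from {y = (h , bh) , i} {y′ = (h′ , bh′) , i′} g g′ (inj₁ l) = ≺≼ (separate bh bh′ l g) (steps-≼ (toℕ i′) g′)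
        from {x} {(h , bh) , i} {x′} {(h′ , bh′) , i′} g g′ (inj₂ (n , m , l)) with cmp h h′
        ... | inj₁ k = ⊥-elim (n k)
        ... | inj₂ (inj₂ k) = ⊥-elim (m k)
        ... | inj₂ (inj₁ refl) with steps-split (suc (toℕ i)) (subst (λ m → Steps h m (proj₁ x′)) (sym (m+[n∸m]≡n l)) g′)
        ... | z , p , q with steps-split (toℕ i) (subst (λ m → Steps h m z) (+-comm 1 (toℕ i)) p)
        ... | x₁ , p₁ , p₂ with steps-det (toℕ i) g p₁
        ... | refl = ≺≼ (steps-≺ 0 p₂) (steps-≼ (toℕ i′ ∸ suc (toℕ i)) q)
        to : ∀ {x y x′ y′} → G x y → G x′ y′ → proj₁ x ≺ proj₁ x′ → lt (D ⊗ finL (suc N)) y y′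
        to {x} {y@((h , bh) , i)} {x′} {y′@((h′ , bh′) , i′)} g g′ l with cmp h h′
        ... | inj₁ k = inj₁ k
        ... | inj₂ (inj₂ k) = ⊥-elim (≺-irr (≺-tr l (from {x′} {y′} {x} {y} g′ g (inj₁ k))))
        ... | inj₂ (inj₁ refl) with <-cmp (toℕ i) (toℕ i′)
        ... | tri< k _ _ = inj₂ (≺-irr , ≺-irr , k)
        ... | tri> _ _ k = ⊥-elim (≺-irr (≺-tr l (from {x′} {y′} {x} {y} g′ g (inj₂ (≺-irr , ≺-irr , k)))))
        ... | tri≈ _ e _ with steps-det (toℕ i) g (subst (λ m → Steps h m (proj₁ x′)) (sym e) g′)
        ... | refl = ⊥-elim (≺-irr l)

      cls-uniform : Cls (In a b)
      cls-uniform = cls-piece (eta N) (iso-trans {_} {D ⊗ finL (suc N)} {_} blocks-iso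
        (⊗-iso (cantor D-isLO QL-isLO (restr-countable (ofRel-isLO linA)) Q-countable
          (let (h , bh , _) = many 1 in h , bh) 0 D-limit Q-limit) iso-refl))

    HasRun-⊆ : ∀ {n a b a′ b′} → (∀ {z} → In a′ b′ z → In a b z) → HasRun n a′ b′ → HasRun n a b
    HasRun-⊆ h (x , y , ix , iy , s) = x , y , h ix , h iy , s

    -- Only finitely many blocks of maximal length: cut them out.
    cls-few : ∀ N → (∀ a b → Good [] a b → NoEnds a b → ¬ HasRun N a b → Cls (In a b)) →
      ∀ m a b → Good [] a b → NoEnds a b → ¬ HasRun (suc N) a b → ¬ Ch (Block N a b) m → Cls (In a b)
    cls-few N ih zero a b good ne short few = ⊥-elim (few tt)
    cls-few N ih (suc m) a b good ne short few with lem (∃ (Block N a b))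
    ... | no none = ih a b good ne λ (x , y , ix , iy , s) → none (x , ix , y , iy , s)
    ... | yes (x , bx@(ix , y , iy , s)) = cls-join {λ z → In a b z × ¬ y ≺ z} {In (just y) b}
        (cls-join {In a (just x)} {λ z → (In a b z × ¬ y ≺ z) × ¬ z ≺ x} left (cls-small middle)
          (λ {u} {v} (_ , l) (_ , n) → [ id , (λ k → ⊥-elim (n k)) ]′ (cotr (ofRel-isLO linA) l v))
          (λ {z} (iz , n) → case lem (z ≺ x) of λ { (yes h) → inj₁ (proj₁ iz , h) ; (no k) → inj₂ ((iz , n) , k) })
          (λ {z} (p , q) → widenʳ {a} {b} (proj₂ ix) (p , q) , λ k → ≺-irr (≼≺ (steps-≼ N s) (≺-tr k q))) proj₁)
        right
        (λ {u} {v} (_ , n) (l , _) → [ (λ k → ⊥-elim (n k)) , id ]′ (cotr (ofRel-isLO linA) l u))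
        (λ {z} iz → case lem (y ≺ z) of λ { (yes h) → inj₂ (h , proj₂ iz) ; (no n) → inj₁ (iz , n) })
        proj₁ (widenˡ {a} {b} (proj₁ iy))
      where
      x≼y = steps-≼ N s
      sub-l : ∀ {z} → In a (just x) z → In a b z
      sub-l = widenʳ {a} {b} (proj₂ ix)
      sub-r : ∀ {z} → In (just y) b z → In a b z
      sub-r = widenˡ {a} {b} (proj₁ iy)
      left : Cls (In a (just x))
      left = cls-few N ih m a (just x) (good-left ix good) ne′ (short ∘ HasRun-⊆ {suc N} {a} {b} {a} {just x} sub-l)
        λ c → few (subst (Ch (Block N a b)) (+-comm m 1)
          (ch-cat m (ch-map m (λ (iz , w , iw , t) → (sub-l iz , w , sub-l iw , t) , proj₂ iz) c) bx tt))
        where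
        -- Cutting at the head x makes no new right end: an element at finite distance below x would
        -- yield an immediate predecessor of x, and the block would extend to N + 1 steps.
        ne′ : NoEnds a (just x)
        ne′ {u} iu = proj₁ (ne (sub-l iu)) , not-small λ sm →
          let (d , t) = small-steps (proj₂ iu) sm
              (z , p , q) = steps-split d (subst (λ k → Steps u k x) (+-comm 1 d) t)
          in short (z , y , In-mid {a} {b} (sub-l iu) ix (steps-≼ d p) (steps-≼ 1 q) , iy , steps-++ 1 q s)
      right : Cls (In (just y) b)
      right = cls-few N ih m (just y) b (good-right iy good) ne′ (short ∘ HasRun-⊆ {suc N} {a} {b} {just y} {b} sub-r)
        λ c → few (ch-cat 0 tt bx (ch-map m (λ (iz , w , iw , t) → (sub-r iz , w , sub-r iw , t) , ≼≺ x≼y (proj₁ iz)) c))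
        where
        ne′ : NoEnds (just y) b
        ne′ {u} iu = (λ k → not-small (λ sm →
          let (d , t) = small-steps (proj₁ iu) sm
              (z , p , q) = steps-split 1 t
          in short (x , z , ix , In-mid {a} {b} iy (sub-r iu) (steps-≼ 1 p) (steps-≼ d q) ,
               subst (λ k → Steps x k z) (+-comm N 1) (steps-++ N s p))) k) , proj₂ (ne (sub-r iu))
      middle : Small (λ z → (In a b z × ¬ y ≺ z) × ¬ z ≺ x)
      middle = small-join x (small-empty λ ((_ , n) , l) → n l)
        (small-join y (small-map (λ (((_ , _) , p) , q) → p , q) (steps-small N s)) (small-empty λ ((((_ , n) , _) , _) , l) → n l))

    cls-bounded : ∀ K a b → Good [] a b → NoEnds a b → ¬ HasRun K a b → Cls (In a b)
    cls-bounded zero a b good ne none = cls-empty λ {x} i → none (x , x , i , i , refl)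
    cls-bounded (suc N) a b good ne short with small-big (Block N a b)
    ... | inj₁ (m , few) = cls-few N (cls-bounded N) m a b good ne short few
    ... | inj₂ many = Uniform.cls-uniform N a b good ne short many

    cls-no-ends : ∀ {a b} → Good [] a b → NoEnds a b → Cls (In a b)
    cls-no-ends {a} {b} good ne with lem (∃ λ n → ¬ HasRun n a b)
    ... | yes (n , short) = cls-bounded n a b good ne short
    ... | no none = cls-unbounded {a} {b} good ne λ n → case lem (HasRun n a b) of λ
      { (yes r) → r ; (no k) → ⊥-elim (none (n , k)) }

    cls-no-left : ∀ {a b} → Good₂ [] a b → (∀ {u} → In a b u → Big (In a (just u))) → Cls (In a b)
    cls-no-left {a} {b} (good , good′) nl with F.small-big (F.Finite-left b a)
    ... | inj₂ big = cls-ends {a} {b} λ {u} i → [ (λ s → inj₂ (small-from swap s)) , (λ s → inj₁ (small-from swap s)) ]′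
        (F.finite-left⇒finite-right good′ big (swap i))
    ... | inj₁ sm with F.trim b a sm
    ... | inj₁ nr = cls-no-ends {a} {b} good λ {u} i → nl i , big-from swap (nr (swap i))
    ... | inj₂ (x , ix , s , nr) = cls-cut-In {a} {b} (swap ix)
        (cls-no-ends {a} {just x} (good-left (swap ix) good) λ {u} i →
          nl (widenʳ {a} {b} (proj₁ ix) i) , big-from swap (nr (swap i)))
        (cls-small (small-from swap s))

    -- If infinitely many elements have finitely many predecessors, every element is at finite
    -- distance from one of the two ends. Otherwise at most a finite piece is cut off on the left,
    -- and `cls-no-left` treats the right end in the same way.
    classify : ∀ {a b} → Good₂ [] a b → Cls (In a b)
    classify {a} {b} g@(good , good′) with small-big (Finite-left a b)
    ... | inj₂ big = cls-ends {a} {b} (finite-left⇒finite-right {a} {b} good big)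
    ... | inj₁ sm with trim a b sm
    ... | inj₁ nl = cls-no-left {a} {b} g nl
    ... | inj₂ (x , ix , s , nl) = cls-cut-In {a} {b} ix (cls-small s)
        (cls-no-left {just x} {b} (good₂-right ix g) nl)

    classify-over : ∀ S {a b} → Good₂ S a b → Cls (In a b)
    classify-over [] {a} {b} g = classify {a} {b} g
    classify-over (s ∷ S) {a} {b} g with lem (In a b s)
    ... | no n = classify-over S {a} {b} (good-drop n (proj₁ g) , F.good-drop (n ∘ swap) (proj₂ g))
    ... | yes i = cls-cut-In {a} {b} i
        (let (p , q) = good₂-left i g in classify-over S {a} {just s} (good-drop (≺-irr ∘ proj₂) p , F.good-drop (≺-irr ∘ proj₁) q))
        (let (p , q) = good₂-right i g in classify-over S {just s} {b} (good-drop (≺-irr ∘ proj₁) p , F.good-drop (≺-irr ∘ proj₂) q))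

  abstract
    classification : ∀ {L} → IsLinearOrder L → RelDelta2Cat L → Σ (List Piece) λ σ → IsoR (ofRel L) (Ts σ)
    classification {L} linL cat =
      let sc = Forcing.delta2⇒scott L linL cat
          (σ , i) = classify-over (range (proj₁ sc)) {nothing} {nothing}
                      (scott⇒good L linL sc , scott⇒good (flip L) (flip-linear linL) (scott-flip linL sc))
      in σ , iso-trans {_} {XL (In nothing nothing)} {_} whole i
      where
      open Blocks L linL
      whole : IsoR (ofRel L) (XL (In nothing nothing))
      whole = (λ x y → x ≡ proj₁ y) , (λ x → (x , tt , tt) , refl) , (λ y → proj₁ y , refl) , λ { refl refl → id , id }

  -- Insertions and sums of punctual orders

  punctual : ∀ {B} → B2 tt B → Punctual B
  punctual (t , p) = t , λ x y → p (x ∷ y ∷ [])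

  Adjacent : Rel → ℕ → ℕ → Set
  Adjacent B x y = B x y ≡ true × (∀ {z} → ¬ (B x z ≡ true × B z y ≡ true))

  Succ : Rel → Set
  Succ B = ∃ λ s → F1 tt s × (∀ x y → Adjacent B x y → s x ≡ y)

  Neighbours : Rel → Set
  Neighbours B = Succ B × Succ (flip B)

  Towards : Bool → Rel → Rel
  Towards true B = B
  Towards false B = flip B

  -- The neighbour c precedes b n if `dir` is true and follows it if `dir` is false, the case of
  -- reversed copies. It is merely asserted to exist: computing it is left to the isomorphisms, and
  -- e then reads f n off its index.
  Codes : (ℕ → ℕ) → Rel → Set
  Codes f B = ∃ λ dir → ∃ λ b → ∃ λ e → F1 tt b × F2 tt e ×
    (∀ n → ∃ λ c → Adjacent (Towards dir B) c (b n) × e n c ≡ f n)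

  flip-conn : ∀ {B} → Conn B → Conn (flip B)
  flip-conn h x y n = swap′ (h x y n)
    where
    swap′ : ∀ {P Q : Set} → P ⊎ Q → Q ⊎ P
    swap′ = [ inj₂ , inj₁ ]′

  adjacent-≗ : ∀ {B B′ : Rel} → (∀ x y → B x y ≡ B′ x y) → ∀ {x y} → Adjacent B x y → Adjacent B′ x y
  adjacent-≗ h {x} {y} (l , n) = trans (sym (h x y)) l , λ {z} (p , q) → n {z} (trans (h x z) p , trans (h z y) q)

  succ-≗ : ∀ {B B′ : Rel} → (∀ x y → B x y ≡ B′ x y) → Succ B → Succ B′
  succ-≗ h (s , sE , c) = s , sE , λ x y a → c x y (adjacent-≗ (λ x y → sym (h x y)) a)

  adjacent-functional : ∀ {B} → Conn B → ∀ {x y x′ y′} → Adjacent B x y → Adjacent B x′ y′ → Iff (x ≡ x′) (y ≡ y′)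
  adjacent-functional {B} cB {x} {y} {x′} {y′} (l , n) (l′ , n′) = to , from
    where
    to : x ≡ x′ → y ≡ y′
    to refl with y ≟ y′
    ... | yes e = e
    ... | no m = ⊥-elim ([ (λ h → n′ (l , h)) , (λ h → n (l′ , h)) ]′ (cB y y′ m))
    from : y ≡ y′ → x ≡ x′
    from refl with x ≟ x′
    ... | yes e = e
    ... | no m = ⊥-elim ([ (λ h → n (h , l′)) , (λ h → n′ (h , l)) ]′ (cB x x′ m))

  -- Insertions and sums create at most one new adjacency, at the junction. Excluded middle tells
  -- whether and where it occurs, and this single value is then written into the program.
  succ-except : ∀ {B} → Conn B → ∀ s → F1 tt s → (Ex : ℕ → ℕ → Set) → (∀ x y → Ex x y → Adjacent B x y) →
    (∀ x y x′ y′ → Ex x y → Ex x′ y′ → x ≡ x′) → (∀ x y → Adjacent B x y → s x ≡ y ⊎ Ex x y) → Succ B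
  succ-except {B} cB s sE Ex adj one! h with lem (∃ λ x → ∃ λ y → Ex x y)
  ... | no none = s , sE , λ x y a → [ id , (λ e → ⊥-elim (none (x , y , e))) ]′ (h x y a)
  ... | yes (x₀ , y₀ , e₀) = (λ x → if x ≡ᵇ x₀ then y₀ else s x) , ifE (eqB v0 (cst x₀)) (cst y₀) sE , ok
    where
    ok : ∀ x y → Adjacent B x y → (if x ≡ᵇ x₀ then y₀ else s x) ≡ y
    ok x y a with x ≡ᵇ x₀ in q
    ... | true = proj₁ (adjacent-functional cB (adj _ _ e₀) a) (sym (ᵇ⇒≡ q))
    ... | false with h x y a
    ... | inj₁ e = e
    ... | inj₂ e = ⊥-elim (true≢false (trans (cong (_≡ᵇ x₀) (one! _ _ _ _ e e₀)) (≡ᵇ-refl x₀)) q)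

  record Pres (X : LO) (Ψ : Rel → Set) : Set₁ where
    constructor mkPres
    field
      B : Rel
      pun : B2 tt B
      conn : Conn B
      iso : IsoR (ofRel B) X
      prop : Ψ B

  pres-iso : ∀ {X Y Ψ} → IsoR X Y → Pres X Ψ → Pres Y Ψ
  pres-iso {X} i (mkPres B p c j q) = mkPres B p c (iso-trans {_} {X} {_} j i) q

  coded-iso : ∀ {X B} (enc : C X → ℕ) → (∀ x → ∃ λ c → enc c ≡ x) →
    (∀ c c′ → Iff (B (enc c) (enc c′) ≡ true) (lt X c c′)) → IsoR (ofRel B) X
  coded-iso {X} enc sur h = iso-flip (iso-fun enc sur λ {c} {c′} → swap (h c c′))

  side : Bool → LO → LO → LO
  side true X Y = X ⊕ Y
  side false X Y = Y ⊕ X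

  true-or : ∀ d → d ≡ true ⊎ not d ≡ true
  true-or true = inj₁ refl
  true-or false = inj₂ refl

  not-or : ∀ d → not d ≡ true ⊎ d ≡ true
  not-or true = inj₂ refl
  not-or false = inj₁ refl

  insertPt : Bool → Rel → Rel
  insertPt d M zero zero = false
  insertPt d M zero (suc j) = d
  insertPt d M (suc i) zero = not d
  insertPt d M (suc i) (suc j) = M i j

  module Insert (d : Bool) (M : Rel) where
    R = insertPt d M

    pun : B2 tt M → B2 tt R
    pun p = Bcast (λ xs → eq (a0 xs) (a1 xs)) (ifB (eqB v0 (cst 0)) (ifB (eqB v1 (cst 0)) falseB dE)
      (ifB (eqB v1 (cst 0)) (notB dE) (app p (predE v0 ∷E predE v1 ∷E []E))))
      where
      dE : EB tt 2 (λ _ → d)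
      dE = cst (bit d)
      eq : ∀ x y → (if x ≡ᵇ 0 then (if y ≡ᵇ 0 then false else d) else (if y ≡ᵇ 0 then not d else M (pred x) (pred y))) ≡ R x y
      eq zero zero = refl
      eq zero (suc y) = refl
      eq (suc x) zero = refl
      eq (suc x) (suc y) = refl

    conn : Conn M → Conn R
    conn c zero zero n = ⊥-elim (n refl)
    conn c zero (suc y) n = true-or d
    conn c (suc x) zero n = not-or d
    conn c (suc x) (suc y) n = c x y (n ∘ cong suc)

    succ-ins : Conn M → Succ M → Succ R
    succ-ins cM (s , sE , h) = succ-except (conn cM) (λ x → if x ≡ᵇ 0 then 0 else suc (s (pred x)))
      (ifE (eqB v0 (cst 0)) (cst 0) (sucE (app1 s sE (predE v0)))) Ex (λ _ _ → proj₁) uniq ok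
      where
      Ex : ℕ → ℕ → Set
      Ex x y = Adjacent R x y × (x ≡ 0 ⊎ y ≡ 0)
      uniq : ∀ x y x′ y′ → Ex x y → Ex x′ y′ → x ≡ x′
      uniq x y x′ y′ (a , inj₁ e) (a′ , inj₁ e′) = trans e (sym e′)
      uniq x y x′ y′ (a , inj₂ e) (a′ , inj₂ e′) = proj₂ (adjacent-functional (conn cM) a a′) (trans e (sym e′))
      uniq zero zero x′ y′ ((() , _) , inj₁ _) (a′ , inj₂ e′)
      uniq zero (suc y) zero zero (a , inj₁ _) ((() , _) , inj₂ _)
      uniq zero (suc y) (suc x′) zero ((l , _) , inj₁ _) ((l′ , _) , inj₂ _) = ⊥-elim (true≢false l′ (cong not l))
      uniq zero zero x′ y′ ((() , _) , inj₂ _) (a′ , inj₁ _)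
      uniq (suc x) zero zero zero (a , inj₂ _) ((() , _) , inj₁ _)
      uniq (suc x) zero zero (suc y′) ((l , _) , inj₂ _) ((l′ , _) , inj₁ _) = ⊥-elim (true≢false l (cong not l′))
      ok : ∀ x y → Adjacent R x y → (if x ≡ᵇ 0 then 0 else suc (s (pred x))) ≡ y ⊎ Ex x y
      ok zero y a = inj₂ (a , inj₁ refl)
      ok (suc x) zero a = inj₂ (a , inj₂ refl)
      ok (suc x) (suc y) (l , n) = inj₁ (cong suc (h x y (l , λ {z} → n {suc z})))

    adjacent-ins : ∀ {x y} → Adjacent M x y → Adjacent R (suc x) (suc y)
    adjacent-ins (l , n) = l , λ { {zero} (p , q) → true≢false p (cong not q) ; {suc z} p → n p }

    iso : IsoR (ofRel R) (side d one (ofRel M))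
    iso = go d
      where
      go : ∀ d → IsoR (ofRel (insertPt d M)) (side d one (ofRel M))
      go true = coded-iso {one ⊕ ofRel M} (λ { (inj₁ _) → 0 ; (inj₂ i) → suc i })
        (λ { zero → inj₁ tt , refl ; (suc x) → inj₂ x , refl })
        (λ { (inj₁ _) (inj₁ _) → (λ ()) , λ { (ll ()) } ; (inj₁ _) (inj₂ _) → (λ _ → lr) , λ _ → refl
           ; (inj₂ _) (inj₁ _) → (λ ()) , λ () ; (inj₂ _) (inj₂ _) → rr , unrr })
      go false = coded-iso {ofRel M ⊕ one} (λ { (inj₂ _) → 0 ; (inj₁ i) → suc i })
        (λ { zero → inj₂ tt , refl ; (suc x) → inj₁ x , refl })
        (λ { (inj₂ _) (inj₂ _) → (λ ()) , λ { (rr ()) } ; (inj₁ _) (inj₂ _) → (λ _ → lr) , λ _ → refl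
           ; (inj₂ _) (inj₁ _) → (λ ()) , λ () ; (inj₁ _) (inj₁ _) → ll , unll })

  insert-flip : ∀ d M x y → insertPt (not d) (flip M) x y ≡ flip (insertPt d M) x y
  insert-flip d M zero zero = refl
  insert-flip d M zero (suc y) = refl
  insert-flip true M (suc x) zero = refl
  insert-flip false M (suc x) zero = refl
  insert-flip d M (suc x) (suc y) = refl

  enc : ℕ ⊎ ℕ → ℕ
  enc (inj₁ i) = i * 2
  enc (inj₂ i) = suc (i * 2)

  dec : ℕ → ℕ ⊎ ℕ
  dec x = if x % 2 ≡ᵇ 0 then inj₁ (x / 2) else inj₂ (x / 2)

  odd-/ : ∀ i → suc (i * 2) / 2 ≡ i
  odd-/ i = trans (+-distrib-/-∣ʳ 1 {i * 2} {2} (divides-refl i)) (m*n/n≡m i 2)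

  dec-enc : ∀ c → dec (enc c) ≡ c
  dec-enc (inj₁ i) rewrite m*n%n≡0 i 2 ⦃ _ ⦄ = cong inj₁ (m*n/n≡m i 2)
  dec-enc (inj₂ i) rewrite [m+kn]%n≡m%n 1 i 2 ⦃ _ ⦄ = cong inj₂ (odd-/ i)

  enc-dec : ∀ x → enc (dec x) ≡ x
  enc-dec x with x % 2 in e | m%n<n x 2
  ... | zero | _ = sym (trans (m≡m%n+[m/n]*n x 2) (cong (_+ x / 2 * 2) e))
  ... | suc zero | _ = sym (trans (m≡m%n+[m/n]*n x 2) (cong (_+ x / 2 * 2) e))
  ... | suc (suc _) | s≤s (s≤s ())

  sumLt : Bool → Rel → Rel → ℕ ⊎ ℕ → ℕ ⊎ ℕ → Bool
  sumLt d M N (inj₁ i) (inj₁ j) = M i j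
  sumLt d M N (inj₁ i) (inj₂ j) = d
  sumLt d M N (inj₂ i) (inj₁ j) = not d
  sumLt d M N (inj₂ i) (inj₂ j) = N i j

  sumRel : Bool → Rel → Rel → Rel
  sumRel d M N x y = sumLt d M N (dec x) (dec y)

  module SumRel (d : Bool) (M N : Rel) where
    R = sumRel d M N

    at : ∀ c c′ → R (enc c) (enc c′) ≡ sumLt d M N c c′
    at c c′ = cong₂ (sumLt d M N) (dec-enc c) (dec-enc c′)

    pun : B2 tt M → B2 tt N → B2 tt R
    pun p q = Bcast (λ xs → eq (a0 xs) (a1 xs)) (ifB (eqB (modE 1 v0) (cst 0))
      (ifB (eqB (modE 1 v1) (cst 0)) (app p (divE 1 v0 ∷E divE 1 v1 ∷E []E)) dE)
      (ifB (eqB (modE 1 v1) (cst 0)) (notB dE) (app q (divE 1 v0 ∷E divE 1 v1 ∷E []E))))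
      where
      dE : EB tt 2 (λ _ → d)
      dE = cst (bit d)
      eq : ∀ x y → (if x % 2 ≡ᵇ 0 then (if y % 2 ≡ᵇ 0 then M (x / 2) (y / 2) else d)
                    else (if y % 2 ≡ᵇ 0 then not d else N (x / 2) (y / 2))) ≡ R x y
      eq x y with x % 2 ≡ᵇ 0 | y % 2 ≡ᵇ 0
      ... | true | true = refl
      ... | true | false = refl
      ... | false | true = refl
      ... | false | false = refl

    conn : Conn M → Conn N → Conn R
    conn cM cN x y n = go (dec x) (dec y) λ e → n (trans (sym (enc-dec x)) (trans (cong enc e) (enc-dec y)))
      where
      go : ∀ c c′ → c ≢ c′ → sumLt d M N c c′ ≡ true ⊎ sumLt d M N c′ c ≡ true
      go (inj₁ i) (inj₁ j) n = cM i j (n ∘ cong inj₁)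
      go (inj₂ i) (inj₂ j) n = cN i j (n ∘ cong inj₂)
      go (inj₁ i) (inj₂ j) n = true-or d
      go (inj₂ i) (inj₁ j) n = not-or d

    Adj⊎ : ℕ ⊎ ℕ → ℕ ⊎ ℕ → Set
    Adj⊎ c c′ = sumLt d M N c c′ ≡ true × (∀ {z} → ¬ (sumLt d M N c z ≡ true × sumLt d M N z c′ ≡ true))

    adj⊎ : ∀ {x y} → Adjacent R x y → Adj⊎ (dec x) (dec y)
    adj⊎ {x} {y} (l , n) = l , λ {z} (p , q) → n {enc z}
      (trans (cong (sumLt d M N (dec x)) (dec-enc z)) p , trans (cong (λ c → sumLt d M N c (dec y)) (dec-enc z)) q)

    adjacent-left : ∀ {i j} → Adjacent M i j → Adjacent R (i * 2) (j * 2)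
    adjacent-left {i} {j} (l , n) = trans (at (inj₁ i) (inj₁ j)) l , λ {z} (p , q) →
      go (dec z) (trans (cong (λ c → sumLt d M N c (dec z)) (sym (dec-enc (inj₁ i)))) p)
                 (trans (cong (sumLt d M N (dec z)) (sym (dec-enc (inj₁ j)))) q)
      where
      go : ∀ c → sumLt d M N (inj₁ i) c ≡ true → sumLt d M N c (inj₁ j) ≡ true → ⊥
      go (inj₁ k) p q = n (p , q)
      go (inj₂ k) p q = true≢false q (cong not p)

    succ-sum : Conn M → Conn N → Succ M → Succ N → Succ R
    succ-sum cM cN (s , sE , h) (u , uE , k) = succ-except (conn cM cN) f
      (ifE (eqB (modE 1 v0) (cst 0)) (app1 s sE (divE 1 v0) *E cst 2) (sucE (app1 u uE (divE 1 v0) *E cst 2)))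
      Ex (λ _ _ → proj₁) uniq ok
      where
      f : ℕ → ℕ
      f x = if x % 2 ≡ᵇ 0 then s (x / 2) * 2 else suc (u (x / 2) * 2)
      f⊎ : ℕ ⊎ ℕ → ℕ ⊎ ℕ
      f⊎ (inj₁ i) = inj₁ (s i)
      f⊎ (inj₂ i) = inj₂ (u i)
      f-dec : ∀ x → f x ≡ enc (f⊎ (dec x))
      f-dec x with x % 2 ≡ᵇ 0
      ... | true = refl
      ... | false = refl
      Cross : ℕ ⊎ ℕ → ℕ ⊎ ℕ → Set
      Cross (inj₁ _) (inj₂ _) = ⊤
      Cross (inj₂ _) (inj₁ _) = ⊤
      Cross _ _ = ⊥
      Ex : ℕ → ℕ → Set
      Ex x y = Adjacent R x y × Cross (dec x) (dec y)
      uniq⊎ : ∀ c c′ e e′ → Adj⊎ c c′ → Adj⊎ e e′ → Cross c c′ → Cross e e′ → c ≡ e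
      uniq⊎ (inj₁ i) (inj₂ j) (inj₁ i′) (inj₂ j′) (l , n) (l′ , n′) _ _ with i ≟ i′
      ... | yes e = cong inj₁ e
      ... | no m = ⊥-elim ([ (λ p → n {inj₁ i′} (p , l)) , (λ p → n′ {inj₁ i} (p , l)) ]′ (cM i i′ m))
      uniq⊎ (inj₂ i) (inj₁ j) (inj₂ i′) (inj₁ j′) (l , n) (l′ , n′) _ _ with i ≟ i′
      ... | yes e = cong inj₂ e
      ... | no m = ⊥-elim ([ (λ p → n {inj₂ i′} (p , l)) , (λ p → n′ {inj₂ i} (p , l)) ]′ (cN i i′ m))
      uniq⊎ (inj₁ i) (inj₂ j) (inj₂ i′) (inj₁ j′) (l , n) (l′ , n′) _ _ = ⊥-elim (true≢false l′ (cong not l))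
      uniq⊎ (inj₂ i) (inj₁ j) (inj₁ i′) (inj₂ j′) (l , n) (l′ , n′) _ _ = ⊥-elim (true≢false l (cong not l′))
      uniq : ∀ x y x′ y′ → Ex x y → Ex x′ y′ → x ≡ x′
      uniq x y x′ y′ (a , c) (a′ , c′) = trans (sym (enc-dec x))
        (trans (cong enc (uniq⊎ _ _ _ _ (adj⊎ {x} {y} a) (adj⊎ {x′} {y′} a′) c c′)) (enc-dec x′))
      ok⊎ : ∀ c c′ → Adj⊎ c c′ → f⊎ c ≡ c′ ⊎ Cross c c′
      ok⊎ (inj₁ i) (inj₁ j) (l , n) = inj₁ (cong inj₁ (h i j (l , λ {z} → n {inj₁ z})))
      ok⊎ (inj₁ i) (inj₂ j) a = inj₂ tt
      ok⊎ (inj₂ i) (inj₁ j) a = inj₂ tt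
      ok⊎ (inj₂ i) (inj₂ j) (l , n) = inj₁ (cong inj₂ (k i j (l , λ {z} → n {inj₂ z})))
      ok : ∀ x y → Adjacent R x y → f x ≡ y ⊎ Ex x y
      ok x y a = [ (λ e → inj₁ (trans (f-dec x) (trans (cong enc e) (enc-dec y)))) , (λ c → inj₂ (a , c)) ]′ (ok⊎ _ _ (adj⊎ {x} {y} a))

  sum-iso : ∀ d M N → IsoR (ofRel (sumRel d M N)) (side d (ofRel M) (ofRel N))
  sum-iso true M N = coded-iso {ofRel M ⊕ ofRel N} enc (λ x → dec x , enc-dec x) λ c c′ →
    (λ h → to c c′ (trans (sym (at c c′)) h)) , λ h → trans (at c c′) (from c c′ h)
    where
    open SumRel true M N
    to : ∀ c c′ → sumLt true M N c c′ ≡ true → SumLt (ofRel M) (ofRel N) c c′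
    to (inj₁ _) (inj₁ _) h = ll h
    to (inj₁ _) (inj₂ _) h = lr
    to (inj₂ _) (inj₂ _) h = rr h
    from : ∀ c c′ → SumLt (ofRel M) (ofRel N) c c′ → sumLt true M N c c′ ≡ true
    from _ _ (ll h) = h
    from _ _ lr = refl
    from _ _ (rr h) = h
  sum-iso false M N = coded-iso {ofRel N ⊕ ofRel M} (enc ∘ sw) (λ x → sw (dec x) , trans (cong enc (sw-sw (dec x))) (enc-dec x)) λ c c′ →
    (λ h → to c c′ (trans (sym (at (sw c) (sw c′))) h)) , λ h → trans (at (sw c) (sw c′)) (from c c′ h)
    where
    open SumRel false M N
    sw : ℕ ⊎ ℕ → ℕ ⊎ ℕ
    sw (inj₁ x) = inj₂ x
    sw (inj₂ x) = inj₁ x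
    sw-sw : ∀ c → sw (sw c) ≡ c
    sw-sw (inj₁ _) = refl
    sw-sw (inj₂ _) = refl
    to : ∀ c c′ → sumLt false M N (sw c) (sw c′) ≡ true → SumLt (ofRel N) (ofRel M) c c′
    to (inj₁ _) (inj₁ _) h = ll h
    to (inj₁ _) (inj₂ _) h = lr
    to (inj₂ _) (inj₂ _) h = rr h
    from : ∀ c c′ → SumLt (ofRel N) (ofRel M) c c′ → sumLt false M N (sw c) (sw c′) ≡ true
    from _ _ (ll h) = h
    from _ _ lr = refl
    from _ _ (rr h) = h

  sum-flip : ∀ d M N x y → sumRel (not d) (flip M) (flip N) x y ≡ flip (sumRel d M N) x y
  sum-flip d M N x y = go d (dec x) (dec y)
    where
    go : ∀ d c c′ → sumLt (not d) (flip M) (flip N) c c′ ≡ sumLt d M N c′ c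
    go d (inj₁ _) (inj₁ _) = refl
    go d (inj₁ _) (inj₂ _) = refl
    go true (inj₂ _) (inj₁ _) = refl
    go false (inj₂ _) (inj₁ _) = refl
    go d (inj₂ _) (inj₂ _) = refl

  -- These are the operations that complete a copy of one piece to a copy of the whole sum. The
  -- added summand has computable neighbours, while Ψ is inherited from M.
  record Stable (Ψ : Rel → Set) : Set where
    field
      insert-stable : ∀ {M} d → Conn M → Ψ M → Ψ (insertPt d M)
      sum-stable : ∀ {M N} d → Conn M → Conn N → Ψ M → Neighbours N → Ψ (sumRel d M N)
  open Stable public

  neighbours-stable : Stable Neighbours
  neighbours-stable = record
    { insert-stable = λ {M} d c (s , p) → Insert.succ-ins d M c s ,
        succ-≗ (insert-flip d M) (Insert.succ-ins (not d) (flip M) (flip-conn c) p)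
    ; sum-stable = λ {M} {N} d c c′ (s , p) (s′ , p′) → SumRel.succ-sum d M N c c′ s s′ ,
        succ-≗ (sum-flip d M N) (SumRel.succ-sum (not d) (flip M) (flip N) (flip-conn c) (flip-conn c′) p p′) }

  -- Additions take place outside M, so adjacencies inside M survive; only the indices have to be
  -- translated.
  codes-stable : ∀ f → Stable (Codes f)
  codes-stable f = record { insert-stable = λ {M} d _ c → ins M d c ; sum-stable = λ {M} {N} d _ _ c _ → sum M N d c }
    where
    ins : ∀ M d → Codes f M → Codes f (insertPt d M)
    ins M d (dir , b , e , bE , eE , h) = dir , suc ∘ b , (λ n c → e n (pred c)) , sucE bE , app2 e eE v0 (predE v1) ,
      λ n → let (c , a , q) = h n in suc c , adj dir a , q
      where
      adj : ∀ dir {x y} → Adjacent (Towards dir M) x y → Adjacent (Towards dir (insertPt d M)) (suc x) (suc y)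
      adj true a = Insert.adjacent-ins d M a
      adj false a = adjacent-≗ (insert-flip d M) (Insert.adjacent-ins (not d) (flip M) a)
    sum : ∀ M N d → Codes f M → Codes f (sumRel d M N)
    sum M N d (dir , b , e , bE , eE , h) = dir , (λ n → b n * 2) , (λ n c → e n (c / 2)) , bE *E cst 2 , app2 e eE v0 (divE 1 v1) ,
      λ n → let (c , a , q) = h n in c * 2 , adj dir a , trans (cong (e n) (m*n/n≡m c 2)) q
      where
      adj : ∀ dir {x y} → Adjacent (Towards dir M) x y → Adjacent (Towards dir (sumRel d M N)) (x * 2) (y * 2)
      adj true a = SumRel.adjacent-left d M N a
      adj false {x} {y} a = adjacent-≗ {B′ = flip (sumRel d M N)} (sum-flip d M N) {x * 2} {y * 2} (SumRel.adjacent-left (not d) (flip M) (flip N) a)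

  side-iso : ∀ d {X X′ Y Y′} → IsoR X X′ → IsoR Y Y′ → IsoR (side d X Y) (side d X′ Y′)
  side-iso true i j = ⊕-iso i j
  side-iso false i j = ⊕-iso j i

  pres-insert : ∀ {X Ψ} → Stable Ψ → ∀ d → Pres X Ψ → Pres (side d one X) Ψ
  pres-insert st d (mkPres B p c i q) = mkPres (insertPt d B) (Insert.pun d B p) (Insert.conn d B c)
    (iso-trans {_} {side d one (ofRel B)} {_} (Insert.iso d B) (side-iso d iso-refl i)) (insert-stable st d c q)

  pres-sum : ∀ {X Y Ψ} → Stable Ψ → ∀ d → Pres X Ψ → Pres Y Neighbours → Pres (side d X Y) Ψ
  pres-sum st d (mkPres B p c i q) (mkPres B′ p′ c′ i′ q′) = mkPres (sumRel d B B′) (SumRel.pun d B B′ p p′) (SumRel.conn d B B′ c c′)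
    (iso-trans {_} {side d (ofRel B) (ofRel B′)} {_} (sum-iso d B B′) (side-iso d i i′)) (sum-stable st d c c′ q q′)

  -- Standard copies

  pres-flip : ∀ {X Ψ Φ} → (∀ {B} → Ψ B → Φ (flip B)) → Pres X Ψ → Pres (op X) Φ
  pres-flip {X} h (mkPres B p c (G , t , s , q) r) = mkPres (flip B) (app p (v1 ∷E v0 ∷E []E)) (flip-conn c)
    (G , t , s , λ {x} {y} {x′} {y′} g g′ → q {x′} {y′} {x} {y} g′ g) (h r)

  pres-om : Pres natL Neighbours
  pres-om = mkPres _<ᵇ_ (ltB v0 v1) (λ x y n → [ (λ l → inj₁ (<⇒ᵇ l)) , (λ l → inj₂ (<⇒ᵇ l)) ]′ (≢⇒< x y n))
    (iso-fun id (λ x → x , refl) (ᵇ⇒< , <⇒ᵇ))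
    ((suc , sucE v0 , λ x y (l , n) → fwd x y (ᵇ⇒< l) n) , (pred , predE v0 , λ x y (l , n) → cong pred (sym (fwd y x (ᵇ⇒< l) (λ {z} (p , q) → n {z} (q , p))))))
    where
    ≢⇒< : ∀ x y → x ≢ y → x < y ⊎ y < x
    ≢⇒< x y n with <-cmp x y
    ... | tri< l _ _ = inj₁ l
    ... | tri≈ _ e _ = ⊥-elim (n e)
    ... | tri> _ _ l = inj₂ l
    fwd : ∀ x y → x < y → (∀ {z} → ¬ ((x <ᵇ z) ≡ true × (z <ᵇ y) ≡ true)) → suc x ≡ y
    fwd x y l n with m≤n⇒m<n∨m≡n l
    ... | inj₁ h = ⊥-elim (n {suc x} (<⇒ᵇ {x} ≤-refl , <⇒ᵇ h))
    ... | inj₂ e = e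

  lexB : Bool → Bool → Bool → Bool
  lexB a b c = a ∨ (b ∧ c)

  lexB-true : ∀ {a b c} → lexB a b c ≡ true → a ≡ true ⊎ (b ≡ true × c ≡ true)
  lexB-true {true} h = inj₁ refl
  lexB-true {false} {true} h = inj₂ (refl , h)

  true-lexB : ∀ {a b c} → a ≡ true ⊎ (b ≡ true × c ≡ true) → lexB a b c ≡ true
  true-lexB (inj₁ refl) = refl
  true-lexB {true} (inj₂ (refl , refl)) = refl
  true-lexB {false} (inj₂ (refl , refl)) = refl

  div-at : ∀ k r q → r < suc k → (r + q * suc k) / suc k ≡ q
  div-at k r q l = trans (+-distrib-/-∣ʳ r {q * suc k} {suc k} (divides-refl q)) (cong₂ _+_ (m<n⇒m/n≡0 l) (m*n/n≡m q (suc k)))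

  mod-at : ∀ k r q → r < suc k → (r + q * suc k) % suc k ≡ r
  mod-at k r q l = trans ([m+kn]%n≡m%n r q (suc k)) (m<n⇒m%n≡m l)

  module EtaRel (k : ℕ) where
    abstract
      R : Rel
      R x y = lexB (Q (x / suc k) (y / suc k)) (x / suc k ≡ᵇ y / suc k) (x % suc k <ᵇ y % suc k)

      R→ : ∀ {x y} → R x y ≡ true → Q (x / suc k) (y / suc k) ≡ true ⊎ (x / suc k ≡ y / suc k × x % suc k < y % suc k)
      R→ {x} {y} h = [ inj₁ , (λ (p , q) → inj₂ (ᵇ⇒≡ p , ᵇ⇒< {x % suc k} q)) ]′ (lexB-true {Q (x / suc k) (y / suc k)} h)

      →R : ∀ {x y} → Q (x / suc k) (y / suc k) ≡ true ⊎ (x / suc k ≡ y / suc k × x % suc k < y % suc k) → R x y ≡ true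
      →R {x} {y} (inj₁ h) = true-lexB {Q (x / suc k) (y / suc k)} {x / suc k ≡ᵇ y / suc k} {x % suc k <ᵇ y % suc k} (inj₁ h)
      →R {x} {y} (inj₂ (p , q)) = true-lexB {Q (x / suc k) (y / suc k)}
        (inj₂ (subst (λ d → (x / suc k ≡ᵇ d) ≡ true) p (≡ᵇ-refl (x / suc k)) , <⇒ᵇ q))

      pun : B2 tt R
      pun = orB (app QE (divE k v0 ∷E divE k v1 ∷E []E)) (andB (eqB (divE k v0) (divE k v1)) (ltB (modE k v0) (modE k v1)))

    conn : Conn R
    conn x y n with x / suc k ≟ y / suc k
    ... | no m = [ (λ h → inj₁ (→R (inj₁ h))) , (λ h → inj₂ (→R (inj₁ h))) ]′ (proj₂ (proj₂ Q-linear) _ _ m)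
    ... | yes e with <-cmp (x % suc k) (y % suc k)
    ... | tri< l _ _ = inj₁ (→R (inj₂ (e , l)))
    ... | tri> _ _ l = inj₂ (→R (inj₂ (sym e , l)))
    ... | tri≈ _ e′ _ = ⊥-elim (n (trans (m≡m%n+[m/n]*n x (suc k)) (trans (cong₂ (λ a b → a + b * suc k) e′ e) (sym (m≡m%n+[m/n]*n y (suc k))))))

    -- `Q` is dense, so adjacent elements lie in the same block: between different blocks there is
    -- the first element z * (k + 1) of an intermediate one. Inside a block the order is that of the
    -- remainders.
    adjacent-suc : ∀ x y → Adjacent R x y → suc x ≡ y
    adjacent-suc x y (l , n) with R→ l
    ... | inj₁ h = let (z , p , q) = Q-between _ _ h in
      ⊥-elim (n {z * suc k} (→R (inj₁ (subst (λ w → Q (x / suc k) w ≡ true) (sym (m*n/n≡m z (suc k))) p)) ,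
                             →R (inj₁ (subst (λ w → Q w (y / suc k) ≡ true) (sym (m*n/n≡m z (suc k))) q))))
    ... | inj₂ (e , h) with m≤n⇒m<n∨m≡n h
    ... | inj₂ e′ = trans (cong suc (m≡m%n+[m/n]*n x (suc k)))
      (trans (cong₂ (λ a b → a + b * suc k) e′ e) (sym (m≡m%n+[m/n]*n y (suc k))))
    ... | inj₁ h′ = ⊥-elim (n {z} (→R (inj₂ (sym zd , subst (x % suc k <_) (sym zm) ≤-refl)) ,
                                   →R (inj₂ (trans zd e , subst (_< y % suc k) (sym zm) h′))))
      where
      z = suc (x % suc k) + x / suc k * suc k
      zl : suc (x % suc k) < suc k
      zl = <-trans h′ (m%n<n y (suc k))
      zd : z / suc k ≡ x / suc k
      zd = div-at k (suc (x % suc k)) (x / suc k) zl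
      zm : z % suc k ≡ suc (x % suc k)
      zm = mod-at k (suc (x % suc k)) (x / suc k) zl

    code : ℕ × Fin (suc k) → ℕ
    code (q , i) = toℕ i + q * suc k

    code-/ : ∀ c → code c / suc k ≡ proj₁ c
    code-/ (q , i) = div-at k (toℕ i) q (toℕ<n i)

    code-% : ∀ c → code c % suc k ≡ toℕ (proj₂ c)
    code-% (q , i) = mod-at k (toℕ i) q (toℕ<n i)

    iso : IsoR (ofRel R) (QL ⊗ finL (suc k))
    iso = coded-iso {QL ⊗ finL (suc k)} code
      (λ x → (x / suc k , fromℕ< (m%n<n x (suc k))) , trans (cong (_+ x / suc k * suc k) (toℕ-fromℕ< _)) (sym (m≡m%n+[m/n]*n x (suc k))))
      λ c c′ → to c c′ , from c c′
      where
      to : ∀ c c′ → R (code c) (code c′) ≡ true → LexLt QL (finL (suc k)) c c′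
      to c c′ h with R→ h
      ... | inj₁ l = inj₁ (trans (sym (cong₂ Q (code-/ c) (code-/ c′))) l)
      ... | inj₂ (e , l) with trans (sym (code-/ c)) (trans e (code-/ c′))
      ... | refl = inj₂ (irr QL-isLO {proj₁ c} , irr QL-isLO {proj₁ c} , subst (_< toℕ (proj₂ c′)) (code-% c) (subst (code c % suc k <_) (code-% c′) l))
      from : ∀ c c′ → LexLt QL (finL (suc k)) c c′ → R (code c) (code c′) ≡ true
      from c c′ (inj₁ l) = →R (inj₁ (trans (cong₂ Q (code-/ c) (code-/ c′)) l))
      from c c′ (inj₂ (n , m , l)) with proj₁ c ≟ proj₁ c′
      ... | no ne = ⊥-elim ([ n , m ]′ (proj₂ (proj₂ Q-linear) _ _ ne))
      ... | yes refl = →R (inj₂ (trans (code-/ c) (sym (code-/ c′)) , subst (_< code c′ % suc k) (sym (code-% c)) (subst (toℕ (proj₂ c) <_) (sym (code-% c′)) l)))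

    neighbours : Neighbours R
    neighbours = (suc , sucE v0 , adjacent-suc) , (pred , predE v0 , λ x y (l , n) →
      cong pred (sym (adjacent-suc y x (l , λ {z} (p , q) → n {z} (q , p)))))

  standard : ∀ p → p ≢ pt → Pres (T p) Neighbours
  standard pt n = ⊥-elim (n refl)
  standard om n = pres-om
  standard mo n = pres-flip {natL} {Neighbours} {Neighbours} swap pres-om
  standard (eta k) n = mkPres R pun conn iso neighbours
    where open EtaRel k

  pres-side : ∀ {X Ψ} → Stable Ψ → ∀ d p → Pres X Ψ → Pres (side d X (T p)) Ψ
  pres-side st true pt P = pres-insert st false P
  pres-side st false pt P = pres-insert st true P
  pres-side st d om P = pres-sum st d P (standard om λ ())
  pres-side st d mo P = pres-sum st d P (standard mo λ ())
  pres-side st d (eta k) P = pres-sum st d P (standard (eta k) λ ())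

  pres-after : ∀ {X Ψ} → Stable Ψ → ∀ σ → Pres X Ψ → Pres (X ⊕ Ts σ) Ψ
  pres-after st [] P = pres-iso (iso-flip ⊕-none) P
  pres-after {X} st (p ∷ σ) P = pres-iso (⊕-assoc {X} {T p} {Ts σ}) (pres-after st σ (pres-side st true p P))

  -- The sum is built outwards from the distinguished piece p, because `Stable` asks for Ψ of the
  -- starting copy and for `Neighbours` of the summands added to it.
  pres-list : ∀ {Ψ p} → Stable Ψ → Pres (T p) Ψ → ∀ {σ} → p ∈ σ → Pres (Ts σ) Ψ
  pres-list st P {_ ∷ σ} (here refl) = pres-after st σ P
  pres-list st P {q ∷ σ} (there i) = pres-side st false q (pres-list st P i)

  -- Arithmetic of sums and products of orders

  ⊗-distrib : ∀ {X Y Z} → IsoR ((X ⊕ Y) ⊗ Z) ((X ⊗ Z) ⊕ (Y ⊗ Z))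
  ⊗-distrib {X} {Y} {Z} = iso-fun f (λ { (inj₁ (x , z)) → (inj₁ x , z) , refl ; (inj₂ (y , z)) → (inj₂ y , z) , refl })
    λ {a} {b} → to a b , from a b
    where
    f : (C X ⊎ C Y) × C Z → (C X × C Z) ⊎ (C Y × C Z)
    f (inj₁ x , z) = inj₁ (x , z)
    f (inj₂ y , z) = inj₂ (y , z)
    to : ∀ a b → LexLt (X ⊕ Y) Z a b → SumLt (X ⊗ Z) (Y ⊗ Z) (f a) (f b)
    to (inj₁ _ , _) (inj₁ _ , _) (inj₁ (ll h)) = ll (inj₁ h)
    to (inj₁ _ , _) (inj₁ _ , _) (inj₂ (n , m , h)) = ll (inj₂ (n ∘ ll , m ∘ ll , h))
    to (inj₁ _ , _) (inj₂ _ , _) h = lr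
    to (inj₂ _ , _) (inj₁ _ , _) (inj₂ (n , m , h)) = ⊥-elim (m lr)
    to (inj₂ _ , _) (inj₂ _ , _) (inj₁ (rr h)) = rr (inj₁ h)
    to (inj₂ _ , _) (inj₂ _ , _) (inj₂ (n , m , h)) = rr (inj₂ (n ∘ rr , m ∘ rr , h))
    from : ∀ a b → SumLt (X ⊗ Z) (Y ⊗ Z) (f a) (f b) → LexLt (X ⊕ Y) Z a b
    from (inj₁ _ , _) (inj₁ _ , _) (ll (inj₁ h)) = inj₁ (ll h)
    from (inj₁ _ , _) (inj₁ _ , _) (ll (inj₂ (n , m , h))) = inj₂ (n ∘ unll , m ∘ unll , h)
    from (inj₁ _ , _) (inj₂ _ , _) h = inj₁ lr
    from (inj₂ _ , _) (inj₁ _ , _) ()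
    from (inj₂ _ , _) (inj₂ _ , _) (rr (inj₁ h)) = inj₁ (rr h)
    from (inj₂ _ , _) (inj₂ _ , _) (rr (inj₂ (n , m , h))) = inj₂ (n ∘ unrr , m ∘ unrr , h)

  ⊗-assoc : ∀ {X Y Z} → IsoR (X ⊗ (Y ⊗ Z)) ((X ⊗ Y) ⊗ Z)
  ⊗-assoc = iso-fun (λ (x , y , z) → (x , y) , z) (λ ((x , y) , z) → (x , y , z) , refl)
    ((λ { (inj₁ h) → inj₁ (inj₁ h)
        ; (inj₂ (n , m , inj₁ h)) → inj₁ (inj₂ (n , m , h))
        ; (inj₂ (n , m , inj₂ (n′ , m′ , h))) → inj₂ ([ n , (λ (_ , _ , k) → n′ k) ]′ , [ m , (λ (_ , _ , k) → m′ k) ]′ , h) }) ,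
     λ { (inj₁ (inj₁ h)) → inj₁ h
       ; (inj₁ (inj₂ (n , m , h))) → inj₂ (n , m , inj₁ h)
       ; (inj₂ (n , m , h)) → inj₂ (n ∘ inj₁ , m ∘ inj₁ ,
           inj₂ ((λ k → n (inj₂ (n ∘ inj₁ , m ∘ inj₁ , k))) , (λ k → m (inj₂ (m ∘ inj₁ , n ∘ inj₁ , k))) , h)) })

  one-⊗ : ∀ {X} → IsoR (one ⊗ X) X
  one-⊗ = iso-fun proj₂ (λ x → (tt , x) , refl) ((λ { (inj₁ ()) ; (inj₂ (_ , _ , h)) → h }) , λ h → inj₂ ((λ ()) , (λ ()) , h))

  finL-suc : ∀ {k} → IsoR (one ⊕ finL k) (finL (suc k))
  finL-suc {k} = iso-fun f (λ { zero → inj₁ tt , refl ; (suc i) → inj₂ i , refl }) λ {a} {b} → to a b , from a b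
    where
    f : ⊤ ⊎ Fin k → Fin (suc k)
    f (inj₁ _) = zero
    f (inj₂ i) = suc i
    to : ∀ a b → SumLt one (finL k) a b → toℕ (f a) < toℕ (f b)
    to _ _ (ll ())
    to _ _ lr = s≤s z≤n
    to _ _ (rr h) = s≤s h
    from : ∀ a b → toℕ (f a) < toℕ (f b) → SumLt one (finL k) a b
    from (inj₁ _) (inj₁ _) ()
    from (inj₁ _) (inj₂ _) h = lr
    from (inj₂ _) (inj₁ _) ()
    from (inj₂ _) (inj₂ _) (s≤s h) = rr h

  finL-zero : IsoR none (finL 0)
  finL-zero = iso-fun (λ ()) (λ ()) λ {}

  -- The last point of copy n becomes the first point of copy n + 1, and the separate leading point
  -- starts copy 0.
  rotate : ∀ {Z} → IsoR (one ⊕ natL ⊗ (Z ⊕ one)) (natL ⊗ (one ⊕ Z))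
  rotate {Z} = iso-fun f
    (λ { (zero , inj₁ _) → inj₁ tt , refl ; (suc n , inj₁ _) → inj₂ (n , inj₂ tt) , refl ; (n , inj₂ z) → inj₂ (n , inj₁ z) , refl })
    λ {a} {b} → to a b , from a b
    where
    f : ⊤ ⊎ ℕ × (C Z ⊎ ⊤) → ℕ × (⊤ ⊎ C Z)
    f (inj₁ _) = 0 , inj₁ tt
    f (inj₂ (n , inj₁ z)) = n , inj₂ z
    f (inj₂ (n , inj₂ _)) = suc n , inj₁ tt
    lex-≤ : ∀ {n m} {x y : ⊤ ⊎ C Z} → n ≤ m → SumLt one Z x y → LexLt natL (one ⊕ Z) (n , x) (m , y)
    lex-≤ l h with m≤n⇒m<n∨m≡n l
    ... | inj₁ k = inj₁ k
    ... | inj₂ refl = inj₂ (<-irrefl refl , <-irrefl refl , h)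
    to : ∀ a b → SumLt one (natL ⊗ (Z ⊕ one)) a b → LexLt natL (one ⊕ Z) (f a) (f b)
    to (inj₁ _) (inj₁ _) (ll ())
    to (inj₁ _) (inj₂ (n , inj₁ z)) h = lex-≤ z≤n lr
    to (inj₁ _) (inj₂ (n , inj₂ _)) h = inj₁ (s≤s z≤n)
    to (inj₂ _) (inj₁ _) ()
    to (inj₂ (n , inj₁ z)) (inj₂ (m , inj₁ w)) (rr (inj₁ l)) = inj₁ l
    to (inj₂ (n , inj₁ z)) (inj₂ (m , inj₁ w)) (rr (inj₂ (p , q , h))) = inj₂ (p , q , rr (unll h))
    to (inj₂ (n , inj₁ z)) (inj₂ (m , inj₂ _)) (rr (inj₁ l)) = inj₁ (m<n⇒m<1+n l)
    to (inj₂ (n , inj₁ z)) (inj₂ (m , inj₂ _)) (rr (inj₂ (p , q , h))) = inj₁ (s≤s (≮⇒≥ q))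
    to (inj₂ (n , inj₂ _)) (inj₂ (m , inj₁ w)) (rr (inj₁ l)) = lex-≤ l lr
    to (inj₂ (n , inj₂ _)) (inj₂ (m , inj₁ w)) (rr (inj₂ (_ , _ , ())))
    to (inj₂ (n , inj₂ _)) (inj₂ (m , inj₂ _)) (rr (inj₁ l)) = inj₁ (s≤s l)
    to (inj₂ (n , inj₂ _)) (inj₂ (m , inj₂ _)) (rr (inj₂ (_ , _ , rr ())))
    from : ∀ a b → LexLt natL (one ⊕ Z) (f a) (f b) → SumLt one (natL ⊗ (Z ⊕ one)) a b
    from (inj₁ _) (inj₁ _) (inj₁ ())
    from (inj₁ _) (inj₁ _) (inj₂ (_ , _ , ll ()))
    from (inj₁ _) (inj₂ _) h = lr
    from (inj₂ (n , inj₁ z)) (inj₁ _) (inj₁ ())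
    from (inj₂ (n , inj₁ z)) (inj₁ _) (inj₂ (_ , _ , ()))
    from (inj₂ (n , inj₂ _)) (inj₁ _) (inj₁ ())
    from (inj₂ (n , inj₂ _)) (inj₁ _) (inj₂ (_ , q , _)) = ⊥-elim (q (s≤s z≤n))
    from (inj₂ (n , inj₁ z)) (inj₂ (m , inj₁ w)) (inj₁ l) = rr (inj₁ l)
    from (inj₂ (n , inj₁ z)) (inj₂ (m , inj₁ w)) (inj₂ (p , q , h)) = rr (inj₂ (p , q , ll (unrr h)))
    from (inj₂ (n , inj₁ z)) (inj₂ (m , inj₂ _)) (inj₁ (s≤s l)) with m≤n⇒m<n∨m≡n l
    ... | inj₁ k = rr (inj₁ k)
    ... | inj₂ refl = rr (inj₂ (<-irrefl refl , <-irrefl refl , lr))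
    from (inj₂ (n , inj₁ z)) (inj₂ (m , inj₂ _)) (inj₂ (_ , _ , ()))
    from (inj₂ (n , inj₂ _)) (inj₂ (m , inj₁ w)) (inj₁ l) = rr (inj₁ (<-trans ≤-refl l))
    from (inj₂ (n , inj₂ _)) (inj₂ (m , inj₁ w)) (inj₂ (p , q , h)) = rr (inj₁ (≮⇒≥ q))
    from (inj₂ (n , inj₂ _)) (inj₂ (m , inj₂ _)) (inj₁ (s≤s l)) = rr (inj₁ l)
    from (inj₂ (n , inj₂ _)) (inj₂ (m , inj₂ _)) (inj₂ (_ , _ , ll ()))

  natL-isLO : IsLO natL
  natL-isLO = mkIsLO (<-irrefl refl) <-trans λ {x} {z} h y → case x <? y of λ
    { (yes l) → inj₁ l ; (no n) → inj₂ (≤-<-trans (≮⇒≥ n) h) }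

  ⊕-countable : ∀ {X Y} → Countable X → Countable Y → Countable (X ⊕ Y)
  ⊕-countable {X} {Y} (e , h) (e′ , h′) = d , λ
    { (inj₁ x) → let (n , x′ , p , q , r) = h x in pair 0 n , inj₁ x′ , at-pair 0 n (inj₁ x′) (cong (Data.Maybe.map inj₁) p) , q ∘ unll , r ∘ unll
    ; (inj₂ y) → let (n , y′ , p , q , r) = h′ y in pair 1 n , inj₂ y′ , at-pair 1 n (inj₂ y′) (cong (Data.Maybe.map inj₂) p) , q ∘ unrr , r ∘ unrr }
    where
    g : ℕ → ℕ → Maybe (C X ⊎ C Y)
    g zero n = Data.Maybe.map inj₁ (e n)
    g (suc _) n = Data.Maybe.map inj₂ (e′ n)
    d : ℕ → Maybe (C X ⊎ C Y)
    d n = g (π₁ n) (π₂ n)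
    at-pair : ∀ a n z → g a n ≡ just z → d (pair a n) ≡ just z
    at-pair a n z p = trans (cong₂ g (π₁-pair a n) (π₂-pair a n)) p

  natL-⊗-countable : ∀ {X} → Countable X → Countable (natL ⊗ X)
  natL-⊗-countable {X} (e , h) = d , λ (m , x) → let (n , x′ , p , q , r) = h x in pair m n , (m , x′) ,
    trans (cong₂ g (π₁-pair m n) (π₂-pair m n)) (cong (Data.Maybe.map (m ,_)) p) ,
    [ <-irrefl refl , (λ (_ , _ , k) → q k) ]′ , [ <-irrefl refl , (λ (_ , _ , k) → r k) ]′
    where
    g : ℕ → ℕ → Maybe (ℕ × C X)
    g m n = Data.Maybe.map (m ,_) (e n)
    d : ℕ → Maybe (ℕ × C X)
    d n = g (π₁ n) (π₂ n)

  -- By Cantor's theorem: each separate point has a copy of `Q` directly before and directly after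
  -- it, so it is a limit from both sides, and the sum has no ends.
  absorb : IsoR (QL ⊕ natL ⊗ (one ⊕ QL)) QL
  absorb = cantor (⊕-isLO QL-isLO (⊗-isLO natL-isLO (⊕-isLO one-isLO QL-isLO))) QL-isLO
    (⊕-countable Q-countable (natL-⊗-countable (⊕-countable ((λ _ → just tt) , λ _ → 0 , tt , refl , id , id) Q-countable)))
    Q-countable (inj₁ 0) 0 limit Q-limit
    where
    S = QL ⊕ natL ⊗ (one ⊕ QL)
    same : ∀ {n} {x y} → SumLt one QL x y → LexLt natL (one ⊕ QL) (n , x) (n , y)
    same h = inj₂ (<-irrefl refl , <-irrefl refl , h)
    limit : ∀ x → Limit-point S x
    limit (inj₁ q) with Q-limit q
    ... | (a , ha) , (b , hb) , l , u = (inj₁ a , ll ha) , (inj₁ b , ll hb) ,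
      (λ { (inj₁ y) (ll h) → let (z , p , r) = l y h in inj₁ z , ll p , ll r }) ,
      λ { (inj₁ y) (ll h) → let (z , p , r) = u y h in inj₁ z , ll p , ll r ; (inj₂ y) h → inj₁ b , ll hb , lr }
    limit (inj₂ (n , inj₂ q)) with Q-limit q
    ... | (a , ha) , (b , hb) , l , u = (inj₂ (n , inj₂ a) , rr (same (rr ha))) , (inj₂ (n , inj₂ b) , rr (same (rr hb))) ,
      (λ { (inj₁ y) h → inj₂ (n , inj₂ a) , lr , rr (same (rr ha))
         ; (inj₂ (m , y)) (rr (inj₁ h)) → inj₂ (n , inj₂ a) , rr (inj₁ h) , rr (same (rr ha))
         ; (inj₂ (m , inj₁ y)) (rr (inj₂ (p , r , h))) → inj₂ (n , inj₂ a) , rr (inj₂ (p , r , lr)) , rr (same (rr ha))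
         ; (inj₂ (m , inj₂ y)) (rr (inj₂ (p , r , rr h))) → let (z , s , t) = l y h in inj₂ (n , inj₂ z) , rr (inj₂ (p , r , rr s)) , rr (same (rr t)) }) ,
      λ { (inj₂ (m , y)) (rr (inj₁ h)) → inj₂ (n , inj₂ b) , rr (same (rr hb)) , rr (inj₁ h)
        ; (inj₂ (m , inj₂ y)) (rr (inj₂ (p , r , rr h))) → let (z , s , t) = u y h in inj₂ (n , inj₂ z) , rr (same (rr s)) , rr (inj₂ (p , r , rr t)) }
    limit (inj₂ (n , inj₁ _)) = before n , (inj₂ (n , inj₂ 0) , rr (same lr)) , below n ,
      λ { (inj₂ (m , y)) (rr (inj₁ h)) → inj₂ (n , inj₂ 0) , rr (same lr) , rr (inj₁ h)
        ; (inj₂ (m , inj₁ y)) (rr (inj₂ (p , r , ll ())))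
        ; (inj₂ (m , inj₂ y)) (rr (inj₂ (p , r , h))) → let ((z , s) , _) = Q-limit y in inj₂ (n , inj₂ z) , rr (same lr) , rr (inj₂ (p , r , rr s)) }
      where
      before : ∀ n → ∃ λ z → lt S z (inj₂ (n , inj₁ tt))
      before n = inj₁ 0 , lr
      below : ∀ n y → lt S y (inj₂ (n , inj₁ tt)) → ∃ λ z → lt S y z × lt S z (inj₂ (n , inj₁ tt))
      below n (inj₁ y) h = let (_ , (b , hb) , _) = Q-limit y in inj₁ b , ll hb , lr
      below n (inj₂ (m , inj₁ y)) (rr (inj₁ h)) = inj₂ (m , inj₂ 0) , rr (same lr) , rr (inj₁ h)
      below n (inj₂ (m , inj₂ y)) (rr (inj₁ h)) = let (_ , (b , hb) , _) = Q-limit y in inj₂ (m , inj₂ b) , rr (same (rr hb)) , rr (inj₁ h)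
      below n (inj₂ (m , inj₁ y)) (rr (inj₂ (p , r , ll ())))

  -- Coding copies

  double≢suc-double : ∀ m k → m * 2 ≢ suc (k * 2)
  double≢suc-double m k e = even≢odd m k (trans (*-comm 2 m) (trans e (cong suc (*-comm k 2))))

  -- A copy of ω: elements are ordered by (key, index).  The even number 2n is a marker; each change of the
  -- guess F n inserts one odd element just below the marker 2n + 2, all other odd elements are fillers.
  module Coded (f : ℕ → ℕ) (F : ℕ → ℕ → ℕ) (FE : F2 tt F) (lim : ∀ n → Eventually (λ s → F n s ≡ f n)) where

    change : ℕ → ℕ → Bool
    change n t = not (F n t ≡ᵇ F n (suc t))

    -- Markers have odd keys, all other elements even ones. The marker 2n has key 2n + 1, so the key
    -- 2n + 2 of a witness lies between those of the markers 2n and 2n + 2.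
    oddKey : ℕ → ℕ → ℕ
    oddKey s c = if change (π₁ c) (π₂ c) then 2 + π₁ c * 2 else s * 2

    key : ℕ → ℕ
    key s = if s % 2 ≡ᵇ 0 then suc s else oddKey s (s / 2)

    abstract
      W : Rel
      W x y = lexB (key x <ᵇ key y) (key x ≡ᵇ key y) (x <ᵇ y)

      W→ : ∀ {x y} → W x y ≡ true → key x < key y ⊎ (key x ≡ key y × x < y)
      W→ {x} {y} h = [ inj₁ ∘ ᵇ⇒< {key x} , (λ (p , q) → inj₂ (ᵇ⇒≡ p , ᵇ⇒< {x} q)) ]′ (lexB-true {key x <ᵇ key y} h)

      →W : ∀ {x y} → key x < key y ⊎ (key x ≡ key y × x < y) → W x y ≡ true
      →W {x} {y} (inj₁ h) = true-lexB {key x <ᵇ key y} {key x ≡ᵇ key y} {x <ᵇ y} (inj₁ (<⇒ᵇ h))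
      →W {x} {y} (inj₂ (p , q)) = true-lexB {key x <ᵇ key y} (inj₂ (subst (λ d → (key x ≡ᵇ d) ≡ true) p (≡ᵇ-refl (key x)) , <⇒ᵇ q))

      pun : B2 tt W
      pun = orB (ltB (keyE v0) (keyE v1)) (andB (eqB (keyE v0) (keyE v1)) (ltB v0 v1))
        where
        keyE : ∀ {n e} → E tt n e → E tt n (λ xs → key (e xs))
        keyE x = app1 key (ifE (eqB (modE 1 v0) (cst 0)) (sucE v0)
          (ifE (notB (eqB (app2 F FE (π₁E (divE 1 v0)) (π₂E (divE 1 v0))) (app2 F FE (π₁E (divE 1 v0)) (sucE (π₂E (divE 1 v0))))))
            (sucE (sucE (π₁E (divE 1 v0) *E cst 2))) (v0 *E cst 2))) x

    linear : IsLinearOrder W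
    linear = (λ x → ¬true⇒false λ h → [ <-irrefl refl , (λ (_ , l) → <-irrefl refl l) ]′ (W→ h)) , tr′ , cn
      where
      tr′ : ∀ x y z → W x y ≡ true → W y z ≡ true → W x z ≡ true
      tr′ x y z h k with W→ {x} {y} h | W→ {y} {z} k
      ... | inj₁ a | inj₁ b = →W (inj₁ (<-trans a b))
      ... | inj₁ a | inj₂ (b , _) = →W (inj₁ (subst (key x <_) b a))
      ... | inj₂ (a , _) | inj₁ b = →W (inj₁ (subst (_< key z) (sym a) b))
      ... | inj₂ (a , l) | inj₂ (b , m) = →W (inj₂ (trans a b , <-trans l m))
      cn : ∀ x y → x ≢ y → W x y ≡ true ⊎ W y x ≡ true
      cn x y n with <-cmp (key x) (key y) | <-cmp x y
      ... | tri< l _ _ | _ = inj₁ (→W (inj₁ l))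
      ... | tri> _ _ l | _ = inj₂ (→W (inj₁ l))
      ... | tri≈ _ e _ | tri< l _ _ = inj₁ (→W (inj₂ (e , l)))
      ... | tri≈ _ e _ | tri> _ _ l = inj₂ (→W (inj₂ (sym e , l)))
      ... | tri≈ _ e _ | tri≈ _ e′ _ = ⊥-elim (n e′)

    key-even : ∀ n → key (n * 2) ≡ suc (n * 2)
    key-even n rewrite m*n%n≡0 n 2 ⦃ _ ⦄ = refl

    key-odd : ∀ c → key (suc (c * 2)) ≡ oddKey (suc (c * 2)) c
    key-odd c rewrite [m+kn]%n≡m%n 1 c 2 ⦃ _ ⦄ = cong (oddKey (suc (c * 2))) (odd-/ c)

    witness : ℕ → ℕ → ℕ
    witness n t = suc (pair n t * 2)

    key-witness : ∀ n t → change n t ≡ true → key (witness n t) ≡ 2 + n * 2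
    key-witness n t h = trans (key-odd (pair n t))
      (trans (cong (λ b → if b then 2 + π₁ (pair n t) * 2 else witness n t * 2) (trans (cong₂ change (π₁-pair n t) (π₂-pair n t)) h))
        (cong (λ m → 2 + m * 2) (π₁-pair n t)))

    key-cases : ∀ y → (∃ λ n → y ≡ n * 2 × key y ≡ suc y) ⊎ (key y ≡ y * 2) ⊎
      (∃ λ n → ∃ λ t → change n t ≡ true × y ≡ witness n t × key y ≡ 2 + n * 2)
    key-cases y with dec y in e | enc-dec y
    ... | inj₁ n | refl = inj₁ (n , refl , key-even n)
    ... | inj₂ c | refl with change (π₁ c) (π₂ c) in h
    ... | true = inj₂ (inj₂ (π₁ c , π₂ c , h , cong (λ m → suc (m * 2)) (sym (pair-π c)) ,
        trans (key-odd c) (cong (λ b → if b then 2 + π₁ c * 2 else suc (c * 2) * 2) h)))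
    ... | false = inj₂ (inj₁ (trans (key-odd c) (cong (λ b → if b then 2 + π₁ c * 2 else suc (c * 2) * 2) h)))

    changes-bounded : ∀ n → ∃ λ T → ∀ t → change n t ≡ true → t < T
    changes-bounded n with lim n
    ... | T , h = T , λ t c → ≰⇒> λ l → true≢false c (cong not (trans (cong₂ _≡ᵇ_ (h t l) (h (suc t) (m≤n⇒m≤1+n l))) (≡ᵇ-refl (f n))))

    witnesses-bounded : ∀ K → ∃ λ M → ∀ n → n < K → ∀ t → change n t ≡ true → witness n t < M
    witnesses-bounded K = bound-below (λ n M → ∀ t → change n t ≡ true → witness n t < M)
      (λ l h t c → <-≤-trans (h t c) l) K λ n _ →
        let (T , h) = changes-bounded n
            (M , b) = bound-below (λ t M → witness n t < M) (λ l h → <-≤-trans h l) T (λ t _ → suc (witness n t) , ≤-refl)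
        in M , λ t c → b t (h t c)

    -- A marker or filler is no larger than its key, and the witnesses with key 2n + 2 correspond to
    -- the changes of the guess at n, of which convergence leaves finitely many. This keeps the
    -- order type at ω.
    keys-finite : ∀ K → ∃ λ M → ∀ y → key y ≤ K → y < M
    keys-finite K with witnesses-bounded (suc K)
    ... | M , h = suc K ⊔ M , λ y l → bound y l (key-cases y)
      where
      bound : ∀ y → key y ≤ K → _ → y < suc K ⊔ M
      bound y l (inj₁ (n , _ , e)) = <-≤-trans (s≤s (≤-trans (n≤1+n y) (subst (_≤ K) e l))) (m≤m⊔n (suc K) M)
      bound y l (inj₂ (inj₁ e)) = <-≤-trans (s≤s (≤-trans (m≤m*n y 2) (subst (_≤ K) e l))) (m≤m⊔n (suc K) M)
      bound y l (inj₂ (inj₂ (n , t , c , refl , e))) = <-≤-trans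
        (h n (s≤s (≤-trans (m≤m*n n 2) (≤-trans (m≤n+m (n * 2) 2) (subst (_≤ K) e l)))) t c) (m≤n⊔m (suc K) M)

    open Ends W linear

    remove : ∀ {P : ℕ → Set} m k → Ch P (suc k) → Ch (λ y → P y × y ≢ m) k
    remove m zero c = tt
    remove m (suc k) (x , p , c) with x ≟ m
    ... | yes refl = ch-map (suc k) (λ (q , l) → q , λ { refl → ≺-irr l }) c
    ... | no n = x , (p , n) , ch-map k (λ ((a , b) , d) → (a , d) , b) (remove m k c)

    bounded-small : ∀ M {P : ℕ → Set} → (∀ {y} → P y → y < M) → ¬ Ch P (suc M)
    bounded-small zero h (x , p , _) = case h p of λ ()
    bounded-small (suc M) h c = bounded-small M (λ (p , n) → ≤∧≢⇒< (≤-pred (h p)) n) (remove M (suc M) c)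

    markers : ∀ k → Ch ((λ _ → ⊤) ↓ (k * 2)) k
    markers zero = tt
    markers (suc k) = ch-below k (→W (inj₁ (subst (_< key (suc k * 2)) (sym (key-even k))
      (subst (suc (k * 2) <_) (sym (key-even (suc k))) (s≤s (n≤1+n _)))))) tt (markers k)

    iso : IsoR (ofRel W) natL
    iso = iso-trans {_} {XL (λ _ → ⊤)} {_} (iso-fun (λ x → x , tt) (λ (x , _) → x , refl) (id , id))
      (omega (λ {x} _ → let (M , h) = keys-finite (key x) in suc M , bounded-small M λ {y} (_ , l) →
          h y ([ <⇒≤ , (λ (e , _) → ≤-reflexive e) ]′ (W→ l)))
        λ k → k * 2 , tt , markers k)

    pred-exists : ∀ {x₀ x} → x₀ ≺ x → ∃ λ c → Adjacent W c x
    pred-exists {x₀} {x} l with iso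
    ... | G , tot , sur , p with tot x₀ | tot x
    ... | n₀ , g₀ | zero , g = case proj₁ (p g₀ g) l of λ ()
    ... | n₀ , g₀ | suc n , g with sur n
    ... | c , h = c , proj₂ (p h g) ≤-refl , λ {z} (a , b) →
      let (m , k) = tot z in <-irrefl refl (<-≤-trans (proj₁ (p h k) a) (≤-pred (proj₁ (p k g) b)))

    -- The index c of the predecessor of the marker 2n + 2 bounds every t at which the guess at n
    -- changes, so the guess is constant from stage c + 1 on.
    codes : ∃ λ b → ∃ λ e → F1 tt b × F2 tt e × (∀ n → ∃ λ c → Adjacent W c (b n) × e n c ≡ f n)
    codes = (λ n → suc n * 2) , (λ n c → F n (suc c)) , sucE v0 *E cst 2 , app2 F FE v0 (sucE v1) , λ n →
      let (c , a) = pred-exists {0} {suc n * 2} (→W (inj₁ (subst (1 <_) (sym (key-even (suc n))) (s≤s (s≤s z≤n)))))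
      in c , a , value n c a
      where
      -- All witnesses for n have the key directly below that of the marker. Being the greatest
      -- element below the marker, c has the largest index with this key, and the index of a witness
      -- is at least t by the pairing.
      below-witness : ∀ n c → Adjacent W c (suc n * 2) → ∀ t → change n t ≡ true → t ≤ c
      below-witness n c (l , e) t h with lem (c ≺ witness n t)
      ... | yes k = ⊥-elim (e {witness n t} (k , →W (inj₁ (subst (key (witness n t) <_) (sym (key-even (suc n)))
            (subst (_< 3 + n * 2) (sym (key-witness n t h)) ≤-refl)))))
      ... | no k = ≤-trans (≤-trans (n≤pair n t) (≤-trans (m≤m*n (pair n t) 2) (n≤1+n _))) (≮⇒≥ λ q → k (→W (inj₂ (same q , q))))
        where
        c<b : key c < key (suc n * 2) ⊎ (key c ≡ key (suc n * 2) × c < suc n * 2)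
        c<b = W→ l
        not-marker : key c ≢ 3 + n * 2
        not-marker e′ with key-cases c
        ... | inj₂ (inj₁ q) = double≢suc-double c (suc n) (trans (sym q) e′)
        ... | inj₂ (inj₂ (m , _ , _ , _ , q)) = double≢suc-double (suc m) (suc n) (trans (sym q) e′)
        ... | inj₁ (_ , _ , q) = ≺-irr (subst (_≺ suc n * 2) (suc-injective (trans (sym q) e′)) l)
        key-c : key c < 3 + n * 2
        key-c = [ subst (key c <_) (key-even (suc n)) , (λ (e′ , _) → ⊥-elim (not-marker (trans e′ (key-even (suc n))))) ]′ c<b
        same : c < witness n t → key c ≡ key (witness n t)
        same q with m≤n⇒m<n∨m≡n (≤-pred key-c)
        ... | inj₁ k′ = ⊥-elim (k (→W (inj₁ (subst (key c <_) (sym (key-witness n t h)) k′))))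
        ... | inj₂ e′ = trans e′ (sym (key-witness n t h))
      value : ∀ n c → Adjacent W c (suc n * 2) → F n (suc c) ≡ f n
      value n c a with lim n
      ... | T , h = trans (sym (const T)) (h (T + suc c) (m≤m+n T (suc c)))
        where
        stays : ∀ t → suc c ≤ t → F n t ≡ F n (suc t)
        stays t l with F n t ≡ᵇ F n (suc t) in e
        ... | true = ᵇ⇒≡ e
        ... | false = ⊥-elim (<-irrefl refl (<-≤-trans l (below-witness n c a t (cong not e))))
        const : ∀ d → F n (d + suc c) ≡ F n (suc c)
        const zero = refl
        const (suc d) = trans (sym (stays (d + suc c) (m≤n+m (suc c) d))) (const d)

    coded-om : Pres natL (Codes f)
    coded-om = mkPres W pun (proj₂ (proj₂ linear)) iso (true , codes)

    coded-mo : Pres (op natL) (Codes f)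
    coded-mo = pres-flip {natL} {λ B → ∃ λ b → ∃ λ e → F1 tt b × F2 tt e × (∀ n → ∃ λ c → Adjacent B c (b n) × e n c ≡ f n)}
      (λ q → false , q) (mkPres W pun (proj₂ (proj₂ linear)) iso codes)

    -- Each point of W is replaced by a copy of U. As U has a least point a and a greatest point e,
    -- adjacent points c and x of W give the adjacent points (c, e) and (x, a), and the coding
    -- carries over.
    module Product (U : Rel) (punU : B2 tt U) (connU : Conn U) (a e : ℕ)
      (least : ∀ z → ¬ U z a ≡ true) (greatest : ∀ z → ¬ U e z ≡ true) where
      abstract
        R : Rel
        R x y = lexB (W (π₁ x) (π₁ y)) (π₁ x ≡ᵇ π₁ y) (U (π₂ x) (π₂ y))

        R→ : ∀ {x y} → R x y ≡ true → π₁ x ≺ π₁ y ⊎ (π₁ x ≡ π₁ y × U (π₂ x) (π₂ y) ≡ true)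
        R→ {x} {y} h = [ inj₁ , (λ (p , q) → inj₂ (ᵇ⇒≡ p , q)) ]′ (lexB-true {W (π₁ x) (π₁ y)} h)

        →R : ∀ {x y} → π₁ x ≺ π₁ y ⊎ (π₁ x ≡ π₁ y × U (π₂ x) (π₂ y) ≡ true) → R x y ≡ true
        →R {x} {y} (inj₁ h) = true-lexB {W (π₁ x) (π₁ y)} {π₁ x ≡ᵇ π₁ y} {U (π₂ x) (π₂ y)} (inj₁ h)
        →R {x} {y} (inj₂ (p , q)) = true-lexB {W (π₁ x) (π₁ y)} (inj₂ (subst (λ d → (π₁ x ≡ᵇ d) ≡ true) p (≡ᵇ-refl (π₁ x)) , q))

        punR : B2 tt R
        punR = orB (app pun (π₁E v0 ∷E π₁E v1 ∷E []E)) (andB (eqB (π₁E v0) (π₁E v1)) (app punU (π₂E v0 ∷E π₂E v1 ∷E []E)))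

      connR : Conn R
      connR x y n with π₁ x ≟ π₁ y
      ... | no m = [ (λ h → inj₁ (→R (inj₁ h))) , (λ h → inj₂ (→R (inj₁ h))) ]′ (proj₂ (proj₂ linear) _ _ m)
      ... | yes q = [ (λ h → inj₁ (→R (inj₂ (q , h)))) , (λ h → inj₂ (→R (inj₂ (sym q , h)))) ]′
        (connU _ _ λ r → n (trans (sym (pair-π x)) (trans (cong₂ pair q r) (pair-π y))))

      isoR : IsoR (ofRel R) (ofRel W ⊗ ofRel U)
      isoR = coded-iso {ofRel W ⊗ ofRel U} (λ (x , y) → pair x y) (λ z → (π₁ z , π₂ z) , pair-π z) λ c c′ → to c c′ , from c c′
        where
        to : ∀ c c′ → R (pair (proj₁ c) (proj₂ c)) (pair (proj₁ c′) (proj₂ c′)) ≡ true → LexLt (ofRel W) (ofRel U) c c′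
        to (x , y) (x′ , y′) h with R→ h
        ... | inj₁ l = inj₁ (trans (sym (cong₂ W (π₁-pair x y) (π₁-pair x′ y′))) l)
        ... | inj₂ (q , l) with trans (sym (π₁-pair x y)) (trans q (π₁-pair x′ y′))
        ... | refl = inj₂ (≺-irr , ≺-irr , trans (sym (cong₂ U (π₂-pair x y) (π₂-pair x′ y′))) l)
        from : ∀ c c′ → LexLt (ofRel W) (ofRel U) c c′ → R (pair (proj₁ c) (proj₂ c)) (pair (proj₁ c′) (proj₂ c′)) ≡ true
        from (x , y) (x′ , y′) (inj₁ l) = →R (inj₁ (trans (cong₂ W (π₁-pair x y) (π₁-pair x′ y′)) l))
        from (x , y) (x′ , y′) (inj₂ (n , m , l)) with cmp x x′
        ... | inj₁ k = ⊥-elim (n k)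
        ... | inj₂ (inj₂ k) = ⊥-elim (m k)
        ... | inj₂ (inj₁ refl) = →R (inj₂ (trans (π₁-pair x y) (sym (π₁-pair x y′)) , trans (cong₂ U (π₂-pair x y) (π₂-pair x y′)) l))

      codesR : Codes f R
      codesR = let (b , g , bE , gE , h) = codes in true , (λ n → pair (b n) a) , (λ n c → g n (π₁ c)) , pairE bE (cst a) , app2 g gE v0 (π₁E v1) ,
        λ n → let (c , adj , v) = h n in pair c e , lift c (b n) adj , trans (cong (g n) (π₁-pair c e)) v
        where
        lift : ∀ c x → Adjacent W c x → Adjacent R (pair c e) (pair x a)
        lift c x (l , none-between) = →R (inj₁ (trans (cong₂ W (π₁-pair c e) (π₁-pair x a)) l)) , λ {z} (p , q) →
          case R→ p of λ
            { (inj₂ (_ , u)) → greatest (π₂ z) (trans (cong (λ w → U w (π₂ z)) (sym (π₂-pair c e))) u)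
            ; (inj₁ u) → case R→ q of λ
              { (inj₂ (_ , w)) → least (π₂ z) (trans (cong (U (π₂ z)) (sym (π₂-pair x a))) w)
              ; (inj₁ w) → none-between {π₁ z} (trans (cong (λ d → W d (π₁ z)) (sym (π₁-pair c e))) u ,
                                                trans (cong (W (π₁ z)) (sym (π₁-pair x a))) w) } }

    coded-ω⊗ : ∀ {X} (x y : C X) → (∀ z → ¬ lt X z x) → (∀ z → ¬ lt X y z) → Pres X Neighbours → Pres (natL ⊗ X) (Codes f)
    coded-ω⊗ {X} x y low high (mkPres U p c (G , t , s , q) _) =
      let (a , ga) = s x ; (e , ge) = s y
          module P = Product U p c a e (λ z h → low _ (proj₁ (q (proj₂ (t z)) ga) h)) (λ z h → high _ (proj₁ (q ge (proj₂ (t z))) h))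
      in mkPres P.R P.punR P.connR (iso-trans {_} {ofRel W ⊗ ofRel U} {_} P.isoR (⊗-iso iso (G , t , s , q))) P.codesR

    pres-fin : ∀ {X} k → Pres X Neighbours → Pres (finL k ⊕ X) Neighbours
    pres-fin {X} zero P = pres-iso (iso-trans {_} {none ⊕ X} {_} (iso-flip none-⊕) (⊕-iso finL-zero iso-refl)) P
    pres-fin {X} (suc k) P = pres-iso
      (iso-trans {_} {(one ⊕ finL k) ⊕ X} {_} (iso-flip (⊕-assoc {one} {finL k} {X})) (⊕-iso finL-suc iso-refl))
      (pres-insert neighbours-stable true (pres-fin k P))

    -- With N = k + 2 and F = Fin N, the copy of η·F is η·F + 1 + W·((N - 1) + η·F + 1):
    -- the last point of each summand and the first N - 1 points of the next one form a block.
    coded-eta : ∀ k → Pres (QL ⊗ finL (suc (suc k))) (Codes f)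
    coded-eta k = pres-iso regroup (pres-sum {natL ⊗ U} {H ⊕ one} (codes-stable f) false
      (coded-ω⊗ {U} (inj₁ zero) (inj₂ (inj₂ tt)) low high (pres-fin (suc k) (pres-insert neighbours-stable false H-pres)))
      (pres-insert neighbours-stable false H-pres))
      where
      N = suc (suc k)
      H U Z : LO
      H = QL ⊗ finL N
      U = finL (suc k) ⊕ (H ⊕ one)
      Z = finL (suc k) ⊕ H
      H-pres : Pres H Neighbours
      H-pres = mkPres R pun′ conn iso′ neighbours
        where open EtaRel (suc k) renaming (pun to pun′; iso to iso′)
      low : ∀ z → ¬ lt U z (inj₁ zero)
      low _ (ll ())
      high : ∀ z → ¬ lt U (inj₂ (inj₂ tt)) z
      high _ (rr (rr ()))
      unit : IsoR (one ⊕ Z) ((one ⊕ QL) ⊗ finL N)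
      unit = iso-trans {_} {(one ⊕ finL (suc k)) ⊕ H} {_} (iso-flip (⊕-assoc {one} {finL (suc k)} {H}))
        (iso-trans {_} {(one ⊗ finL N) ⊕ H} {_} (⊕-iso (iso-trans {_} {finL N} {_} finL-suc (iso-flip one-⊗)) iso-refl)
          (iso-flip ⊗-distrib))
      tail′ : IsoR (one ⊕ natL ⊗ U) ((natL ⊗ (one ⊕ QL)) ⊗ finL N)
      tail′ = iso-trans {_} {one ⊕ natL ⊗ (Z ⊕ one)} {_} (⊕-iso iso-refl (⊗-iso iso-refl (iso-flip (⊕-assoc {finL (suc k)} {H} {one}))))
        (iso-trans {_} {natL ⊗ (one ⊕ Z)} {_} rotate
          (iso-trans {_} {natL ⊗ ((one ⊕ QL) ⊗ finL N)} {_} (⊗-iso iso-refl unit) ⊗-assoc))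
      regroup : IsoR ((H ⊕ one) ⊕ natL ⊗ U) H
      regroup = iso-trans {_} {H ⊕ (one ⊕ natL ⊗ U)} {_} (⊕-assoc {H} {one} {natL ⊗ U})
        (iso-trans {_} {H ⊕ ((natL ⊗ (one ⊕ QL)) ⊗ finL N)} {_} (⊕-iso iso-refl tail′)
          (iso-trans {_} {(QL ⊕ natL ⊗ (one ⊕ QL)) ⊗ finL N} {_} (iso-flip ⊗-distrib) (⊗-iso absorb iso-refl)))

  -- Orders with finitely many adjacencies

  limit-iso : ∀ {X Y} (i : IsoR X Y) → ∀ {x y} → proj₁ i x y → Limit-point Y y → Limit-point X x
  limit-iso {X} {Y} (G , t , s , p) {x} {y} g ((a , ha) , (b , hb) , l , u) =
    (let (x′ , g′) = s a in x′ , proj₂ (p g′ g) ha) , (let (x′ , g′) = s b in x′ , proj₂ (p g g′) hb) ,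
    (λ x₁ h → let (y₁ , g₁) = t x₁ ; (z , q , r) = l y₁ (proj₁ (p g₁ g) h) ; (x′ , g′) = s z in x′ , proj₂ (p g₁ g′) q , proj₂ (p g′ g) r) ,
    (λ x₁ h → let (y₁ , g₁) = t x₁ ; (z , q , r) = u y₁ (proj₁ (p g g₁) h) ; (x′ , g′) = s z in x′ , proj₂ (p g g′) q , proj₂ (p g′ g₁) r)

  -- Equivalently, there are only finitely many adjacencies.
  AlmostLimit : LO → Set
  AlmostLimit X = ∃ λ (S : List (C X)) → ∀ x → x ∈ S ⊎ Limit-point X x

  Simple : Piece → Set
  Simple p = p ≡ pt ⊎ p ≡ eta 0

  almost-limit : ∀ σ → (∀ {p} → p ∈ σ → Simple p) → AlmostLimit (Ts σ)
  almost-limit [] h = [] , λ ()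
  almost-limit (p ∷ σ) h with almost-limit σ (h ∘ there) | piece (h (here refl))
    where
    piece : ∀ {p} → Simple p → AlmostLimit (T p)
    piece (inj₁ refl) = tt ∷ [] , λ _ → inj₁ (here refl)
    piece (inj₂ refl) = [] , λ { (q , zero) → inj₂ (lim q) }
      where
      lim : ∀ q → Limit-point (QL ⊗ finL 1) (q , zero)
      lim q with Q-limit q
      ... | (a , ha) , (b , hb) , l , u = ((a , zero) , inj₁ ha) , ((b , zero) , inj₁ hb) ,
        (λ { (y , zero) (inj₁ h) → let (z , r , s) = l y h in (z , zero) , inj₁ r , inj₁ s }) ,
        (λ { (y , zero) (inj₁ h) → let (z , r , s) = u y h in (z , zero) , inj₁ r , inj₁ s })
  ... | S , k | S′ , k′ = map inj₁ S′ ++ map inj₂ S , λ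
    { (inj₁ x) → [ (λ i → inj₁ (∈-++⁺ˡ (∈-map⁺ inj₁ i))) , (λ (( a , ha) , (b , hb) , l , u) → inj₂ ((inj₁ a , ll ha) , (inj₁ b , ll hb) ,
        (λ { (inj₁ y) (ll h) → let (z , r , s) = l y h in inj₁ z , ll r , ll s }) ,
        λ { (inj₁ y) (ll h) → let (z , r , s) = u y h in inj₁ z , ll r , ll s ; (inj₂ y) lr → inj₁ b , ll hb , lr })) ]′ (k′ x)
    ; (inj₂ x) → [ (λ i → inj₁ (∈-++⁺ʳ (map inj₁ S′) (∈-map⁺ inj₂ i))) , (λ ((a , ha) , (b , hb) , l , u) → inj₂ ((inj₂ a , rr ha) , (inj₂ b , rr hb) ,
        (λ { (inj₁ y) lr → inj₂ a , lr , rr ha ; (inj₂ y) (rr h) → let (z , r , s) = l y h in inj₂ z , rr r , rr s }) ,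
        λ { (inj₂ y) (rr h) → let (z , r , s) = u y h in inj₂ z , rr r , rr s })) ]′ (k x) }

  incomparable : ∀ {A} → IsLinearOrder A → ∀ {x y} → ¬ A x y ≡ true → ¬ A y x ≡ true → x ≡ y
  incomparable (_ , _ , c) {x} {y} n m with x ≟ y
  ... | yes e = e
  ... | no k = ⊥-elim ([ n , m ]′ (c x y k))

  almost-limit-iso : ∀ {L X} → IsLinearOrder L → IsLO X → IsoR (ofRel L) X → AlmostLimit X → AlmostLimit (ofRel L)
  almost-limit-iso {L} {X} linL iX i@(G , t , s , p) (S , h) = map (λ y → proj₁ (s y)) S , λ x →
    let (y , g) = t x in [ (λ m → inj₁ (subst (_∈ _) (sym (same g (proj₂ (s y)))) (∈-map⁺ (λ y → proj₁ (s y)) m))) , (λ l → inj₂ (limit-iso i g l)) ]′ (h y)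
    where
    same : ∀ {x x′ y} → G x y → G x′ y → x ≡ x′
    same g g′ = incomparable linL (irr iX ∘ proj₁ (p g g′)) (irr iX ∘ proj₁ (p g′ g))

  pull-linear : ∀ {B L ψ} → IsIso B L ψ → IsLinearOrder L → IsLinearOrder B
  pull-linear {B} {L} {ψ} (p , inj , _) (i , t , c) = (λ x → trans (p x x) (i _)) ,
    (λ x y z h k → trans (p x z) (t _ _ _ (trans (sym (p x y)) h) (trans (sym (p y z)) k))) ,
    λ x y n → [ (λ h → inj₁ (trans (p x y) h)) , (λ h → inj₂ (trans (p y x) h)) ]′ (c _ _ (n ∘ inj x y))

  code : List (ℕ × ℕ) → ℕ
  code [] = 0
  code ((x , y) ∷ zs) = suc (pair (pair x y) (code zs))

  tail₀ : List (ℕ × ℕ) → List (ℕ × ℕ)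
  tail₀ [] = []
  tail₀ (z ∷ zs) = zs

  drop₀ : ℕ → List (ℕ × ℕ) → List (ℕ × ℕ)
  drop₀ zero zs = zs
  drop₀ (suc i) zs = tail₀ (drop₀ i zs)

  dropCode : ℕ → ℕ → ℕ
  dropCode zero c = c
  dropCode (suc i) c = π₂ (pred (dropCode i c))

  code-tail : ∀ zs → π₂ (pred (code zs)) ≡ code (tail₀ zs)
  -- The pairing is abstract; that `π₂ 0` is 0 follows from π₂ 0 ≤ `pair (π₁ 0) (π₂ 0)`, which is 0.
  code-tail [] = n≤0⇒n≡0 (≤-trans (n≤pair (π₁ 0) (π₂ 0)) (≤-reflexive (pair-π 0)))
  code-tail ((x , y) ∷ zs) = π₂-pair (pair x y) (code zs)

  dropCode-code : ∀ i zs → dropCode i (code zs) ≡ code (drop₀ i zs)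
  dropCode-code zero zs = refl
  dropCode-code (suc i) zs = trans (cong (π₂ ∘ pred) (dropCode-code i zs)) (code-tail (drop₀ i zs))

  drop₀-tail : ∀ i zs → drop₀ i (tail₀ zs) ≡ drop₀ (suc i) zs
  drop₀-tail zero zs = refl
  drop₀-tail (suc i) zs = cong tail₀ (drop₀-tail i zs)

  -- The code of a list exceeds every position in it, so it can bound the search in `fitsB`.
  ∈⇒drop : ∀ {z zs} → z ∈ zs → ∃ λ i → ∃ λ r → i < code zs × drop₀ i zs ≡ z ∷ r
  ∈⇒drop {zs = z ∷ zs} (here refl) = 0 , zs , s≤s z≤n , refl
  ∈⇒drop {zs = (x , y) ∷ zs} (there m) = let (i , r , l , e) = ∈⇒drop m in
    suc i , r , s≤s (≤-trans l (n≤pair (pair x y) (code zs))) , trans (sym (drop₀-tail i _)) e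

  drop⇒∈ : ∀ i {z r} zs → drop₀ i zs ≡ z ∷ r → z ∈ zs
  drop⇒∈ zero (z ∷ zs) refl = here refl
  drop⇒∈ (suc i) [] e = ⊥-elim (nil i e)
    where
    nil : ∀ i {z r} → drop₀ (suc i) [] ≢ z ∷ r
    nil zero ()
    nil (suc i) e with drop₀ i [] | nil i
    ... | [] | _ = case e of λ ()
    ... | _ ∷ [] | n = case e of λ ()
    ... | _ ∷ _ ∷ _ | n = n refl
  drop⇒∈ (suc i) (z ∷ zs) e = there (drop⇒∈ i zs (trans (drop₀-tail i (z ∷ zs)) e))

  sameB : Bool → Bool → Bool
  sameB a b = if a then b else not b

  sameB-≡ : ∀ {a b} → sameB a b ≡ true → a ≡ b
  sameB-≡ {true} {true} h = refl
  sameB-≡ {false} {false} h = refl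

  sameB-refl : ∀ a → sameB a a ≡ true
  sameB-refl true = refl
  sameB-refl false = refl

  ∧-true : ∀ {a b} → a ∧ b ≡ true → a ≡ true × b ≡ true
  ∧-true {true} {true} _ = refl , refl

  abstract
    least : ∀ (p : ℕ → Bool) z → p z ≡ true → ∃ λ z → p z ≡ true × (∀ z′ → z′ < z → p z′ ≡ false)
    least p z h = leastBelow p (suc z) , leastBelow-true p (suc z) (s≤s (≮⇒≥ λ l → true≢false h (leastBelow-min p (suc z) z l))) , leastBelow-min p (suc z)

  -- Least choices make the back-and-forth history computable from the diagram of B.
  module BackForth (B L : Rel) (linL : IsLinearOrder L) (pL : Punctual L) (ψ : ℕ → ℕ) (isoψ : IsIso B L ψ)
    (almost : AlmostLimit (ofRel L)) where

    linB : IsLinearOrder B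
    linB = pull-linear isoψ linL
    X Y : LO
    X = ofRel B
    Y = ofRel L
    iX : IsLO X
    iX = ofRel-isLO linB
    iY : IsLO Y
    iY = ofRel-isLO linL
    S = proj₁ almost

    φ : ℕ → ℕ
    φ = proj₁ (iso-sym {B} {L} ψ isoψ)
    isoφ : IsIso L B φ
    isoφ = proj₁ (proj₂ (iso-sym {B} {L} ψ isoψ))
    φψ : ∀ x → φ (ψ x) ≡ x
    φψ = proj₁ (proj₂ (proj₂ (iso-sym {B} {L} ψ isoψ)))
    ψφ : ∀ y → ψ (φ y) ≡ y
    ψφ = proj₂ (proj₂ (proj₂ (iso-sym {B} {L} ψ isoψ)))

    -- A pair either follows ψ or consists of limit points, which have room on both sides. The
    -- finitely many exceptional points are listed from the start, matched according to ψ.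
    Kind : ℕ × ℕ → Set
    Kind (x , y) = ψ x ≡ y ⊎ (Limit-point X x × Limit-point Y y)

    Inv : List (ℕ × ℕ) → Set
    Inv zs = Pattern X Y zs × (∀ {z} → z ∈ zs → Kind z) × (∀ {c} → c ∈ S → (φ c , c) ∈ zs)

    start : List (ℕ × ℕ)
    start = map (λ c → φ c , c) S

    start-inv : Inv start
    start-inv = (λ i j → pat (∈-map⁻ _ i) (∈-map⁻ _ j)) , (λ i → kind (∈-map⁻ _ i)) , ∈-map⁺ _
      where
      pat : ∀ {z w} → (∃ λ c → c ∈ S × z ≡ (φ c , c)) → (∃ λ c → c ∈ S × w ≡ (φ c , c)) →
        Iff (lt X (proj₁ z) (proj₁ w)) (lt Y (proj₂ z) (proj₂ w))
      pat (c , _ , refl) (d , _ , refl) = trans (proj₁ isoφ c d) , trans (sym (proj₁ isoφ c d))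
      kind : ∀ {z} → (∃ λ c → c ∈ S × z ≡ (φ c , c)) → Kind z
      kind (c , _ , refl) = inj₁ (ψφ c)

    -- A new x or y corresponds to none of the exceptional points, which are listed already, so it
    -- is a limit point. Hence any fitting pair keeps the invariant, and choices can be made by
    -- searching for the least one without testing for limit points.
    inv-∷ : ∀ {zs x y} → Inv zs → Fits X Y x y zs → Inv ((x , y) ∷ zs)
    inv-∷ {zs} {x} {y} (p , k , s) f = pattern-∷ iX iY p f , (λ { (here refl) → kind ; (there i) → k i }) , there ∘ s
      where
      same-x : ∀ {z} → z ∈ zs → y ≡ proj₂ z → x ≡ proj₁ z
      same-x i refl = let (a , b) = f i in incomparable linB (irr iY ∘ proj₁ a) (irr iY ∘ proj₁ b)
      same-y : ∀ {z} → z ∈ zs → x ≡ proj₁ z → y ≡ proj₂ z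
      same-y i refl = let (a , b) = f i in incomparable linL (irr iX ∘ proj₂ a) (irr iX ∘ proj₂ b)
      kind : Kind (x , y)
      kind with lem (∃ λ z → z ∈ zs × x ≡ proj₁ z)
      ... | yes (z , i , e) = subst Kind (cong₂ _,_ (sym e) (sym (same-y i e))) (k i)
      ... | no new with proj₂ almost (ψ x) | proj₂ almost y
      ... | inj₁ m | _ = ⊥-elim (new (_ , s m , sym (φψ x)))
      ... | inj₂ _ | inj₁ m = ⊥-elim (new (_ , s m , same-x (s m) refl))
      ... | inj₂ l | inj₂ l′ = inj₂ (limit-iso (ofIsIso isoψ) refl l , l′)

    -- If the nearest pairs follow h, the image h x lies between; otherwise one of the image points
    -- is a limit point and leaves room on the required side.
    between : ∀ {A D : Rel} → IsLinearOrder A → (h : ℕ → ℕ) → IsIso A D h → ∀ zs → Pattern (ofRel A) (ofRel D) zs →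
      (∀ {z} → z ∈ zs → h (proj₁ z) ≡ proj₂ z ⊎ Limit-point (ofRel D) (proj₂ z)) → ∀ x l u →
      Lower (λ z → A (proj₁ z) x ≡ true) zs l → Lower (λ z → A x (proj₁ z) ≡ true) zs u →
      ∃ λ y → OnJust (λ z → D (proj₂ z) y ≡ true) l × OnJust (λ z → D y (proj₂ z) ≡ true) u
    between linA h ih zs p k x nothing nothing _ _ = h x , tt , tt
    between linA h ih zs p k x (just z) nothing (i , a) _ with k i
    ... | inj₁ refl = h x , trans (sym (proj₁ ih _ _)) a , tt
    ... | inj₂ (_ , (y , b) , _) = y , b , tt
    between linA h ih zs p k x nothing (just z) _ (i , a) with k i
    ... | inj₁ refl = h x , tt , trans (sym (proj₁ ih _ _)) a
    ... | inj₂ ((y , b) , _) = y , tt , b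
    between linA h ih zs p k x (just z) (just w) (i , a) (j , b) with k i | k j
    ... | inj₁ refl | inj₁ refl = h x , trans (sym (proj₁ ih _ _)) a , trans (sym (proj₁ ih _ _)) b
    ... | inj₂ (_ , _ , _ , up) | _ = up (proj₂ w) (proj₁ (p i j) (tr (ofRel-isLO linA) a b))
    ... | inj₁ _ | inj₂ (_ , _ , down , _) = down (proj₂ z) (proj₁ (p i j) (tr (ofRel-isLO linA) a b))

    forth : ∀ zs → Inv zs → ∀ x → ∃ λ y → Fits X Y x y zs
    forth zs (p , k , _) x = extend iX iY zs p x (between linB ψ isoψ zs p (λ i → [ inj₁ , inj₂ ∘ proj₂ ]′ (k i)) x)

    back : ∀ zs → Inv zs → ∀ y → ∃ λ x → Fits X Y x y zs
    back zs (p , k , _) y = let (x , f) = extend iY iX _ p′ y (between linL φ isoφ _ p′ k′ y) in x , fits-swap {X} {Y} f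
      where
      p′ = pattern-swap {X} {Y} p
      k′ : ∀ {z} → z ∈ map swap zs → φ (proj₁ z) ≡ proj₂ z ⊎ Limit-point X (proj₂ z)
      k′ i with ∈-map⁻ swap i
      ... | w , j , refl = [ (λ e → inj₁ (trans (cong φ (sym e)) (φψ _))) , inj₂ ∘ proj₁ ]′ (k j)

    test : ℕ → ℕ → ℕ → ℕ → Bool
    test x y x₁ y₁ = sameB (B x x₁) (L y y₁) ∧ sameB (B x₁ x) (L y₁ y)

    O : Orc (just 2)
    O = diag B

    BE : B2 O B
    BE = orc refl , λ { (x ∷ y ∷ []) → refl }

    LE : B2 O L
    LE = liftE (proj₁ pL , λ { (x ∷ y ∷ []) → proj₂ pL x y })

    abstract
      clash : ℕ → ℕ → ℕ → Bool
      clash x y d = if d ≡ᵇ 0 then false else not (test x y (π₁ (π₁ (pred d))) (π₂ (π₁ (pred d))))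

      bad : ℕ → ℕ → ℕ → ℕ → Bool
      bad x y c i = clash x y (dropCode i c)

      fitsB : ℕ → ℕ → ℕ → Bool
      fitsB x y c = not (leastBelow (bad x y c) c <ᵇ c)

      bad-code : ∀ x y {zs i z r} → drop₀ i zs ≡ z ∷ r → bad x y (code zs) i ≡ not (test x y (proj₁ z) (proj₂ z))
      bad-code x y {zs} {i} {z} {r} e = trans (cong (clash x y) (trans (dropCode-code i zs) (cong code e)))
        (cong₂ (λ a b → not (test x y a b))
          (trans (cong π₁ (π₁-pair (pair (proj₁ z) (proj₂ z)) (code r))) (π₁-pair (proj₁ z) (proj₂ z)))
          (trans (cong π₂ (π₁-pair (pair (proj₁ z) (proj₂ z)) (code r))) (π₂-pair (proj₁ z) (proj₂ z))))

      fitsB⇒ : ∀ {x y} zs → fitsB x y (code zs) ≡ true → Fits X Y x y zs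
      fitsB⇒ {x} {y} zs h {z} m with ∈⇒drop m
      ... | i , r , l , e = let (a , b) = ∧-true good in eq a , eq b
        where
        none-bad : bad x y (code zs) i ≡ false
        none-bad = leastBelow-min (bad x y (code zs)) (code zs) i (<-≤-trans l (≮⇒≥ (ᵇ⇒≮ (not-injective h))))
        good : test x y (proj₁ z) (proj₂ z) ≡ true
        good = not-injective (trans (sym (bad-code x y {zs} {i} e)) none-bad)
        eq : ∀ {a b} → sameB a b ≡ true → Iff (a ≡ true) (b ≡ true)
        eq {a} q with sameB-≡ {a} q
        ... | refl = id , id

      ⇒fitsB : ∀ {x y} zs → Fits X Y x y zs → fitsB x y (code zs) ≡ true
      ⇒fitsB {x} {y} zs f = cong not (≮⇒ᵇ λ l → find (leastBelow (bad x y (code zs)) (code zs)) (leastBelow-true (bad x y (code zs)) (code zs) l))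
        where
        find : ∀ i → bad x y (code zs) i ≡ true → ⊥
        find i h with drop₀ i zs in e
        ... | [] = case trans (sym h) (cong (clash x y) (trans (dropCode-code i zs) (cong code e))) of λ ()
        ... | z ∷ r = let (a , b) = f (drop⇒∈ i zs e) in
          true≢false (trans (cong₂ _∧_ (eq a) (eq b)) refl) (not-injective (trans (sym (bad-code x y {zs} {i} e)) h))
          where
          eq : ∀ {a b} → Iff (a ≡ true) (b ≡ true) → sameB a b ≡ true
          eq {a} q = subst (λ c → sameB a c ≡ true) (Iff-bool q) (sameB-refl a)

      sameE : ∀ {n p q} → EB O n p → EB O n q → EB O n (λ xs → sameB (p xs) (q xs))
      sameE a b = ifB a b (notB b)

      fitsE : EB O 3 (λ xs → fitsB (a0 xs) (a1 xs) (a2 xs))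
      fitsE = notB (anyB {p = λ i xs → bad (a0 xs) (a1 xs) (a2 xs) i} badE v2)
        where
        dropE : E O 4 (λ xs → dropCode (a0 xs) (a3 xs))
        dropE = app2 dropCode (pr v0 (π₂E (predE v1)) (λ i ps → dropCode i (head ps)) (λ _ → refl) (λ _ _ → refl)) v0 v3
        x₁E : E O 4 (λ xs → π₁ (π₁ (pred (dropCode (a0 xs) (a3 xs)))))
        x₁E = π₁E (π₁E (predE dropE))
        y₁E : E O 4 (λ xs → π₂ (π₁ (pred (dropCode (a0 xs) (a3 xs)))))
        y₁E = π₂E (π₁E (predE dropE))
        badE : EB O 4 (λ xs → bad (a1 xs) (a2 xs) (a3 xs) (a0 xs))
        badE = ifB (eqB dropE (cst 0)) falseB (notB (andB
          (sameE (app BE (v1 ∷E x₁E ∷E []E)) (app LE (v2 ∷E y₁E ∷E []E)))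
          (sameE (app BE (x₁E ∷E v1 ∷E []E)) (app LE (y₁E ∷E v2 ∷E []E)))))

    -- z codes the image of n and the preimage of n.
    ok : ℕ → ℕ → ℕ → Bool
    ok z n c = fitsB n (π₁ z) c ∧ fitsB (π₂ z) n (suc (pair (pair n (π₁ z)) c))

    choose : ∀ n zs → Inv zs → ∃ λ z → ok z n (code zs) ≡ true × (∀ z′ → z′ < z → ok z′ n (code zs) ≡ false)
    choose n zs iv = least (λ z → ok z n (code zs)) (pair (proj₁ f) (proj₁ g))
      (trans (cong₂ (λ a b → fitsB n a (code zs) ∧ fitsB b n (suc (pair (pair n a) (code zs)))) (π₁-pair (proj₁ f) (proj₁ g)) (π₂-pair (proj₁ f) (proj₁ g)))
        (cong₂ _∧_ (⇒fitsB zs (proj₂ f)) (⇒fitsB ((n , proj₁ f) ∷ zs) (proj₂ g))))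
      where
      f = forth zs iv n
      g = back _ (inv-∷ iv (proj₂ f)) n

    St : Set
    St = Σ (List (ℕ × ℕ)) Inv

    pick : ℕ → St → ℕ
    pick n (zs , iv) = proj₁ (choose n zs iv)

    next : ℕ → St → St
    next n (zs , iv) = (π₂ z , n) ∷ (n , π₁ z) ∷ zs , inv-∷ (inv-∷ iv (fitsB⇒ zs (proj₁ q))) (fitsB⇒ ((n , π₁ z) ∷ zs) (proj₂ q))
      where
      z = proj₁ (choose n zs iv)
      q = ∧-true {fitsB n (π₁ z) (code zs)} (proj₁ (proj₂ (choose n zs iv)))

    state : ℕ → St
    state zero = start , start-inv
    state (suc n) = next n (state n)

    f : ℕ → ℕ
    f n = π₁ (pick n (state n))

    state-mono : ∀ n d {z} → z ∈ proj₁ (state n) → z ∈ proj₁ (state (d + n))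
    state-mono n zero i = i
    state-mono n (suc d) i = there (there (state-mono n d i))

    pattern₂ : ∀ n m {z w} → z ∈ proj₁ (state n) → w ∈ proj₁ (state m) → Iff (lt X (proj₁ z) (proj₁ w)) (lt Y (proj₂ z) (proj₂ w))
    pattern₂ n m {z} {w} i j = proj₁ (proj₂ (state (m + n))) (state-mono n m i)
      (subst (λ k → w ∈ proj₁ (state k)) (+-comm n m) (state-mono m n j))

    f∈ : ∀ n → (n , f n) ∈ proj₁ (state (suc n))
    f∈ n = there (here refl)

    f-iso : IsIso B L f
    f-iso = toIsIso {B} {L} linB (proj₂ (proj₂ linL)) (iso-fun f sur λ {x} {y} → pattern₂ (suc x) (suc y) (f∈ x) (f∈ y))
      where
      sur : ∀ y → ∃ λ x → f x ≡ y
      sur y = x , incomparable linL (irr iX ∘ proj₂ (pattern₂ (suc x) (suc y) (f∈ x) here′)) (irr iX ∘ proj₂ (pattern₂ (suc y) (suc x) here′ (f∈ x)))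
        where
        x = π₂ (pick y (state y))
        here′ : (x , y) ∈ proj₁ (state (suc y))
        here′ = here refl

    abstract
      failE : EB O 3 (λ xs → not (ok (a0 xs) (a1 xs) (a2 xs)))
      failE = notB (andB (app fitsE (v1 ∷E π₁E v0 ∷E v2 ∷E []E))
        (app fitsE (π₂E v0 ∷E v1 ∷E sucE (pairE (pairE v1 (π₁E v0)) v2) ∷E []E)))

      nextE : E O 3 (λ xs → suc (pair (pair (π₂ (a0 xs)) (a1 xs)) (suc (pair (pair (a1 xs) (π₁ (a0 xs))) (a2 xs)))))
      nextE = sucE (pairE (pairE (π₂E v0) v1) (sucE (pairE (pairE v1 (π₁E v0)) v2)))

      startE : E O 0 (λ _ → code start)
      startE = cst (code start)

      graphE : EB O 2 (λ xs → π₁ (a0 xs) ≡ᵇ a1 xs)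
      graphE = eqB (π₁E v0) v1

    pickT : Rec (just 2) 2
    pickT = mu (embPR (proj₁ failE))

    pick-ev : ∀ n s → Ev O pickT (n ∷ code (proj₁ s) ∷ []) (pick n s)
    pick-ev n (zs , iv) with choose n zs iv
    ... | z , g , below = ev-mu (subst (Ev O _ _) (cong (bit ∘ not) g) (E-ev failE (z ∷ n ∷ code zs ∷ [])))
      λ z′ l → 0 , subst (Ev O _ _) (cong (bit ∘ not) (below z′ l)) (E-ev failE (z′ ∷ n ∷ code zs ∷ []))

    stateT : Rec (just 2) 1
    stateT = prec (embPR (proj₁ startE)) (comp (embPR (proj₁ nextE)) (pickT ∷ proj zero ∷ proj (suc zero) ∷ []))

    state-ev : ∀ n → Ev O stateT (n ∷ []) (code (proj₁ (state n)))
    state-ev zero = ev-prec0 (E-ev startE [])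
    state-ev (suc n) = ev-precS (state-ev n) (ev-comp
      (evs-∷ (pick-ev n (state n)) (evs-∷ ev-proj (evs-∷ ev-proj evs-[]))) (E-ev nextE (_ ∷ n ∷ code (proj₁ (state n)) ∷ [])))

    graphT : Rec (just 2) 2
    graphT = comp (embPR (proj₁ graphE)) (comp pickT (proj zero ∷ comp stateT (proj zero ∷ []) ∷ []) ∷ proj (suc zero) ∷ [])

    graph-ev : ∀ x y → Ev O graphT (x ∷ y ∷ []) (bit (f x ≡ᵇ y))
    graph-ev x y = ev-comp (evs-∷ (ev-comp (evs-∷ ev-proj (evs-∷ (ev-comp (evs-∷ ev-proj evs-[]) (state-ev x)) evs-[]))
      (pick-ev x (state x))) (evs-∷ ev-proj evs-[])) (E-ev graphE (pick x (state x) ∷ y ∷ []))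

    f-computable : Delta1Fun O f
    f-computable = graphT , λ { (x ∷ y ∷ []) →
      (λ { refl → subst (Ev O graphT _) (cong bit (≡ᵇ-refl (f x))) (graph-ev x (f x)) }) ,
      λ n → subst (Ev O graphT _) (cong bit (¬true⇒false {f x ≡ᵇ y} (n ∘ ᵇ⇒≡))) (graph-ev x y) }

  almost-limit⇒delta1 : ∀ {L} → IsLinearOrder L → Punctual L → AlmostLimit (ofRel L) → RelDelta1Cat L
  almost-limit⇒delta1 {L} linL pL al B (ψ , isoψ) = f , f-iso , f-computable
    where open BackForth B L linL pL ψ isoψ al

  -- Recovering a Δ⁰₂ function

  T-isLO : ∀ p → IsLO (T p)
  T-isLO pt = one-isLO
  T-isLO om = natL-isLO
  T-isLO mo = op-isLO natL-isLO
  T-isLO (eta k) = ⊗-isLO QL-isLO finL-isLO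

  Ts-isLO : ∀ σ → IsLO (Ts σ)
  Ts-isLO [] = mkIsLO (λ { {()} }) (λ { {()} }) (λ { {()} })
  Ts-isLO (p ∷ σ) = ⊕-isLO (T-isLO p) (Ts-isLO σ)

  adjacent-iso : ∀ {A B ι} → IsIso A B ι → ∀ {x y} → Adjacent A x y → Adjacent B (ι x) (ι y)
  adjacent-iso {A} {B} {ι} (p , _ , sur) {x} {y} (l , n) = trans (sym (p x y)) l , λ {z} → go z (sur z)
    where
    go : ∀ z → (∃ λ w → ι w ≡ z) → ¬ (B (ι x) z ≡ true × B z (ι y) ≡ true)
    go _ (w , refl) (a , b) = n {w} (trans (p x w) a , trans (p w y) b)

  adjacent-flip : ∀ {A x y} → Adjacent A x y → Adjacent (flip A) y x
  adjacent-flip (l , n) = l , λ {z} (a , b) → n {z} (b , a)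

  pres-punctual : ∀ {X Ψ} (P : Pres X Ψ) → Punctual (Pres.B P)
  pres-punctual P = punctual (Pres.pun P)

  pres-isomorphic : ∀ {L X Ψ} → IsLinearOrder L → IsoR (ofRel L) X → (P : Pres X Ψ) → Isomorphic L (Pres.B P)
  pres-isomorphic {L} {X} linL i P = _ , toIsIso {L} {Pres.B P} linL (Pres.conn P) (iso-trans {_} {X} {_} i (iso-flip (Pres.iso P)))

  module _ (L : Rel) (g : ℕ → ℕ) (cat : InPrCat L g) {X : LO} (linL : IsLinearOrder L) (i : IsoR (ofRel L) X) where
    private
      O : Orc (just 1)
      O v = g (head v)

      reduce : ∀ {f} → f ≤PR g → F1 O f
      reduce (t , p) = t , λ { (x ∷ []) → p x }

    -- f n is computed from the neighbour of b n in C, found through the copy B with computable neighbours.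
    decode : ∀ {f} → Pres X Neighbours → Pres X (Codes f) → f ≤PR g
    decode {f} PB PC with cat (Pres.B PB) (pres-punctual PB) (pres-isomorphic linL i PB)
                        | cat (Pres.B PC) (pres-punctual PC) (pres-isomorphic linL i PC)
    ... | φ , φ⁻ , isoφ , φ⁻φ , φφ⁻ , φ≤ , φ⁻≤ | χ , χ⁻ , isoχ , χ⁻χ , χχ⁻ , χ≤ , χ⁻≤ =
        go (Pres.prop PC)
      where
      B C′ : Rel
      B = Pres.B PB
      C′ = Pres.B PC
      ι κ : ℕ → ℕ
      ι x = φ (χ⁻ x)
      κ y = χ (φ⁻ y)
      κι : ∀ x → κ (ι x) ≡ x
      κι x = trans (cong χ (φ⁻φ (χ⁻ x))) (χχ⁻ x)
      isoχ⁻ : IsIso C′ L χ⁻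
      isoχ⁻ = (λ x y → trans (sym (cong₂ C′ (χχ⁻ x) (χχ⁻ y))) (sym (proj₁ isoχ (χ⁻ x) (χ⁻ y)))) ,
        (λ x y e → trans (sym (χχ⁻ x)) (trans (cong χ e) (χχ⁻ y))) , λ y → χ y , χ⁻χ y
      isoι : IsIso C′ B ι
      isoι = iso-∘ {C′} {L} {B} {χ⁻} {φ} isoχ⁻ isoφ
      compute : ∀ (s b : ℕ → ℕ) (e : ℕ → ℕ → ℕ) → F1 tt s → F1 tt b → F2 tt e → (∀ n → e n (κ (s (ι (b n)))) ≡ f n) → f ≤PR g
      compute s b e sE bE eE h = proj₁ E₀ , λ n → trans (proj₂ E₀ (n ∷ [])) (h n)
        where
        E₀ : F1 O (λ n → e n (κ (s (ι (b n)))))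
        E₀ = app2 e (liftE eE) v0 (app1 χ (reduce χ≤) (app1 φ⁻ (reduce φ⁻≤) (app1 s (liftE sE)
          (app1 φ (reduce φ≤) (app1 χ⁻ (reduce χ⁻≤) (app1 b (liftE bE) v0))))))
      go : Codes f C′ → f ≤PR g
      go (true , b , e , bE , eE , h) = let (p , pE , hp) = proj₂ (Pres.prop PB) in compute p b e pE bE eE λ n →
        let (c , a , v) = h n
            found = hp (ι (b n)) (ι c) (adjacent-flip {B} {ι c} {ι (b n)} (adjacent-iso {C′} {B} {ι} isoι a))
        in trans (cong (e n) (trans (cong κ found) (κι c))) v
      go (false , b , e , bE , eE , h) = let (s , sE , hs) = proj₁ (Pres.prop PB) in compute s b e sE bE eE λ n →
        let (c , a , v) = h n
            found = hs (ι (b n)) (ι c) (adjacent-iso {C′} {B} {ι} isoι (adjacent-flip {flip C′} {c} {b n} a))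
        in trans (cong (e n) (trans (cong κ found) (κι c))) v

  coded : ∀ p → ¬ Simple p → ∀ f F (FE : F2 tt F) (lim : ∀ n → Eventually (λ s → F n s ≡ f n)) → Pres (T p) (Codes f)
  coded pt n = ⊥-elim (n (inj₁ refl))
  coded om n f F FE lim = Coded.coded-om f F FE lim
  coded mo n f F FE lim = Coded.coded-mo f F FE lim
  coded (eta zero) n = ⊥-elim (n (inj₂ refl))
  coded (eta (suc k)) n f F FE lim = Coded.coded-eta f F FE lim k

  -- The pieces that are not `Simple` are those with infinitely many adjacencies, and one of them
  -- suffices for the coding. If there is none, all but finitely many elements of L are limit
  -- points, against the assumption that L is not relatively Δ⁰₁-categorical.
  prcat⇒cone : ∀ L → IsLinearOrder L → Punctual L → RelDelta2Cat L → ¬ RelDelta1Cat L →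
    ∀ g → InPrCat L g → InConeDelta2 g
  prcat⇒cone L linL pL cat ¬cat g prcat f (sigma , _) with classification linL cat
  ... | σ , i with lem (∃ λ p → p ∈ σ × ¬ Simple p)
  ... | yes (p , m , n) = let (F , FE , lim) = limit-lemma f sigma in decode L g prcat linL i
        (pres-list {p = p} neighbours-stable (standard p λ { refl → n (inj₁ refl) }) m)
        (pres-list {p = p} (codes-stable f) (coded p n f F FE lim) m)
  ... | no none = ⊥-elim (¬cat (almost-limit⇒delta1 linL pL
        (almost-limit-iso linL (Ts-isLO σ) i (almost-limit σ simple))))
      where
      simple : ∀ {p} → p ∈ σ → Simple p
      simple {p} m with lem (Simple p)
      ... | yes s = s
      ... | no n = ⊥-elim (none (p , m , n))

theorem3p3 : ((P : Set) → Dec P) →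
    (L : Rel) → IsLinearOrder L → Punctual L →
    RelDelta2Cat L → ¬ RelDelta1Cat L →
    (g : ℕ → ℕ) → (InPrCat L g → InConeDelta2 g) × (InConeDelta2 g → InPrCat L g)
theorem3p3 lem L linL pL cat ¬cat g =
    Classical.prcat⇒cone lem L linL pL cat ¬cat g , Classical.cone⇒prcat lem {L} {g} cat
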